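{- Let $q>2$ be a prime power and $u,v$ non-zero elements of $\mathbb{F}_q$. Write $\mathrm{Rad}(q-1)=k\,p_1\cdots p_s$ with $k$ a divisor and $p_1,\dots,p_s$ distinct primes, and let $\delta_3=1-3\sum_{i=1}^s\frac1{p_i}$. Suppose $\delta_3>0$. Set $\theta=\theta(k)$, $\tau=\tau(k)$, $W=W(k)$ and $\theta_{q-1}=\theta(q-1)$. Then $$N(q,u,v)\ge \theta^2\theta_{q-1}\cdot(q-1)\left\{\delta_3\tau\,q-\theta W^3\sqrt{q}\right\}.$$
   Context: A primitive element of $\mathbb{F}_q$ is a generator of $\mathbb{F}_q^*$. An ordered pair $(a,b)$ of primitive elements is $(u,v)$-primitive if $ua+vb$ and $va^{ -1}+ub^{ -1}$ are both primitive; $N(q,u,v)$ is the number of such pairs. $\mathrm{Rad}(m)$ is the product of the distinct primes dividing $m$; $\omega(m)$ is the number of distinct prime divisors of $m$, $W(m)=2^{\omega(m)}$, $\theta(m)=\phi(m)/m$, $\tau(m)=\prod_{l\mid m}\left(1-\frac{1}{l-1}+\frac{1}{(l-1)^2}\right)$ over distinct primes $l\mid m$. -}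

module Defs where

open import Level using (Level; _⊔_) renaming (suc to lsuc)
open import Data.Nat as ℕ using (ℕ; zero; suc)
open import Data.Nat.Divisibility using (_∣_; _∣?_)
open import Data.Nat.Primality using (Prime; prime?)
open import Data.Nat.ListAction using (product)
open import Data.Nat.Coprimality using (coprime?)
open import Data.Fin using (Fin)
open import Data.List as List using (List; []; _∷_; filter; upTo; applyUpTo; length)
open import Data.List.Relation.Unary.All using (All)
open import Data.List.Relation.Unary.AllPairs using (AllPairs)
open import Data.Integer using (+_)
open import Data.Rational as ℚ using (ℚ; 0ℚ; 1ℚ; _/_)
open import Data.Product using (Σ; _×_; ∃; _,_)
open import Relation.Nullary using (¬_)
open import Relation.Nullary.Decidable using (_×-dec_)
open import Relation.Binary.PropositionalEquality using (_≡_)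
open import Algebra.Bundles using (CommutativeRing)

record FiniteField (c ℓ : Level) (q : ℕ) : Set (lsuc (c ⊔ ℓ)) where
  field
    commRing : CommutativeRing c ℓ
  open CommutativeRing commRing public
  field
    _⁻¹      : Carrier → Carrier
    1≉0      : ¬ (1# ≈ 0#)
    inverseʳ : ∀ x → ¬ (x ≈ 0#) → (x * (x ⁻¹)) ≈ 1#
    enum     : Fin q → Carrier
    enum-inj : ∀ i j → enum i ≈ enum j → i ≡ j
    enum-sur : ∀ x → ∃ λ i → enum i ≈ x

  infixr 8 _^_
  _^_ : Carrier → ℕ → Carrier
  x ^ zero  = 1#
  x ^ suc m = x * (x ^ m)

  IsPrimitive : Carrier → Set (c ⊔ ℓ)
  IsPrimitive a = ¬ (a ≈ 0#) × (∀ x → ¬ (x ≈ 0#) → ∃ λ m → x ≈ (a ^ m))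

  IsUVPrimitive : Carrier → Carrier → Carrier → Carrier → Set (c ⊔ ℓ)
  IsUVPrimitive u v a b =
    IsPrimitive a × IsPrimitive b ×
    IsPrimitive ((u * a) + (v * b)) ×
    IsPrimitive ((v * (a ⁻¹)) + (u * (b ⁻¹)))

  DistinctPairs : Carrier × Carrier → Carrier × Carrier → Set ℓ
  DistinctPairs (a , b) (a′ , b′) = ¬ ((a ≈ a′) × (b ≈ b′))

  -- "N(q,u,v) ≥ B" : there is a list of pairwise distinct (u,v)-primitive
  -- pairs whose length is at least B
  N≥ : Carrier → Carrier → ℚ → Set (c ⊔ ℓ)
  N≥ u v B = Σ (List (Carrier × Carrier)) λ ps →
    AllPairs DistinctPairs ps ×
    All (λ { (a , b) → IsUVPrimitive u v a b }) ps ×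
    B ℚ.≤ ((+ length ps) / 1)

IsPrimePower : ℕ → Set
IsPrimePower q = ∃ λ p → ∃ λ e → Prime p × 1 ℕ.≤ e × q ≡ p ℕ.^ e

-- the distinct primes dividing m (in increasing order), for m ≥ 1
primeDivisors : ℕ → List ℕ
primeDivisors m = filter (λ l → prime? l ×-dec (l ∣? m)) (upTo (suc m))

Rad : ℕ → ℕ
Rad m = product (primeDivisors m)

ω : ℕ → ℕ
ω m = length (primeDivisors m)

W : ℕ → ℚ
W m = (+ (2 ℕ.^ ω m)) / 1

φ : ℕ → ℕ
φ m = length (filter (λ i → coprime? i m) (applyUpTo suc m))

-- θ(m) = φ(m)/m  (m ≥ 1; value at 0 is irrelevant)
θ : ℕ → ℚ
θ zero        = 0ℚ
θ m@(suc _)   = (+ φ m) / m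

-- 1/l as a rational (l ≥ 1; value at 0 irrelevant)
inv : ℕ → ℚ
inv zero        = 0ℚ
inv l@(suc _)   = (+ 1) / l

τ-factor : ℕ → ℚ
τ-factor l = (1ℚ ℚ.- inv (l ℕ.∸ 1)) ℚ.+ inv ((l ℕ.∸ 1) ℕ.* (l ℕ.∸ 1))

τ : ℕ → ℚ
τ m = List.foldr (λ l acc → τ-factor l ℚ.* acc) 1ℚ (primeDivisors m)

δ₃ : List ℕ → ℚ
δ₃ ps = 1ℚ ℚ.- (((+ 3) / 1) ℚ.* List.foldr (λ p acc → inv p ℚ.+ acc) 0ℚ ps)

ℕtoℚ : ℕ → ℚ
ℕtoℚ n = (+ n) / 1

{-# OPTIONS --safe #-}
module Submission where

-- Fix b = g^B primitive and let n = q - 1. Writing u a = v b x and u a + v b = v b (1 + x), the three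
-- remaining conditions say that the logarithms of a, u a + v b and (u a + v b) / (a b) avoid residue 0
-- modulo every prime l | n. The indicator of avoiding residue 0 mod l is (1 - 1/l) (1 - κ), where κ is a
-- normalised positive-definite kernel (the mean of the characters of order l), so that after expanding
-- the conditions for l | k everything reduces to one estimate: for a product Φ of translated κ's, the
-- sum of Φ over the points (x, 1 + x) differs from q times its mean over all pairs of units by at most √q (for q ≥ 4).
-- No complex characters are needed: Φ is a row of a positive-definite kernel, which is tested against the
-- measure Σ_x (x, 1 + x) - (q / n²) Σ - c (point mass), and the resulting quadratic form is evaluated
-- from the number of pairs of points (x, 1 + x) with a given quotient, exactly as for |J(χ, ψ)|² = q.
-- The primes p in ps are sieved out. Their p-th power indicators are 1/p + (1 - 1/p) κ, and averaging
-- over the residue of B mod p, which is non-zero, replaces κ by - κ / (p - 1); this is why the error terms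
-- of the sieve have total weight δ₃ + 3 Σ 1/p = 1.

open import Defs
open import Level using (Level; _⊔_)
open import Data.Nat as ℕ using (ℕ; zero; suc)
open import Data.Nat.Primality using (Prime; prime?; prime[2]; prime⇒irreducible; prime⇒nonTrivial; prime⇒nonZero; euclidsLemma; productOfPrimes≢0)
open import Data.Nat.ListAction using (product)
open import Data.List as List using (List; []; _∷_; _++_; filter; applyUpTo; upTo; cartesianProduct; length)
open import Data.List.Relation.Unary.All as All using (All; []; _∷_)
open import Data.List.Relation.Unary.Unique.Propositional using (Unique)
open import Data.Rational as ℚ using (ℚ; 0ℚ; 1ℚ; mkℚ; _/_)
open import Relation.Nullary using (¬_; Dec; yes; no)
open import Relation.Binary.PropositionalEquality as ≡ using (_≡_; _≢_)
import Data.Nat.Properties as ℕₚ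
import Data.Nat.Divisibility as ℕ∣
import Data.Nat.Coprimality as Coprimality
open import Data.Nat.GCD using (module Bézout; gcd; gcd-GCD; gcd[m,n]∣m; gcd[m,n]∣n)
open import Data.Nat.Induction using (<-rec)
open import Data.Nat.ListAction.Properties using (∈⇒∣product)
open import Data.Nat.Primality.Factorisation using (factorise; factorisationHasAllPrimeFactors)
open import Data.Nat.Tactic.RingSolver using () renaming (solve-∀ to solve-∀-ℕ)
open import Data.Integer as ℤ using (ℤ)
import Data.Integer.Properties as ℤₚ
import Data.Integer.Divisibility.Signed as ℤ∣
open import Data.Integer.Tactic.RingSolver using () renaming (solve-∀ to solve-∀-ℤ)
import Data.Rational.Properties as ℚₚ
open import Data.Fin as Fin using (Fin; punchIn; punchOut)
import Data.Fin.Properties as Finₚ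
open import Data.Fin.Permutation using (permutation)
open import Data.Empty using (⊥; ⊥-elim)
open import Data.Maybe using (Maybe; just; nothing)
open import Data.Product using (_×_; ∃; _,_; proj₁; proj₂)
open import Data.Sum using (_⊎_; inj₁; inj₂)
import Data.List.Properties as Listₚ
import Data.List.Relation.Unary.All.Properties as Allₚ
open import Data.List.Relation.Unary.AllPairs using (AllPairs; []; _∷_)
import Data.List.Relation.Unary.AllPairs.Properties as AllPairsₚ
open import Data.List.Relation.Unary.Any using (here; there)
import Data.List.Relation.Unary.Unique.Propositional.Properties as Uniqueₚ
open import Data.List.Membership.Propositional using (_∈_; _∉_; find)
open import Data.List.Membership.Propositional.Properties using (∈-filter⁺; ∈-filter⁻; ∈-cartesianProduct⁻; ∈-upTo⁺; ∈-upTo⁻)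
open import Relation.Unary using (Pred; Decidable)
open import Relation.Nullary.Decidable using (map′; ¬?; _×-dec_; decidable-stable; toWitness; toWitnessFalse)
import Algebra.Properties.CommutativeMonoid.Sum as CommutativeMonoidSum
import Algebra.Properties.Group as GroupProperties
import Algebra.Solver.Ring.NaturalCoefficients.Default as SemiringSolver
import Relation.Binary.Reasoning.Setoid as SetoidReasoning
import Tactic.RingSolver as RingSolver
import Tactic.RingSolver.Core.AlmostCommutativeRing as ACR

-- Read spectrally, a translation kernel is a weighted mean of pairs (χ, ψ) of characters, and its
-- double sum over the line is the mean of |J|², where J is the sum of χ(x) ψ(1 + x). This |J|² is q
-- if χ, ψ and χψ are nontrivial, 1 if exactly one of them is trivial, and (q - 2)² for the trivial
-- pair. The main term has to be q times the mean, although the line has only q - 2 points with both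
-- coordinates non-zero; measured against q, the trivial pair keeps 2² = 4, and 4 ≤ q is why q = 3
-- is treated apart. No real square root is needed: a point mass c adds 2 c D + c² to the quadratic
-- form, D being the discrepancy, and c = r, c = - r give |D| ≤ r from q ≤ r². The point mass cannot
-- sit at a pair of units. The three conditions are shifts of log x, log (1 + x) and their
-- difference, and a common zero of all three modulo l would force l to divide the logarithm of b,
-- which is prime to n. Hence points have three independent coordinates, and the pairs of units fill
-- only a plane among them.

-- Finite sums and indicators over the rationals.

module RationalSums where
  open ≡ using (refl; sym; trans; cong; cong₂; subst; subst₂)
  open import Data.Rational using (_+_; _*_; _-_; -_; _≤_; _<_)
  open RingSolver using (solve-∀)
  open GroupProperties ℚₚ.+-0-group using () renaming (∙-cancelˡ to +-cancelˡ-≡)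
  open import Data.Integer using (+_)

  isZero? : ∀ x → Maybe (0ℚ ≡ x)
  isZero? x with 0ℚ ℚ.≟ x
  ... | yes p = just p
  ... | no _  = nothing

  ℚ-ring : ACR.AlmostCommutativeRing _ _
  ℚ-ring = ACR.fromCommutativeRing ℚₚ.+-*-commutativeRing isZero?

  ℕtoℚ-mkℚ : ∀ n → ℕtoℚ n ≡ mkℚ (+ n) 0 (Coprimality.sym (Coprimality.1-coprimeTo n))
  ℕtoℚ-mkℚ n = ℚₚ.normalize-coprime (Coprimality.sym (Coprimality.1-coprimeTo n))

  inv-mkℚ : ∀ n → inv (suc n) ≡ mkℚ (+ 1) n (Coprimality.1-coprimeTo (suc n))
  inv-mkℚ n = ℚₚ.normalize-coprime (Coprimality.1-coprimeTo (suc n))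

  -- ℕtoℚ unfolds to a gcd normalisation; ι is its well-behaved synonym.
  ι : ℕ → ℚ
  ι zero    = 0ℚ
  ι (suc n) = ι n + 1ℚ

  ι≡ℕtoℚ : ∀ n → ι n ≡ ℕtoℚ n
  ι≡ℕtoℚ zero = refl
  ι≡ℕtoℚ (suc n) rewrite ι≡ℕtoℚ n | ℕtoℚ-mkℚ n =
    cong (_/ 1) (trans (cong (ℤ._+ ℤ.1ℤ) (ℤₚ.*-identityʳ (+ n))) (cong +_ (ℕₚ.+-comm n 1)))

  ι-+ : ∀ m n → ι (m ℕ.+ n) ≡ ι m + ι n
  ι-+ zero    n = sym (ℚₚ.+-identityˡ (ι n))
  ι-+ (suc m) n = trans (cong (_+ 1ℚ) (ι-+ m n)) (lem (ι m) (ι n))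
    where
    lem : ∀ a b → a + b + 1ℚ ≡ a + 1ℚ + b
    lem = solve-∀ ℚ-ring

  ι-* : ∀ m n → ι (m ℕ.* n) ≡ ι m * ι n
  ι-* zero    n = sym (ℚₚ.*-zeroˡ (ι n))
  ι-* (suc m) n = trans (ι-+ n (m ℕ.* n)) (trans (cong (λ z → ι n + z) (ι-* m n)) (lem (ι m) (ι n)))
    where
    lem : ∀ a b → b + a * b ≡ (a + 1ℚ) * b
    lem = solve-∀ ℚ-ring

  0≤1 : 0ℚ ≤ 1ℚ
  0≤1 = ℚ.*≤* (ℤ.+≤+ ℕ.z≤n)

  0≤ι : ∀ n → 0ℚ ≤ ι n
  0≤ι zero    = ℚₚ.≤-refl
  0≤ι (suc n) = ℚₚ.+-mono-≤ (0≤ι n) 0≤1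

  ι-mono-≤ : ∀ {m n} → m ℕ.≤ n → ι m ≤ ι n
  ι-mono-≤ {n = n} ℕ.z≤n = 0≤ι n
  ι-mono-≤ (ℕ.s≤s m≤n)   = ℚₚ.+-monoˡ-≤ 1ℚ (ι-mono-≤ m≤n)

  0<ι : ∀ n → 0 ℕ.< n → 0ℚ < ι n
  0<ι n 0<n = ℚₚ.<-≤-trans (ℚ.*<* (ℤ.+<+ (ℕ.s≤s ℕ.z≤n))) (ι-mono-≤ 0<n)

  inv-*-ι : ∀ n → 0 ℕ.< n → inv n * ι n ≡ 1ℚ
  inv-*-ι (suc n) _ = trans (cong (inv (suc n) *_) (ι≡ℕtoℚ (suc n))) lem
    where
    lem : inv (suc n) * ℕtoℚ (suc n) ≡ 1ℚ
    lem rewrite ℕtoℚ-mkℚ (suc n) | inv-mkℚ n =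
      ℚₚ.*-inverseˡ (mkℚ (+ suc n) 0 (Coprimality.sym (Coprimality.1-coprimeTo (suc n))))

  0≤inv : ∀ n → 0ℚ ≤ inv n
  0≤inv zero = ℚₚ.≤-refl
  0≤inv (suc n) rewrite inv-mkℚ n = ℚ.*≤* (ℤ.+≤+ ℕ.z≤n)

  /-as-* : ∀ a n → (+ a) / suc n ≡ ι a * inv (suc n)
  /-as-* a n rewrite ι≡ℕtoℚ a | ℕtoℚ-mkℚ a | inv-mkℚ n =
    sym (ℚₚ./-cong (ℤₚ.*-identityʳ (+ a)) (ℕₚ.*-identityˡ (suc n)))

  *-nonneg : ∀ {x y} → 0ℚ ≤ x → 0ℚ ≤ y → 0ℚ ≤ x * y
  *-nonneg {x} {y} p q = subst (_≤ x * y) (ℚₚ.*-zeroʳ x)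
    (ℚₚ.*-monoˡ-≤-nonNeg x {{ℚ.nonNegative p}} q)

  +-nonneg : ∀ {x y} → 0ℚ ≤ x → 0ℚ ≤ y → 0ℚ ≤ x + y
  +-nonneg p q = ℚₚ.+-mono-≤ p q

  *-monoˡ-≤ : ∀ {x y z} → 0ℚ ≤ z → x ≤ y → z * x ≤ z * y
  *-monoˡ-≤ {z = z} p q = ℚₚ.*-monoˡ-≤-nonNeg z {{ℚ.nonNegative p}} q

  ≤-from-diff : ∀ {x y} → 0ℚ ≤ y - x → x ≤ y
  ≤-from-diff {x} {y} p = subst₂ _≤_ (ℚₚ.+-identityʳ x) (lem x y) (ℚₚ.+-monoʳ-≤ x p)
    where
    lem : ∀ x y → x + (y - x) ≡ y
    lem = solve-∀ ℚ-ring

  diff-from-≤ : ∀ {x y} → x ≤ y → 0ℚ ≤ y - x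
  diff-from-≤ {x} {y} p = subst (_≤ y - x) (ℚₚ.+-inverseʳ x) (ℚₚ.+-monoˡ-≤ (- x) p)

  *-cancelˡ-≤ : ∀ {x y z} → 0ℚ < z → z * x ≤ z * y → x ≤ y
  *-cancelˡ-≤ {z = z} p q = ℚₚ.*-cancelˡ-≤-pos z {{ℚ.positive p}} q

  square-nonneg : ∀ x → 0ℚ ≤ x * x
  square-nonneg x with ℚₚ.≤-total 0ℚ x
  ... | inj₁ p = *-nonneg p p
  ... | inj₂ p = subst (0ℚ ≤_) (lem x) (*-nonneg q q)
    where
    q : 0ℚ ≤ - x
    q = ℚₚ.neg-antimono-≤ p
    lem : ∀ x → (- x) * (- x) ≡ x * x
    lem = solve-∀ ℚ-ring

  *-left-comm : ∀ x y z → x * (y * z) ≡ y * (x * z)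
  *-left-comm = solve-∀ ℚ-ring

  ∑ : ℕ → (ℕ → ℚ) → ℚ
  ∑ zero    f = 0ℚ
  ∑ (suc n) f = ∑ n f + f n

  ∑-cong< : ∀ n {f g} → (∀ i → i ℕ.< n → f i ≡ g i) → ∑ n f ≡ ∑ n g
  ∑-cong< zero    eq = refl
  ∑-cong< (suc n) eq =
    cong₂ _+_ (∑-cong< n λ i i<n → eq i (ℕₚ.m≤n⇒m≤1+n i<n)) (eq n ℕₚ.≤-refl)

  ∑-cong : ∀ n {f g} → (∀ i → f i ≡ g i) → ∑ n f ≡ ∑ n g
  ∑-cong n eq = ∑-cong< n λ i _ → eq i

  ∑-+ : ∀ n f g → ∑ n (λ i → f i + g i) ≡ ∑ n f + ∑ n g
  ∑-+ zero    f g = refl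
  ∑-+ (suc n) f g rewrite ∑-+ n f g = lem (∑ n f) (∑ n g) (f n) (g n)
    where
    lem : ∀ a b c d → (a + b) + (c + d) ≡ (a + c) + (b + d)
    lem = solve-∀ ℚ-ring

  ∑-*ˡ : ∀ n c f → ∑ n (λ i → c * f i) ≡ c * ∑ n f
  ∑-*ˡ zero    c f = sym (ℚₚ.*-zeroʳ c)
  ∑-*ˡ (suc n) c f rewrite ∑-*ˡ n c f = sym (ℚₚ.*-distribˡ-+ c (∑ n f) (f n))

  ∑-*ʳ : ∀ n c f → ∑ n (λ i → f i * c) ≡ ∑ n f * c
  ∑-*ʳ n c f = trans (∑-cong n λ i → ℚₚ.*-comm (f i) c) (trans (∑-*ˡ n c f) (ℚₚ.*-comm c _))

  ∑-const : ∀ n c → ∑ n (λ _ → c) ≡ ι n * c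
  ∑-const zero    c = sym (ℚₚ.*-zeroˡ c)
  ∑-const (suc n) c rewrite ∑-const n c = lem (ι n) c
    where
    lem : ∀ a c → a * c + c ≡ (a + 1ℚ) * c
    lem = solve-∀ ℚ-ring

  ∑-zero : ∀ n → ∑ n (λ _ → 0ℚ) ≡ 0ℚ
  ∑-zero n = trans (∑-const n 0ℚ) (ℚₚ.*-zeroʳ (ι n))

  ∑-swap : ∀ m n (f : ℕ → ℕ → ℚ) → ∑ m (λ i → ∑ n (f i)) ≡ ∑ n (λ j → ∑ m (λ i → f i j))
  ∑-swap zero    n f = sym (∑-zero n)
  ∑-swap (suc m) n f rewrite ∑-swap m n f = sym (∑-+ n (λ j → ∑ m (λ i → f i j)) (f m))

  ∑-nonneg : ∀ n {f} → (∀ i → 0ℚ ≤ f i) → 0ℚ ≤ ∑ n f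
  ∑-nonneg zero    p = ℚₚ.≤-refl
  ∑-nonneg (suc n) p = +-nonneg (∑-nonneg n p) (p n)

  ∑-mono< : ∀ n {f g} → (∀ i → i ℕ.< n → f i ≤ g i) → ∑ n f ≤ ∑ n g
  ∑-mono< zero    p = ℚₚ.≤-refl
  ∑-mono< (suc n) p = ℚₚ.+-mono-≤ (∑-mono< n λ i i<n → p i (ℕₚ.m≤n⇒m≤1+n i<n)) (p n ℕₚ.≤-refl)

  ∑-suc : ∀ n f → f 0 + ∑ n (λ i → f (suc i)) ≡ ∑ (suc n) f
  ∑-suc zero    f = ℚₚ.+-comm (f 0) 0ℚ
  ∑-suc (suc n) f = trans (sym (ℚₚ.+-assoc (f 0) _ _)) (cong (_+ f (suc n)) (∑-suc n f))

  -- Shifting by one trades the first term of the window for the term after the last. The sum of n +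
  -- 1 consecutive terms can be split at either end, and periodicity makes the two end terms equal.
  ∑-shift : ∀ n f → (∀ i → f (i ℕ.+ n) ≡ f i) → ∀ c → ∑ n (λ i → f (i ℕ.+ c)) ≡ ∑ n f
  ∑-shift n f per zero    = ∑-cong n λ i → cong f (ℕₚ.+-identityʳ i)
  ∑-shift n f per (suc c) = trans step (∑-shift n f per c)
    where
    g : ℕ → ℚ
    g i = f (i ℕ.+ c)
    cancel : ∀ a b c → a + b ≡ c + a → b ≡ c
    cancel a b c eq = +-cancelˡ-≡ a b c (trans eq (ℚₚ.+-comm c a))
    wrap : g n ≡ g 0
    wrap = trans (cong f (ℕₚ.+-comm n c)) (per c)
    step : ∑ n (λ i → f (i ℕ.+ suc c)) ≡ ∑ n g
    step = trans (∑-cong n λ i → cong f (ℕₚ.+-suc i c))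
      (cancel (g 0) _ _ (trans (∑-suc n g) (cong (λ z → ∑ n g + z) wrap)))

  ∑-single : ∀ n f k → k ℕ.< n → (∀ i → i ℕ.< n → i ≢ k → f i ≡ 0ℚ) → ∑ n f ≡ f k
  ∑-single (suc n) f k k<1+n z with k ℕ.≟ n
  ... | yes refl = trans (cong (_+ f n) (trans (∑-cong< n λ i i<n →
        z i (ℕₚ.m≤n⇒m≤1+n i<n) (ℕₚ.<⇒≢ i<n)) (∑-zero n))) (ℚₚ.+-identityˡ _)
  ... | no k≢n = trans (cong₂ _+_ (∑-single n f k (ℕₚ.≤∧≢⇒< (ℕₚ.≤-pred k<1+n) k≢n)
        λ i i<n → z i (ℕₚ.m≤n⇒m≤1+n i<n)) (z n ℕₚ.≤-refl λ eq → k≢n (sym eq))) (ℚₚ.+-identityʳ _)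

  𝟙 : ∀ {a} {A : Set a} → Dec A → ℚ
  𝟙 (yes _) = 1ℚ
  𝟙 (no  _) = 0ℚ

  𝟙-yes : ∀ {a} {A : Set a} (d : Dec A) → A → 𝟙 d ≡ 1ℚ
  𝟙-yes (yes _) _ = refl
  𝟙-yes (no ¬p) p = ⊥-elim (¬p p)

  𝟙-no : ∀ {a} {A : Set a} (d : Dec A) → ¬ A → 𝟙 d ≡ 0ℚ
  𝟙-no (yes p) ¬p = ⊥-elim (¬p p)
  𝟙-no (no _)  _  = refl

  𝟙-cong : ∀ {a b} {A : Set a} {B : Set b} (d : Dec A) (e : Dec B) →
    (A → B) → (B → A) → 𝟙 d ≡ 𝟙 e
  𝟙-cong (yes p) e f g = sym (𝟙-yes e (f p))
  𝟙-cong (no ¬p) e f g = sym (𝟙-no e λ b → ¬p (g b))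

  𝟙-nonneg : ∀ {a} {A : Set a} (d : Dec A) → 0ℚ ≤ 𝟙 d
  𝟙-nonneg (yes _) = 0≤1
  𝟙-nonneg (no _)  = ℚₚ.≤-refl

  𝟙-× : ∀ {a b} {A : Set a} {B : Set b} (d : Dec A) (e : Dec B) → 𝟙 d * 𝟙 e ≡ 𝟙 (d ×-dec e)
  𝟙-× (yes _) (yes _) = refl
  𝟙-× (yes _) (no _)  = refl
  𝟙-× (no _)  e       = ℚₚ.*-zeroˡ (𝟙 e)

-- Congruences, the kernels `κ`, and products of positive-definite kernels.

module PositiveDefiniteKernels where
  open ≡ using (refl; sym; trans; cong; cong₂; subst; subst₂; module ≡-Reasoning)
  open import Data.Rational using (_+_; _*_; _-_; -_; _≤_; _<_)
  open RingSolver using (solve-∀)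
  open import Data.Integer using (+_)
  open RationalSums

  -- A record rather than bare divisibility, so that `l`, `a`, `b` can be recovered by unification.
  -- The difference is an integer because natural subtraction truncates.
  record Cong (l a b : ℕ) : Set where
    constructor mkCong
    field
      divides : (+ l) ℤ∣.∣ (+ a ℤ.- + b)

  cong? : ∀ l a b → Dec (Cong l a b)
  cong? l a b = map′ mkCong Cong.divides ((+ l) ℤ∣.∣? (+ a ℤ.- + b))

  Cong-reflexive : ∀ {l a b} → a ≡ b → Cong l a b
  Cong-reflexive {l} {a} refl =
    mkCong (ℤ∣.divides (+ 0) (trans (ℤₚ.+-inverseʳ (+ a)) (sym (ℤₚ.*-zeroˡ (+ l)))))

  Cong-refl : ∀ {l} a → Cong l a a
  Cong-refl a = Cong-reflexive refl

  Cong-sym : ∀ {l a b} → Cong l a b → Cong l b a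
  Cong-sym {l} {a} {b} (mkCong p) = mkCong (subst ((+ l) ℤ∣.∣_) (lem (+ a) (+ b)) (ℤ∣.∣m⇒∣-m p))
    where
    lem : ∀ x y → ℤ.- (x ℤ.- y) ≡ y ℤ.- x
    lem = solve-∀-ℤ

  Cong-trans : ∀ {l a b c} → Cong l a b → Cong l b c → Cong l a c
  Cong-trans {l} {a} {b} {c} (mkCong p) (mkCong q) =
    mkCong (subst ((+ l) ℤ∣.∣_) (lem (+ a) (+ b) (+ c)) (ℤ∣.∣m∣n⇒∣m+n p q))
    where
    lem : ∀ x y z → (x ℤ.- y) ℤ.+ (y ℤ.- z) ≡ x ℤ.- z
    lem = solve-∀-ℤ

  Cong-+ : ∀ {l a b c d} → Cong l a b → Cong l c d → Cong l (a ℕ.+ c) (b ℕ.+ d)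
  Cong-+ {l} {a} {b} {c} {d} (mkCong p) (mkCong q) = mkCong (subst ((+ l) ℤ∣.∣_)
    (trans (lem (+ a) (+ b) (+ c) (+ d)) (sym (cong₂ ℤ._-_ (ℤₚ.pos-+ a c) (ℤₚ.pos-+ b d))))
    (ℤ∣.∣m∣n⇒∣m+n p q))
    where
    lem : ∀ x y z w → (x ℤ.- y) ℤ.+ (z ℤ.- w) ≡ (x ℤ.+ z) ℤ.- (y ℤ.+ w)
    lem = solve-∀-ℤ

  Cong-* : ∀ {l a b} c → Cong l a b → Cong l (c ℕ.* a) (c ℕ.* b)
  Cong-* {l} {a} {b} c (mkCong p) = mkCong (subst ((+ l) ℤ∣.∣_)
    (trans (lem (+ a) (+ b) (+ c)) (sym (cong₂ ℤ._-_ (ℤₚ.pos-* c a) (ℤₚ.pos-* c b))))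
    (ℤ∣.∣n⇒∣m*n (+ c) p))
    where
    lem : ∀ x y z → z ℤ.* (x ℤ.- y) ≡ z ℤ.* x ℤ.- z ℤ.* y
    lem = solve-∀-ℤ

  Cong-+ʳ : ∀ {l a b} c → Cong l a b → Cong l (a ℕ.+ c) (b ℕ.+ c)
  Cong-+ʳ c p = Cong-+ p (Cong-refl c)

  Cong-+ˡ : ∀ {l a b} c → Cong l a b → Cong l (c ℕ.+ a) (c ℕ.+ b)
  Cong-+ˡ c p = Cong-+ (Cong-refl c) p

  Cong-cancelʳ : ∀ {l a b} c → Cong l (a ℕ.+ c) (b ℕ.+ c) → Cong l a b
  Cong-cancelʳ {l} {a} {b} c (mkCong p) = mkCong (subst ((+ l) ℤ∣.∣_)
    (trans (cong₂ ℤ._-_ (ℤₚ.pos-+ a c) (ℤₚ.pos-+ b c)) (lem (+ a) (+ b) (+ c))) p)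
    where
    lem : ∀ x y z → (x ℤ.+ z) ℤ.- (y ℤ.+ z) ≡ x ℤ.- y
    lem = solve-∀-ℤ

  Cong-cancelˡ : ∀ {l a b} c → Cong l (c ℕ.+ a) (c ℕ.+ b) → Cong l a b
  Cong-cancelˡ {l} {a} {b} c p =
    Cong-cancelʳ c (subst₂ (Cong l) (ℕₚ.+-comm c a) (ℕₚ.+-comm c b) p)

  ∣⇒Cong0 : ∀ {l a} → l ℕ∣.∣ a → Cong l a 0
  ∣⇒Cong0 {l} {a} p = mkCong (subst ((+ l) ℤ∣.∣_) (sym (ℤₚ.+-identityʳ (+ a))) (ℤ∣.∣ᵤ⇒∣ p))

  Cong0⇒∣ : ∀ {l a} → Cong l a 0 → l ℕ∣.∣ a
  Cong0⇒∣ {l} {a} (mkCong p) = ℤ∣.∣⇒∣ᵤ (subst ((+ l) ℤ∣.∣_) (ℤₚ.+-identityʳ (+ a)) p)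

  Cong-+∣ : ∀ {l} a {m} → l ℕ∣.∣ m → Cong l (a ℕ.+ m) a
  Cong-+∣ {l} a {m} p = subst (Cong l (a ℕ.+ m)) (ℕₚ.+-identityʳ a) (Cong-+ˡ a (∣⇒Cong0 p))

  Cong-∣ : ∀ {l m a b} → l ℕ∣.∣ m → Cong m a b → Cong l a b
  Cong-∣ p (mkCong q) = mkCong (ℤ∣.∣-trans (ℤ∣.∣ᵤ⇒∣ p) q)

  Cong-≤⇒≡ : ∀ {l a b} → a ℕ.≤ b → b ℕ.< l → Cong l b a → a ≡ b
  Cong-≤⇒≡ {l} {a} {b} a≤b b<l (mkCong p) = ℕₚ.≤-antisym a≤b (ℕₚ.m∸n≡0⇒m≤n (b∸a≡0 (b ℕ.∸ a) refl))
    where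
    l∣ : l ℕ∣.∣ b ℕ.∸ a
    l∣ = ℤ∣.∣⇒∣ᵤ (subst ((+ l) ℤ∣.∣_) (trans (ℤₚ.m-n≡m⊖n b a) (ℤₚ.⊖-≥ a≤b)) p)
    b∸a≡0 : ∀ d → b ℕ.∸ a ≡ d → b ℕ.∸ a ≡ 0
    b∸a≡0 zero    eq = eq
    b∸a≡0 (suc d) eq = ⊥-elim (ℕₚ.<⇒≱ (ℕₚ.≤-<-trans (ℕₚ.m∸n≤m b a) b<l)
      (subst (l ℕ.≤_) (sym eq) (ℕ∣.∣⇒≤ (subst (l ℕ∣.∣_) eq l∣))))

  Cong-<⇒≡ : ∀ {l a b} → a ℕ.< l → b ℕ.< l → Cong l a b → a ≡ b
  Cong-<⇒≡ {a = a} {b} a<l b<l p with ℕₚ.≤-total a b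
  ... | inj₁ a≤b = Cong-≤⇒≡ a≤b b<l (Cong-sym p)
  ... | inj₂ b≤a = sym (Cong-≤⇒≡ b≤a a<l p)

  δ : ℕ → ℕ → ℕ → ℚ
  δ l a b = 𝟙 (cong? l a b)

  δ-cong : ∀ l {a b a′ b′} → Cong l a a′ → Cong l b b′ → δ l a b ≡ δ l a′ b′
  δ-cong l {a} {b} {a′} {b′} p q = 𝟙-cong (cong? l a b) (cong? l a′ b′)
    (λ r → Cong-trans (Cong-sym p) (Cong-trans r q))
    (λ r → Cong-trans p (Cong-trans r (Cong-sym q)))

  δ-sym : ∀ l a b → δ l a b ≡ δ l b a
  δ-sym l a b = 𝟙-cong (cong? l a b) (cong? l b a) Cong-sym Cong-sym

  δ-shift : ∀ l a b c → δ l (a ℕ.+ c) (b ℕ.+ c) ≡ δ l a b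
  δ-shift l a b c = 𝟙-cong (cong? l (a ℕ.+ c) (b ℕ.+ c)) (cong? l a b) (Cong-cancelʳ c) (Cong-+ʳ c)

  ∑-δ : ∀ l → 0 ℕ.< l → ∀ a → ∑ l (λ r → δ l r a) ≡ 1ℚ
  ∑-δ l 0<l a = begin
    ∑ l (λ r → δ l r a)         ≡⟨ sym (∑-shift l (λ r → δ l r a) per a) ⟩
    ∑ l (λ r → δ l (r ℕ.+ a) a) ≡⟨ ∑-cong l (λ r → δ-shift l r 0 a) ⟩
    ∑ l (λ r → δ l r 0)         ≡⟨ ∑-single l (λ r → δ l r 0) 0 0<l (λ i i<l i≢0 →
                                     𝟙-no (cong? l i 0) λ p → i≢0 (Cong-<⇒≡ i<l 0<l p)) ⟩
    δ l 0 0                     ≡⟨ 𝟙-yes (cong? l 0 0) (Cong-refl 0) ⟩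
    1ℚ                          ∎
    where
    open ≡-Reasoning
    per : ∀ i → δ l (i ℕ.+ l) a ≡ δ l i a
    per i = δ-cong l (Cong-+∣ i ℕ∣.∣-refl) (Cong-refl a)

  -- κ l a b averages ζ^(a - b) over the primitive l-th roots of unity ζ, for l prime.
  κ : ℕ → ℕ → ℕ → ℚ
  κ l a b = inv (l ℕ.∸ 1) * (ι l * δ l a b - 1ℚ)

  κ-cong : ∀ l {a b a′ b′} → Cong l a a′ → Cong l b b′ → κ l a b ≡ κ l a′ b′
  κ-cong l p q = cong (λ d → inv (l ℕ.∸ 1) * (ι l * d - 1ℚ)) (δ-cong l p q)

  κ-sym : ∀ l a b → κ l a b ≡ κ l b a
  κ-sym l a b = cong (λ d → inv (l ℕ.∸ 1) * (ι l * d - 1ℚ)) (δ-sym l a b)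

  κ-shift : ∀ l a b c → κ l (a ℕ.+ c) (b ℕ.+ c) ≡ κ l a b
  κ-shift l a b c = cong (λ d → inv (l ℕ.∸ 1) * (ι l * d - 1ℚ)) (δ-shift l a b c)

  ι-pred : ∀ l → 1 ℕ.≤ l → ι l ≡ ι (l ℕ.∸ 1) + 1ℚ
  ι-pred (suc l) _ = refl

  κ-diag : ∀ l → 2 ℕ.≤ l → ∀ a → κ l a a ≡ 1ℚ
  κ-diag l 2≤l a = begin
    inv l-1 * (ι l * δ l a a - 1ℚ)           ≡⟨ cong (λ d → inv l-1 * (ι l * d - 1ℚ))
                                                  (𝟙-yes (cong? l a a) (Cong-refl a)) ⟩
    inv l-1 * (ι l * 1ℚ - 1ℚ)                ≡⟨ cong (λ d → inv l-1 * (d * 1ℚ - 1ℚ)) (ι-pred l (ℕₚ.<⇒≤ 2≤l)) ⟩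
    inv l-1 * ((ι l-1 + 1ℚ) * 1ℚ - 1ℚ)       ≡⟨ lem (inv l-1) (ι l-1) ⟩
    inv l-1 * ι l-1                          ≡⟨ inv-*-ι l-1 (ℕₚ.∸-monoˡ-≤ 1 2≤l) ⟩
    1ℚ                                       ∎
    where
    open ≡-Reasoning
    l-1 = l ℕ.∸ 1
    lem : ∀ a b → a * ((b + 1ℚ) * 1ℚ - 1ℚ) ≡ a * b
    lem = solve-∀ ℚ-ring

  κ-feature : ℕ → ℕ → ℕ → ℚ
  κ-feature l c a = ι l * δ l c a - 1ℚ

  -- The vectors `κ-feature l _ a` are `l` times the projections of the basis vectors of ℚ^l
  -- orthogonal to the constants, so their inner products are l² (δ - 1/l); division by l (l - 1)
  -- makes the diagonal 1. This rational Gram form stands in for the decomposition into characters.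
  κ-gram : ∀ l → 2 ℕ.≤ l → ∀ a b →
    κ l a b ≡ (inv (l ℕ.∸ 1) * inv l) * ∑ l (λ c → κ-feature l c a * κ-feature l c b)
  κ-gram l 2≤l a b = sym (begin
    (inv (l ℕ.∸ 1) * inv l) * ∑ l (λ c → κ-feature l c a * κ-feature l c b)
      ≡⟨ cong ((inv (l ℕ.∸ 1) * inv l) *_) total ⟩
    (inv (l ℕ.∸ 1) * inv l) * (ι l * (ι l * δ l a b - 1ℚ))
      ≡⟨ lem₂ (inv (l ℕ.∸ 1)) (inv l) (ι l) (ι l * δ l a b - 1ℚ) ⟩
    (inv l * ι l) * (inv (l ℕ.∸ 1) * (ι l * δ l a b - 1ℚ))
      ≡⟨ cong (_* κ l a b) (inv-*-ι l 0<l) ⟩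
    1ℚ * κ l a b
      ≡⟨ ℚₚ.*-identityˡ (κ l a b) ⟩
    κ l a b ∎)
    where
    open ≡-Reasoning
    0<l : 0 ℕ.< l
    0<l = ℕₚ.<⇒≤ 2≤l
    lem₂ : ∀ u v w x → (u * v) * (w * x) ≡ (v * w) * (u * x)
    lem₂ = solve-∀ ℚ-ring
    δδ : ∀ c → δ l c a * δ l c b ≡ δ l a b * δ l c a
    δδ c with cong? l c a
    ... | no _  = trans (ℚₚ.*-zeroˡ (δ l c b)) (sym (ℚₚ.*-zeroʳ (δ l a b)))
    ... | yes p = trans (ℚₚ.*-identityˡ (δ l c b)) (trans (δ-cong l p (Cong-refl b))
                    (sym (ℚₚ.*-identityʳ (δ l a b))))
    term : ∀ c → κ-feature l c a * κ-feature l c b ≡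
      (ι l * ι l * δ l a b - ι l) * δ l c a + ((- ι l) * δ l c b + 1ℚ)
    term c = trans (lem (ι l) (δ l c a) (δ l c b)) (trans (cong (λ z → (ι l * ι l) * z + ((- ι l) * δ l c a + ((- ι l) * δ l c b + 1ℚ))) (δδ c))
      (lem′ (ι l) (δ l c a) (δ l c b) (δ l a b)))
      where
      lem : ∀ u v w → (u * v - 1ℚ) * (u * w - 1ℚ) ≡ (u * u) * (v * w) + ((- u) * v + ((- u) * w + 1ℚ))
      lem = solve-∀ ℚ-ring
      lem′ : ∀ u v w x → (u * u) * (x * v) + ((- u) * v + ((- u) * w + 1ℚ)) ≡ (u * u * x - u) * v + ((- u) * w + 1ℚ)
      lem′ = solve-∀ ℚ-ring
    total : ∑ l (λ c → κ-feature l c a * κ-feature l c b) ≡ ι l * (ι l * δ l a b - 1ℚ)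
    total = begin
      ∑ l (λ c → κ-feature l c a * κ-feature l c b)
        ≡⟨ ∑-cong l term ⟩
      ∑ l (λ c → A * δ l c a + ((- ι l) * δ l c b + 1ℚ))
        ≡⟨ ∑-+ l (λ c → A * δ l c a) (λ c → (- ι l) * δ l c b + 1ℚ) ⟩
      ∑ l (λ c → A * δ l c a) + ∑ l (λ c → (- ι l) * δ l c b + 1ℚ)
        ≡⟨ cong₂ _+_ (trans (∑-*ˡ l A (λ c → δ l c a)) (cong (A *_) (∑-δ l 0<l a)))
             (trans (∑-+ l (λ c → (- ι l) * δ l c b) (λ _ → 1ℚ))
               (cong₂ _+_ (trans (∑-*ˡ l (- ι l) (λ c → δ l c b)) (cong ((- ι l) *_) (∑-δ l 0<l b)))
                  (∑-const l 1ℚ))) ⟩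
      A * 1ℚ + ((- ι l) * 1ℚ + ι l * 1ℚ)
        ≡⟨ lem (ι l) (δ l a b) ⟩
      ι l * (ι l * δ l a b - 1ℚ) ∎
      where
      A = ι l * ι l * δ l a b - ι l
      lem : ∀ u x → (u * u * x - u) * 1ℚ + ((- u) * 1ℚ + u * 1ℚ) ≡ u * (u * x - 1ℚ)
      lem = solve-∀ ℚ-ring

  -- A functional plays the role of a finite signed measure on X.
  record Functional (X : Set) : Set where
    field
      app       : (X → ℚ) → ℚ
      app-cong  : ∀ {f g} → (∀ x → f x ≡ g x) → app f ≡ app g
      app-+     : ∀ f g → app (λ x → f x + g x) ≡ app f + app g
      app-*     : ∀ c f → app (λ x → c * f x) ≡ c * app f

  open Functional

  app-∑ : ∀ {X} (I : Functional X) n (f : ℕ → X → ℚ) →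
    app I (λ x → ∑ n (λ c → f c x)) ≡ ∑ n (λ c → app I (f c))
  app-∑ I zero    f = trans (app-cong I λ x → sym (ℚₚ.*-zeroˡ 0ℚ))
    (trans (app-* I 0ℚ (λ _ → 0ℚ)) (ℚₚ.*-zeroˡ (app I (λ _ → 0ℚ))))
  app-∑ I (suc n) f = trans (app-+ I (λ x → ∑ n (λ c → f c x)) (f n)) (cong (_+ app I (f n)) (app-∑ I n f))

  reweight : ∀ {X} → (X → ℚ) → Functional X → Functional X
  reweight w I = record
    { app      = λ f → app I (λ x → w x * f x)
    ; app-cong = λ eq → app-cong I λ x → cong (w x *_) (eq x)
    ; app-+    = λ f g → trans (app-cong I λ x → ℚₚ.*-distribˡ-+ (w x) (f x) (g x))
                   (app-+ I (λ x → w x * f x) (λ x → w x * g x))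
    ; app-*    = λ c f → trans (app-cong I λ x → *-left-comm (w x) c (f x)) (app-* I c (λ x → w x * f x))
    }

  -- `I` is applied twice in a fixed order. The Gram forms used are finite sums of products, so the
  -- two applications never have to be exchanged.
  PositiveDefinite : ∀ {X : Set} → (X → X → ℚ) → Set
  PositiveDefinite {X} P = ∀ (I : Functional X) → 0ℚ ≤ app I (λ x → app I (λ y → P x y))

  positiveDefinite-1 : ∀ {X : Set} → PositiveDefinite {X} (λ _ _ → 1ℚ)
  positiveDefinite-1 I = subst (0ℚ ≤_) (sym eq) (square-nonneg (app I (λ _ → 1ℚ)))
    where
    eq : app I (λ x → app I (λ y → 1ℚ)) ≡ app I (λ _ → 1ℚ) * app I (λ _ → 1ℚ)
    eq = trans (app-cong I λ x → sym (ℚₚ.*-identityʳ (app I (λ _ → 1ℚ))))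
      (app-* I (app I (λ _ → 1ℚ)) (λ _ → 1ℚ))

  -- The Schur product argument: the Gram form of `κ` turns the product into a non-negative
  -- combination of values of `P` on `I` reweighted by one feature at a time.
  positiveDefinite-κ : ∀ {X : Set} {P : X → X → ℚ} l → 2 ℕ.≤ l → (φ : X → ℕ) →
    PositiveDefinite P → PositiveDefinite (λ x y → κ l (φ x) (φ y) * P x y)
  positiveDefinite-κ {X} {P} l 2≤l φ pd I = subst (0ℚ ≤_) (sym eq)
    (*-nonneg (*-nonneg (0≤inv (l ℕ.∸ 1)) (0≤inv l)) (∑-nonneg l λ c → pd (reweight (h c) I)))
    where
    open ≡-Reasoning
    C = inv (l ℕ.∸ 1) * inv l
    h : ℕ → X → ℚ
    h c x = κ-feature l c (φ x)
    pw : ∀ x y → κ l (φ x) (φ y) * P x y ≡ C * ∑ l (λ c → h c x * (h c y * P x y))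
    pw x y = begin
      κ l (φ x) (φ y) * P x y                    ≡⟨ cong (_* P x y) (κ-gram l 2≤l (φ x) (φ y)) ⟩
      (C * ∑ l (λ c → h c x * h c y)) * P x y    ≡⟨ ℚₚ.*-assoc C _ (P x y) ⟩
      C * (∑ l (λ c → h c x * h c y) * P x y)    ≡⟨ cong (C *_) (sym (∑-*ʳ l (P x y) (λ c → h c x * h c y))) ⟩
      C * ∑ l (λ c → (h c x * h c y) * P x y)    ≡⟨ cong (C *_) (∑-cong l λ c → ℚₚ.*-assoc (h c x) (h c y) (P x y)) ⟩
      C * ∑ l (λ c → h c x * (h c y * P x y))    ∎
    inner : ∀ x → app I (λ y → κ l (φ x) (φ y) * P x y) ≡
      C * ∑ l (λ c → h c x * app I (λ y → h c y * P x y))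
    inner x = begin
      app I (λ y → κ l (φ x) (φ y) * P x y)
        ≡⟨ app-cong I (pw x) ⟩
      app I (λ y → C * ∑ l (λ c → h c x * (h c y * P x y)))
        ≡⟨ app-* I C (λ y → ∑ l (λ c → h c x * (h c y * P x y))) ⟩
      C * app I (λ y → ∑ l (λ c → h c x * (h c y * P x y)))
        ≡⟨ cong (C *_) (app-∑ I l (λ c y → h c x * (h c y * P x y))) ⟩
      C * ∑ l (λ c → app I (λ y → h c x * (h c y * P x y)))
        ≡⟨ cong (C *_) (∑-cong l λ c → app-* I (h c x) (λ y → h c y * P x y)) ⟩
      C * ∑ l (λ c → h c x * app I (λ y → h c y * P x y)) ∎
    eq : app I (λ x → app I (λ y → κ l (φ x) (φ y) * P x y)) ≡
      C * ∑ l (λ c → app I (λ x → h c x * app I (λ y → h c y * P x y)))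
    eq = begin
      app I (λ x → app I (λ y → κ l (φ x) (φ y) * P x y))
        ≡⟨ app-cong I inner ⟩
      app I (λ x → C * ∑ l (λ c → h c x * app I (λ y → h c y * P x y)))
        ≡⟨ app-* I C (λ x → ∑ l (λ c → h c x * app I (λ y → h c y * P x y))) ⟩
      C * app I (λ x → ∑ l (λ c → h c x * app I (λ y → h c y * P x y)))
        ≡⟨ cong (C *_) (app-∑ I l (λ c x → h c x * app I (λ y → h c y * P x y))) ⟩
      C * ∑ l (λ c → app I (λ x → h c x * app I (λ y → h c y * P x y))) ∎

-- The square-root bound for the points (x, 1 + x).

module JacobiSums where
  open ≡ using (refl; sym; trans; cong; cong₂; subst; subst₂; module ≡-Reasoning)
  open import Data.Rational using (_+_; _*_; _-_; -_; _≤_; _<_)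
  open RingSolver using (solve-∀)
  open RationalSums
  open PositiveDefiniteKernels

  ∑-pick : ∀ n (f : ℕ → ℚ) a → a ℕ.< n → ∑ n (λ i → f i * δ n i a) ≡ f a
  ∑-pick n f a a<n = trans
    (∑-single n (λ i → f i * δ n i a) a a<n (λ i i<n i≢a → trans
      (cong (f i *_) (𝟙-no (cong? n i a) λ p → i≢a (Cong-<⇒≡ i<n a<n p))) (ℚₚ.*-zeroʳ (f i))))
    (trans (cong (f a *_) (𝟙-yes (cong? n a a) (Cong-refl a))) (ℚₚ.*-identityʳ (f a)))

  ∑-sub : ∀ n f g → ∑ n (λ i → f i - g i) ≡ ∑ n f - ∑ n g
  ∑-sub n f g = trans (∑-cong n λ i → lem (f i) (g i))
    (trans (∑-+ n f (λ i → (- 1ℚ) * g i)) (trans (cong (λ z → ∑ n f + z) (∑-*ˡ n (- 1ℚ) g)) (sym (lem (∑ n f) (∑ n g)))))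
    where
    lem : ∀ a b → a - b ≡ a + (- 1ℚ) * b
    lem = solve-∀ ℚ-ring

  ∑∑ : ℕ → (ℕ → ℕ → ℚ) → ℚ
  ∑∑ n f = ∑ n (λ i → ∑ n (f i))

  ∑∑-cong : ∀ n {f g} → (∀ i j → f i j ≡ g i j) → ∑∑ n f ≡ ∑∑ n g
  ∑∑-cong n eq = ∑-cong n λ i → ∑-cong n (eq i)

  ∑∑-+ : ∀ n f g → ∑∑ n (λ i j → f i j + g i j) ≡ ∑∑ n f + ∑∑ n g
  ∑∑-+ n f g = trans (∑-cong n λ i → ∑-+ n (f i) (g i)) (∑-+ n (λ i → ∑ n (f i)) (λ i → ∑ n (g i)))

  ∑∑-sub : ∀ n f g → ∑∑ n (λ i j → f i j - g i j) ≡ ∑∑ n f - ∑∑ n g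
  ∑∑-sub n f g = trans (∑-cong n λ i → ∑-sub n (f i) (g i)) (∑-sub n (λ i → ∑ n (f i)) (λ i → ∑ n (g i)))

  ∑∑-*ˡ : ∀ n c f → ∑∑ n (λ i j → c * f i j) ≡ c * ∑∑ n f
  ∑∑-*ˡ n c f = trans (∑-cong n λ i → ∑-*ˡ n c (f i)) (∑-*ˡ n c (λ i → ∑ n (f i)))

  ∑∑-*ʳ : ∀ n c f → ∑∑ n (λ i j → f i j * c) ≡ ∑∑ n f * c
  ∑∑-*ʳ n c f = trans (∑-cong n λ i → ∑-*ʳ n c (f i)) (∑-*ʳ n c (λ i → ∑ n (f i)))

  ∑∑-const : ∀ n c → ∑∑ n (λ _ _ → c) ≡ ι n * (ι n * c)
  ∑∑-const n c = trans (∑-const n (∑ n (λ _ → c))) (cong (ι n *_) (∑-const n c))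

  ∑∑-∑-swap : ∀ m n (f : ℕ → ℕ → ℕ → ℚ) →
    ∑∑ n (λ i j → ∑ m (f i j)) ≡ ∑ m (λ k → ∑∑ n (λ i j → f i j k))
  ∑∑-∑-swap m n f = trans (∑-cong n λ i → ∑-swap n m (f i)) (∑-swap n m (λ i k → ∑ n (λ j → f i j k)))

  ∑∑-swap : ∀ n (f : ℕ → ℕ → ℕ → ℕ → ℚ) →
    ∑∑ n (λ i j → ∑∑ n (f i j)) ≡ ∑∑ n (λ k l → ∑∑ n (λ i j → f i j k l))
  ∑∑-swap n f = trans (∑∑-∑-swap n n (λ i j k → ∑ n (f i j k)))
    (∑-cong n λ k → ∑∑-∑-swap n n (λ i j → f i j k))

  Periodic : ℕ → (ℕ → ℕ → ℚ) → Set
  Periodic n f = (∀ i j → f (i ℕ.+ n) j ≡ f i j) × (∀ i j → f i (j ℕ.+ n) ≡ f i j)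

  ∑∑-shift : ∀ n f → Periodic n f → ∀ a b → ∑∑ n (λ i j → f (i ℕ.+ a) (j ℕ.+ b)) ≡ ∑∑ n f
  ∑∑-shift n f (per₁ , per₂) a b = trans (∑-cong n λ i → ∑-shift n (f (i ℕ.+ a)) (per₂ (i ℕ.+ a)) b)
    (∑-shift n (λ i → ∑ n (f i)) (λ i → ∑-cong n (per₁ i)) a)

  data Axis : Set where
    fst snd quo : Axis

  Point : Set
  Point = Axis → ℕ

  _⊕_ : Point → Point → Point
  (x ⊕ y) c = x c ℕ.+ y c

  Cong-pt : ℕ → Point → Point → Set
  Cong-pt n x y = ∀ c → Cong n (x c) (y c)

  origin : Point
  origin _ = 0

  record TranslationKernel (n : ℕ) (P : Point → Point → ℚ) : Set where
    field
      positive : PositiveDefinite P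
      symm     : ∀ x y → P x y ≡ P y x
      diag     : ∀ x → P x x ≡ 1ℚ
      shift    : ∀ x y z → P (x ⊕ z) (y ⊕ z) ≡ P x y
      respects : ∀ {x y x′ y′} → Cong-pt n x x′ → Cong-pt n y y′ → P x y ≡ P x′ y′

  GoodModulus : ℕ → ℕ → Set
  GoodModulus n l = 2 ℕ.≤ l × l ℕ∣.∣ n

  kernel : List (ℕ × Axis) → Point → Point → ℚ
  kernel []             x y = 1ℚ
  kernel ((l , c) ∷ fs) x y = κ l (x c) (y c) * kernel fs x y

  kernel-translation : ∀ n {fs} → All (λ f → GoodModulus n (proj₁ f)) fs → TranslationKernel n (kernel fs)
  kernel-translation n [] = record
    { positive = positiveDefinite-1
    ; symm     = λ _ _ → refl
    ; diag     = λ _ → refl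
    ; shift    = λ _ _ _ → refl
    ; respects = λ _ _ → refl
    }
  kernel-translation n {(l , c) ∷ fs} ((2≤l , l∣n) ∷ good) = record
    { positive = positiveDefinite-κ l 2≤l (λ x → x c) positive
    ; symm     = λ x y → cong₂ _*_ (κ-sym l (x c) (y c)) (symm x y)
    ; diag     = λ x → cong₂ _*_ (κ-diag l 2≤l (x c)) (diag x)
    ; shift    = λ x y z → cong₂ _*_ (κ-shift l (x c) (y c) (z c)) (shift x y z)
    ; respects = λ p q → cong₂ _*_ (κ-cong l (Cong-∣ l∣n (p c)) (Cong-∣ l∣n (q c))) (respects p q)
    }
    where open TranslationKernel (kernel-translation n good)

  -- The quotient y / x of the elements with logarithms i and j has logarithm j - i mod n.
  pt : ℕ → ℕ → ℕ → Point
  pt n i j fst = i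
  pt n i j snd = j
  pt n i j quo = j ℕ.+ (n ℕ.∸ 1) ℕ.* i

  pt-⊕ : ∀ n i j i′ j′ c → pt n (i ℕ.+ i′) (j ℕ.+ j′) c ≡ (pt n i j ⊕ pt n i′ j′) c
  pt-⊕ n i j i′ j′ fst = refl
  pt-⊕ n i j i′ j′ snd = refl
  pt-⊕ n i j i′ j′ quo = lem (n ℕ.∸ 1) i j i′ j′
    where
    open import Data.Nat.Tactic.RingSolver using () renaming (solve-∀ to solve-∀-ℕ)
    lem : ∀ m i j i′ j′ → (j ℕ.+ j′) ℕ.+ m ℕ.* (i ℕ.+ i′) ≡ (j ℕ.+ m ℕ.* i) ℕ.+ (j′ ℕ.+ m ℕ.* i′)
    lem = solve-∀-ℕ

  pt-cong : ∀ n {l i i′ j j′} → Cong l i i′ → Cong l j j′ → Cong-pt l (pt n i j) (pt n i′ j′)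
  pt-cong n p q fst = p
  pt-cong n p q snd = q
  pt-cong n p q quo = Cong-+ q (Cong-* (n ℕ.∸ 1) p)

  -- Since q ≤ r², the hypothesis makes 2 r² + 2 r D non-negative. This is Cauchy-Schwarz with the
  -- rational `r` in place of the optimal √q.
  double : ∀ r → 0ℚ < r → ∀ D q → q ≤ r * r →
    (0ℚ ≤ q + (r + r) * D + r * r) → - D ≤ r
  double r 0<r D q q≤rr p = *-cancelˡ-≤ {z = r + r} (ℚₚ.+-mono-< 0<r 0<r) (≤-from-diff
    (subst (0ℚ ≤_) (lem r D) (ℚₚ.≤-trans p (ℚₚ.+-monoˡ-≤ (r * r) (ℚₚ.+-monoˡ-≤ ((r + r) * D) q≤rr)))))
    where
    lem : ∀ r D → r * r + (r + r) * D + r * r ≡ (r + r) * r - (r + r) * (- D)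
    lem = solve-∀ ℚ-ring

  -- The logarithms (i , j) of the points (x , 1 + x) of the affine line have these correlations.
  record LineCorrelation (n : ℕ) (K : ℕ → ℕ → ℚ) : Set where
    field
      K-periodic    : Periodic n K
      ∑∑K           : ∑∑ n K ≡ ι n - 1ℚ
      K-correlation : ∀ s t → ∑∑ n (λ i j → K i j * K (i ℕ.+ s) (j ℕ.+ t)) ≡
        (ι n + 1ℚ) * (δ n s 0 * δ n t 0) + 1ℚ - δ n t s - δ n s 0 - δ n t 0

  deviation : ℕ → (ℕ → ℕ → ℚ) → ℚ → (ℕ → ℕ → ℚ) → ℚ
  deviation n K β f = ∑∑ n (λ i j → K i j * f i j) - β * ∑∑ n f

  -- q / n², the mass of each pair of units when the whole has mass q.
  density : ℕ → ℚ
  density n = (ι n + 1ℚ) * (inv n * inv n)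

  discrepancy : ℕ → (ℕ → ℕ → ℚ) → (ℕ → ℕ → ℚ) → ℚ
  discrepancy n K = deviation n K (density n)

  module JacobiBound
    (n : ℕ) (3≤n : 3 ℕ.≤ n)
    {K : ℕ → ℕ → ℚ} (K-line : LineCorrelation n K)
    {P : Point → Point → ℚ} (P-kernel : TranslationKernel n P)
    where

    open TranslationKernel P-kernel
    open LineCorrelation K-line
    open ≡-Reasoning

    0<n : 0 ℕ.< n
    0<n = ℕₚ.≤-trans (ℕ.s≤s ℕ.z≤n) 3≤n

    p : ℕ → ℕ → Point
    p = pt n

    Ψ : ℕ → ℕ → ℚ
    Ψ i j = P (p i j) origin

    M : ℚ
    M = ∑∑ n Ψ

    add-n : ∀ i → Cong n (i ℕ.+ n) i
    add-n i = Cong-+∣ i ℕ∣.∣-refl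

    P-periodic : ∀ z → Periodic n (λ i j → P (p i j) z)
    P-periodic z = (λ i j → respects (pt-cong n (add-n i) (Cong-refl j)) (λ c → Cong-refl (z c)))
                 , (λ i j → respects (pt-cong n (Cong-refl i) (add-n j)) (λ c → Cong-refl (z c)))

    P-translate : ∀ i j i′ j′ → P (p (i ℕ.+ i′) (j ℕ.+ j′)) (p i′ j′) ≡ Ψ i j
    P-translate i j i′ j′ = trans
      (respects (λ c → Cong-reflexive (pt-⊕ n i j i′ j′ c)) (λ c → Cong-refl (p i′ j′ c)))
      (shift (p i j) origin (p i′ j′))

    ∑∑P : ∀ i′ j′ → ∑∑ n (λ i j → P (p i j) (p i′ j′)) ≡ M
    ∑∑P i′ j′ = trans (sym (∑∑-shift n (λ i j → P (p i j) (p i′ j′)) (P-periodic (p i′ j′)) i′ j′))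
      (∑∑-cong n λ i j → P-translate i j i′ j′)

    ∑∑P′ : ∀ i j → ∑∑ n (λ i′ j′ → P (p i j) (p i′ j′)) ≡ M
    ∑∑P′ i j = trans (∑∑-cong n λ i′ j′ → symm (p i j) (p i′ j′)) (∑∑P i j)

    ray : ℕ → ℕ → ℕ → Point
    ray a b s = p (a ℕ.* s) (b ℕ.* s)

    -- Spectrally, `n` times the weight of the characters trivial on the direction (a, b). The
    -- directions (1, 0), (0, 1), (1, 1) detect trivial χ, ψ, χψ, and `M` is n² times the weight of
    -- the trivial pair.
    line : ℕ → ℕ → ℚ
    line a b = ∑ n (λ s → Ψ (a ℕ.* s) (b ℕ.* s))

    lineTest : ℕ → ℕ → Functional Point
    lineTest a b = record
      { app      = λ f → ι n * ∑ n (λ s → f (ray a b s)) - ∑∑ n (λ i j → f (p i j))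
      ; app-cong = λ eq → cong₂ (λ x y → ι n * x - y)
                     (∑-cong n λ s → eq (ray a b s)) (∑∑-cong n λ i j → eq (p i j))
      ; app-+    = λ f g → trans (cong₂ (λ x y → ι n * x - y)
                     (∑-+ n (λ s → f (ray a b s)) (λ s → g (ray a b s)))
                     (∑∑-+ n (λ i j → f (p i j)) (λ i j → g (p i j))))
                     (lem₁ (ι n) (∑ n (λ s → f (ray a b s))) (∑ n (λ s → g (ray a b s)))
                       (∑∑ n (λ i j → f (p i j))) (∑∑ n (λ i j → g (p i j))))
      ; app-*    = λ c f → trans (cong₂ (λ x y → ι n * x - y)
                     (∑-*ˡ n c (λ s → f (ray a b s))) (∑∑-*ˡ n c (λ i j → f (p i j))))
                     (lem₂ (ι n) c (∑ n (λ s → f (ray a b s))) (∑∑ n (λ i j → f (p i j))))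
      }
      where
      lem₁ : ∀ n x y z w → n * (x + y) - (z + w) ≡ (n * x - z) + (n * y - w)
      lem₁ = solve-∀ ℚ-ring
      lem₂ : ∀ n c x y → n * (c * x) - c * y ≡ c * (n * x - y)
      lem₂ = solve-∀ ℚ-ring

    -- The characters trivial on the ray include the trivial pair. Testing the kernel on `n` times
    -- the ray minus the whole plane, a measure of total mass zero, gives n² (n · line - M) ≥ 0.
    line-bound : ∀ a b → M ≤ ι n * line a b
    line-bound a b = *-cancelˡ-≤ (0<ι n 0<n) (*-cancelˡ-≤ (0<ι n 0<n)
      (≤-from-diff (subst (0ℚ ≤_) eq (positive (lineTest a b)))))
      where
      L : ℚ
      L = line a b
      onLine : ∀ s′ → ∑ n (λ s → P (ray a b s) (ray a b s′)) ≡ L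
      onLine s′ = trans (sym (∑-shift n f per s′)) (∑-cong n λ s → trans
          (cong₂ (λ x y → P (p x y) (ray a b s′)) (ℕₚ.*-distribˡ-+ a s s′) (ℕₚ.*-distribˡ-+ b s s′))
          (P-translate (a ℕ.* s) (b ℕ.* s) (a ℕ.* s′) (b ℕ.* s′)))
        where
        f : ℕ → ℚ
        f s = P (ray a b s) (ray a b s′)
        per : ∀ s → f (s ℕ.+ n) ≡ f s
        per s = respects (pt-cong n (Cong-* a (add-n s)) (Cong-* b (add-n s)))
          (λ c → Cong-refl (p (a ℕ.* s′) (b ℕ.* s′) c))
      onLine′ : ∀ s → ∑ n (λ s′ → P (ray a b s) (ray a b s′)) ≡ L
      onLine′ s = trans (∑-cong n λ s′ → symm _ _) (onLine s)
      mixed : ∑∑ n (λ i j → ∑ n (λ s → P (p i j) (ray a b s))) ≡ ι n * M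
      mixed = trans (∑∑-∑-swap n n (λ i j s → P (p i j) (ray a b s)))
        (trans (∑-cong n λ s → ∑∑P (a ℕ.* s) (b ℕ.* s)) (∑-const n M))
      eq : Functional.app (lineTest a b) (λ x → Functional.app (lineTest a b) (λ y → P x y)) ≡
        ι n * (ι n * (ι n * L)) - ι n * (ι n * M)
      eq = begin
        ι n * ∑ n (λ s → ι n * ∑ n (λ s′ → P (ray a b s) (ray a b s′))
                   - ∑∑ n (λ i j → P (ray a b s) (p i j)))
          - ∑∑ n (λ i j → ι n * ∑ n (λ s → P (p i j) (ray a b s))
                   - ∑∑ n (λ i′ j′ → P (p i j) (p i′ j′)))
          ≡⟨ cong₂ (λ x y → ι n * x - y)
               (∑-cong n λ s → cong₂ (λ x y → ι n * x - y) (onLine′ s) (∑∑P′ (a ℕ.* s) (b ℕ.* s)))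
               (∑∑-cong n λ i j → cong (λ y → ι n * ∑ n (λ s → P (p i j) (ray a b s)) - y) (∑∑P′ i j)) ⟩
        ι n * ∑ n (λ s → ι n * L - M)
          - ∑∑ n (λ i j → ι n * ∑ n (λ s → P (p i j) (ray a b s)) - M)
          ≡⟨ cong₂ (λ x y → ι n * x - y) (∑-const n (ι n * L - M))
               (trans (∑∑-sub n (λ i j → ι n * ∑ n (λ s → P (p i j) (ray a b s))) (λ _ _ → M))
                 (cong₂ _-_ (trans (∑∑-*ˡ n (ι n) (λ i j → ∑ n (λ s → P (p i j) (ray a b s))))
                               (cong (ι n *_) mixed))
                            (∑∑-const n M))) ⟩
        ι n * (ι n * (ι n * L - M)) - (ι n * (ι n * M) - ι n * (ι n * M))
          ≡⟨ lem (ι n) L M ⟩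
        ι n * (ι n * (ι n * L)) - ι n * (ι n * M) ∎
        where
        lem : ∀ n L M → n * (n * (n * L - M)) - (n * (n * M) - n * (n * M)) ≡ n * (n * (n * L)) - n * (n * M)
        lem = solve-∀ ℚ-ring

    -- The weighted mean of |J(χ, ψ)|²: q for every pair, minus n for each of χ, ψ, χψ that is
    -- trivial, plus n² when all three are. This leaves q - n = 1 for one trivial character and q +
    -- n² - 3 n = (n - 1)² for the trivial pair.
    energy : ℚ
    energy = ι n + 1ℚ + M - line 1 1 - line 0 1 - line 1 0

    ∑∑KKP : ∑∑ n (λ i j → K i j * ∑∑ n (λ i′ j′ → K i′ j′ * P (p i j) (p i′ j′))) ≡ energy
    ∑∑KKP = begin
      ∑∑ n (λ i j → K i j * ∑∑ n (λ i′ j′ → K i′ j′ * P (p i j) (p i′ j′)))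
        -- Writing the second point as (s + i, t + j) makes the kernel depend on (s, t) alone, so
        -- the sum over (i, j) becomes a correlation of `K`.
        ≡⟨ (∑∑-cong n λ i j → cong (K i j *_) (recentre i j)) ⟩
      ∑∑ n (λ i j → K i j * ∑∑ n (λ s t → K (s ℕ.+ i) (t ℕ.+ j) * Ψ s t))
        ≡⟨ (∑∑-cong n λ i j → sym (∑∑-*ˡ n (K i j) (λ s t → K (s ℕ.+ i) (t ℕ.+ j) * Ψ s t))) ⟩
      ∑∑ n (λ i j → ∑∑ n (λ s t → K i j * (K (s ℕ.+ i) (t ℕ.+ j) * Ψ s t)))
        ≡⟨ ∑∑-swap n (λ i j s t → K i j * (K (s ℕ.+ i) (t ℕ.+ j) * Ψ s t)) ⟩
      ∑∑ n (λ s t → ∑∑ n (λ i j → K i j * (K (s ℕ.+ i) (t ℕ.+ j) * Ψ s t)))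
        ≡⟨ (∑∑-cong n λ s t → trans (∑∑-cong n λ i j → reorder i j s t)
             (trans (∑∑-*ˡ n (Ψ s t) (λ i j → K i j * K (i ℕ.+ s) (j ℕ.+ t)))
               (cong (Ψ s t *_) (K-correlation s t)))) ⟩
      ∑∑ n (λ s t → Ψ s t * ((ι n + 1ℚ) * (δ n s 0 * δ n t 0) + 1ℚ - δ n t s - δ n s 0 - δ n t 0))
        ≡⟨ (∑∑-cong n λ s t → spread (ι n + 1ℚ) (Ψ s t) (δ n s 0) (δ n t 0) (δ n t s)) ⟩
      ∑∑ n (λ s t → Ψ s t * δ n t 0 * ((ι n + 1ℚ) * δ n s 0) + Ψ s t - Ψ s t * δ n t s - Ψ s t * δ n s 0 - Ψ s t * δ n t 0)
        ≡⟨ split ⟩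
      ∑∑ n (λ s t → Ψ s t * δ n t 0 * ((ι n + 1ℚ) * δ n s 0)) + M - ∑∑ n (λ s t → Ψ s t * δ n t s)
        - ∑∑ n (λ s t → Ψ s t * δ n s 0) - ∑∑ n (λ s t → Ψ s t * δ n t 0)
        ≡⟨ cong₂ _-_ (cong₂ _-_ (cong₂ _-_ (cong (_+ M) atOrigin) onDiagonal) onSnd) onFst ⟩
      ι n + 1ℚ + M - line 1 1 - line 0 1 - line 1 0 ∎
      where
      recentre : ∀ i j → ∑∑ n (λ i′ j′ → K i′ j′ * P (p i j) (p i′ j′)) ≡
        ∑∑ n (λ s t → K (s ℕ.+ i) (t ℕ.+ j) * Ψ s t)
      recentre i j = trans (sym (∑∑-shift n (λ i′ j′ → K i′ j′ * P (p i j) (p i′ j′)) per i j))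
        (∑∑-cong n λ s t → cong (K (s ℕ.+ i) (t ℕ.+ j) *_)
          (trans (symm (p i j) (p (s ℕ.+ i) (t ℕ.+ j))) (P-translate s t i j)))
        where
        per : Periodic n (λ i′ j′ → K i′ j′ * P (p i j) (p i′ j′))
        per = (λ i′ j′ → cong₂ _*_ (proj₁ K-periodic i′ j′)
                 (respects (λ c → Cong-refl (p i j c)) (pt-cong n (add-n i′) (Cong-refl j′))))
            , (λ i′ j′ → cong₂ _*_ (proj₂ K-periodic i′ j′)
                 (respects (λ c → Cong-refl (p i j c)) (pt-cong n (Cong-refl i′) (add-n j′))))
      reorder : ∀ i j s t → K i j * (K (s ℕ.+ i) (t ℕ.+ j) * Ψ s t) ≡ Ψ s t * (K i j * K (i ℕ.+ s) (j ℕ.+ t))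
      reorder i j s t = trans (lem (K i j) (K (s ℕ.+ i) (t ℕ.+ j)) (Ψ s t))
        (cong (λ z → Ψ s t * (K i j * z)) (cong₂ K (ℕₚ.+-comm s i) (ℕₚ.+-comm t j)))
        where
        lem : ∀ a b c → a * (b * c) ≡ c * (a * b)
        lem = solve-∀ ℚ-ring
      spread : ∀ q Ψ a b d → Ψ * (q * (a * b) + 1ℚ - d - a - b) ≡ Ψ * b * (q * a) + Ψ - Ψ * d - Ψ * a - Ψ * b
      spread = solve-∀ ℚ-ring
      split : ∑∑ n (λ s t → Ψ s t * δ n t 0 * ((ι n + 1ℚ) * δ n s 0) + Ψ s t - Ψ s t * δ n t s - Ψ s t * δ n s 0 - Ψ s t * δ n t 0) ≡
        ∑∑ n (λ s t → Ψ s t * δ n t 0 * ((ι n + 1ℚ) * δ n s 0)) + M - ∑∑ n (λ s t → Ψ s t * δ n t s)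
        - ∑∑ n (λ s t → Ψ s t * δ n s 0) - ∑∑ n (λ s t → Ψ s t * δ n t 0)
      split = trans (∑∑-sub n (λ s t → f₁ s t + Ψ s t - f₂ s t - f₃ s t) f₄)
        (cong (_- ∑∑ n f₄) (trans (∑∑-sub n (λ s t → f₁ s t + Ψ s t - f₂ s t) f₃)
        (cong (_- ∑∑ n f₃) (trans (∑∑-sub n (λ s t → f₁ s t + Ψ s t) f₂)
        (cong (_- ∑∑ n f₂) (∑∑-+ n f₁ Ψ))))))
        where
        f₁ f₂ f₃ f₄ : ℕ → ℕ → ℚ
        f₁ s t = Ψ s t * δ n t 0 * ((ι n + 1ℚ) * δ n s 0)
        f₂ s t = Ψ s t * δ n t s
        f₃ s t = Ψ s t * δ n s 0
        f₄ s t = Ψ s t * δ n t 0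
      onFst : ∑∑ n (λ s t → Ψ s t * δ n t 0) ≡ line 1 0
      onFst = ∑-cong n λ s → trans (∑-pick n (Ψ s) 0 0<n) (cong (λ z → Ψ z 0) (sym (ℕₚ.+-identityʳ s)))
      onDiagonal : ∑∑ n (λ s t → Ψ s t * δ n t s) ≡ line 1 1
      onDiagonal = ∑-cong< n λ s s<n → trans (∑-pick n (Ψ s) s s<n)
        (cong₂ Ψ (sym (ℕₚ.+-identityʳ s)) (sym (ℕₚ.+-identityʳ s)))
      onSnd : ∑∑ n (λ s t → Ψ s t * δ n s 0) ≡ line 0 1
      onSnd = trans (∑-cong n λ s → ∑-*ʳ n (δ n s 0) (Ψ s))
        (trans (∑-pick n (λ s → ∑ n (Ψ s)) 0 0<n) (∑-cong n λ t → cong (Ψ 0) (sym (ℕₚ.+-identityʳ t))))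
      atOrigin : ∑∑ n (λ s t → Ψ s t * δ n t 0 * ((ι n + 1ℚ) * δ n s 0)) ≡ ι n + 1ℚ
      atOrigin = begin
        ∑∑ n (λ s t → Ψ s t * δ n t 0 * ((ι n + 1ℚ) * δ n s 0))
          ≡⟨ (∑-cong n λ s → trans (∑-*ʳ n ((ι n + 1ℚ) * δ n s 0) (λ t → Ψ s t * δ n t 0))
               (trans (cong (_* ((ι n + 1ℚ) * δ n s 0)) (∑-pick n (Ψ s) 0 0<n))
                 (*-left-comm (Ψ s 0) (ι n + 1ℚ) (δ n s 0)))) ⟩
        ∑ n (λ s → (ι n + 1ℚ) * (Ψ s 0 * δ n s 0))
          ≡⟨ ∑-*ˡ n (ι n + 1ℚ) (λ s → Ψ s 0 * δ n s 0) ⟩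
        (ι n + 1ℚ) * ∑ n (λ s → Ψ s 0 * δ n s 0)
          ≡⟨ cong ((ι n + 1ℚ) *_) (trans (∑-pick n (λ s → Ψ s 0) 0 0<n) Ψ00) ⟩
        (ι n + 1ℚ) * 1ℚ
          ≡⟨ ℚₚ.*-identityʳ (ι n + 1ℚ) ⟩
        ι n + 1ℚ ∎
        where
        p00 : ∀ c → p 0 0 c ≡ 0
        p00 fst = refl
        p00 snd = refl
        p00 quo = ℕₚ.*-zeroʳ (n ℕ.∸ 1)
        Ψ00 : Ψ 0 0 ≡ 1ℚ
        Ψ00 = trans (respects (λ c → Cong-reflexive (p00 c)) (λ c → Cong-refl 0)) (diag origin)

    module PointTest (β : ℚ) (z : Point) (c : ℚ) where
      w : ℕ → ℕ → ℚ
      w i j = K i j - β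

      pointTest : Functional Point
      pointTest = record
        { app      = λ f → ∑∑ n (λ i j → w i j * f (p i j)) + c * f z
        ; app-cong = λ eq → cong₂ (λ x y → x + c * y) (∑∑-cong n λ i j → cong (w i j *_) (eq (p i j))) (eq z)
        ; app-+    = λ f g → trans (cong (λ x → x + c * (f z + g z))
                       (trans (∑∑-cong n λ i j → ℚₚ.*-distribˡ-+ (w i j) (f (p i j)) (g (p i j)))
                         (∑∑-+ n (λ i j → w i j * f (p i j)) (λ i j → w i j * g (p i j)))))
                       (lem₁ c (∑∑ n (λ i j → w i j * f (p i j))) (∑∑ n (λ i j → w i j * g (p i j))) (f z) (g z))
        ; app-*    = λ d f → trans (cong (λ x → x + c * (d * f z))
                       (trans (∑∑-cong n λ i j → *-left-comm (w i j) d (f (p i j))) (∑∑-*ˡ n d (λ i j → w i j * f (p i j)))))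
                       (lem₃ c d (∑∑ n (λ i j → w i j * f (p i j))) (f z))
        }
        where
        lem₁ : ∀ c x y u v → (x + y) + c * (u + v) ≡ (x + c * u) + (y + c * v)
        lem₁ = solve-∀ ℚ-ring
        lem₃ : ∀ c d x y → d * x + c * (d * y) ≡ d * (x + c * y)
        lem₃ = solve-∀ ℚ-ring

      D : ℚ
      D = deviation n K β (λ i j → P (p i j) z)

      -- Positivity on the measure K - β plus `c` times the point mass at `z`: the energy corrected
      -- for the subtracted mean, twice the cross term, and c² because `P z z` is 1. The weight `c`
      -- stays free since both signs are used.
      quadratic : 0ℚ ≤ (energy - (β + β) * ((ι n - 1ℚ) * M) + β * β * (ι n * (ι n * M))) + (c + c) * D + c * c
      quadratic = subst (0ℚ ≤_) eq (positive pointTest)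
        where
        wsum : ∀ f → ∑∑ n (λ i j → w i j * f i j) ≡ ∑∑ n (λ i j → K i j * f i j) - β * ∑∑ n f
        wsum f = trans (∑∑-cong n λ i j → lem (K i j) β (f i j))
          (trans (∑∑-sub n (λ i j → K i j * f i j) (λ i j → β * f i j))
            (cong (λ x → ∑∑ n (λ i j → K i j * f i j) - x) (∑∑-*ˡ n β f)))
          where
          lem : ∀ k b f → (k - b) * f ≡ k * f - b * f
          lem = solve-∀ ℚ-ring
        G : ℕ → ℕ → ℚ
        G i j = ∑∑ n (λ i′ j′ → K i′ j′ * P (p i j) (p i′ j′))
        ∑∑G : ∑∑ n G ≡ (ι n - 1ℚ) * M
        ∑∑G = begin
          ∑∑ n (λ i j → ∑∑ n (λ i′ j′ → K i′ j′ * P (p i j) (p i′ j′)))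
            ≡⟨ ∑∑-swap n (λ i j i′ j′ → K i′ j′ * P (p i j) (p i′ j′)) ⟩
          ∑∑ n (λ i′ j′ → ∑∑ n (λ i j → K i′ j′ * P (p i j) (p i′ j′)))
            ≡⟨ (∑∑-cong n λ i′ j′ → trans (∑∑-*ˡ n (K i′ j′) (λ i j → P (p i j) (p i′ j′)))
                 (cong (K i′ j′ *_) (∑∑P i′ j′))) ⟩
          ∑∑ n (λ i′ j′ → K i′ j′ * M)
            ≡⟨ ∑∑-*ʳ n M K ⟩
          ∑∑ n K * M
            ≡⟨ cong (_* M) ∑∑K ⟩
          (ι n - 1ℚ) * M ∎
        inner : ∀ i j → ∑∑ n (λ i′ j′ → w i′ j′ * P (p i j) (p i′ j′)) ≡ G i j - β * M
        inner i j = trans (wsum (λ i′ j′ → P (p i j) (p i′ j′))) (cong (λ x → G i j - β * x) (∑∑P′ i j))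
        H : ℕ → ℕ → ℚ
        H i j = P (p i j) z
        ∑∑wG : ∑∑ n (λ i j → w i j * G i j) ≡ energy - β * ((ι n - 1ℚ) * M)
        ∑∑wG = trans (wsum G) (cong₂ (λ x y → x - β * y) ∑∑KKP ∑∑G)
        ∑∑wM : ∑∑ n (λ i j → w i j * (β * M)) ≡ (ι n - 1ℚ) * (β * M) - β * (ι n * (ι n * (β * M)))
        ∑∑wM = trans (wsum (λ _ _ → β * M)) (cong₂ (λ x y → x - β * y)
          (trans (∑∑-*ʳ n (β * M) K) (cong (_* (β * M)) ∑∑K)) (∑∑-const n (β * M)))
        row : ∀ i j → w i j * (∑∑ n (λ i′ j′ → w i′ j′ * P (p i j) (p i′ j′)) + c * P (p i j) z) ≡
          w i j * G i j - w i j * (β * M) + c * (w i j * H i j)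
        row i j = trans (cong (λ x → w i j * (x + c * H i j)) (inner i j)) (lem (w i j) (G i j) (β * M) c (H i j))
          where
          lem : ∀ w g m c h → w * (g - m + c * h) ≡ w * g - w * m + c * (w * h)
          lem = solve-∀ ℚ-ring
        fromZ : ∑∑ n (λ i j → w i j * P z (p i j)) ≡ D
        fromZ = trans (∑∑-cong n λ i j → cong (w i j *_) (symm z (p i j))) (wsum H)
        eq : Functional.app pointTest (λ x → Functional.app pointTest (λ y → P x y)) ≡
          (energy - (β + β) * ((ι n - 1ℚ) * M) + β * β * (ι n * (ι n * M))) + (c + c) * D + c * c
        eq = begin
          ∑∑ n (λ i j → w i j * (∑∑ n (λ i′ j′ → w i′ j′ * P (p i j) (p i′ j′)) + c * P (p i j) z))
            + c * (∑∑ n (λ i j → w i j * P z (p i j)) + c * P z z)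
            ≡⟨ cong₂ (λ x y → x + c * y)
                 (trans (∑∑-cong n row)
                   (trans (∑∑-+ n (λ i j → w i j * G i j - w i j * (β * M)) (λ i j → c * (w i j * H i j)))
                     (cong₂ _+_ (trans (∑∑-sub n (λ i j → w i j * G i j) (λ i j → w i j * (β * M))) (cong₂ _-_ ∑∑wG ∑∑wM))
                       (trans (∑∑-*ˡ n c (λ i j → w i j * H i j)) (cong (c *_) (wsum H))))))
                 (cong₂ (λ x y → x + c * y) fromZ (diag z)) ⟩
          (energy - β * ((ι n - 1ℚ) * M) - ((ι n - 1ℚ) * (β * M) - β * (ι n * (ι n * (β * M)))) + c * D)
            + c * (D + c * 1ℚ)
            ≡⟨ lem energy β (ι n) M c D ⟩
          (energy - (β + β) * ((ι n - 1ℚ) * M) + β * β * (ι n * (ι n * M))) + (c + c) * D + c * c ∎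
          where
          lem : ∀ e b n m c d → (e - b * ((n - 1ℚ) * m) - ((n - 1ℚ) * (b * m) - b * (n * (n * (b * m)))) + c * d)
            + c * (d + c * 1ℚ) ≡ (e - (b + b) * ((n - 1ℚ) * m) + b * b * (n * (n * m))) + (c + c) * d + c * c
          lem = solve-∀ ℚ-ring

    ν : ℚ
    ν = inv n

    β₀ : ℚ
    β₀ = density n

    M-nonneg : 0ℚ ≤ M
    M-nonneg = *-cancelˡ-≤ (0<ι n 0<n) (*-cancelˡ-≤ (0<ι n 0<n) (subst₂ _≤_ (sym zero≡) eq (positive total)))
      where
      zero≡ : ι n * (ι n * 0ℚ) ≡ 0ℚ
      zero≡ = lem (ι n)
        where
        lem : ∀ x → x * (x * 0ℚ) ≡ 0ℚ
        lem = solve-∀ ℚ-ring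
      total : Functional Point
      total = record
        { app      = λ f → ∑∑ n (λ i j → f (p i j))
        ; app-cong = λ eq → ∑∑-cong n λ i j → eq (p i j)
        ; app-+    = λ f g → ∑∑-+ n (λ i j → f (p i j)) (λ i j → g (p i j))
        ; app-*    = λ c f → ∑∑-*ˡ n c (λ i j → f (p i j))
        }
      eq : ∑∑ n (λ i j → ∑∑ n (λ i′ j′ → P (p i j) (p i′ j′))) ≡ ι n * (ι n * M)
      eq = trans (∑∑-cong n ∑∑P′) (∑∑-const n M)

    νn : ν * ι n ≡ 1ℚ
    νn = inv-*-ι n 0<n

    line-bound′ : ∀ a b → ν * M ≤ line a b
    line-bound′ a b = subst (ν * M ≤_) (trans (sym (ℚₚ.*-assoc ν (ι n) (line a b)))
        (trans (cong (_* line a b) νn) (ℚₚ.*-identityˡ (line a b))))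
      (*-monoˡ-≤ (0≤inv n) (line-bound a b))

    -- Subtracting the mean affects only the trivial pair, whose share becomes (n - 1 - q)² = 4; the
    -- others keep 1 or q. So q dominates every share once 4 ≤ q. In the difference the three line
    -- terms account for the degenerate pairs and (n - 3) ν² M for the trivial one.
    energy-bound : energy - (β₀ + β₀) * ((ι n - 1ℚ) * M) + β₀ * β₀ * (ι n * (ι n * M)) ≤ ι n + 1ℚ
    energy-bound = ≤-from-diff (subst (0ℚ ≤_) (sym eq)
      (+-nonneg (+-nonneg (+-nonneg (diff-from-≤ (line-bound′ 1 1)) (diff-from-≤ (line-bound′ 0 1)))
        (diff-from-≤ (line-bound′ 1 0)))
        (*-nonneg (*-nonneg (square-nonneg ν) (diff-from-≤ (ι-mono-≤ 3≤n))) M-nonneg)))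
      where
      L₁ L₂ L₃ : ℚ
      L₁ = line 1 1
      L₂ = line 0 1
      L₃ = line 1 0
      -- The wanted identity holds only modulo v n = 1; the last summand displays the multiple of 1
      -- - v n, so that the ring solver can treat `v` as a free variable.
      gen : ∀ n v m a b c → (n + 1ℚ) - ((n + 1ℚ + m - a - b - c)
          - ((n + 1ℚ) * (v * v) + (n + 1ℚ) * (v * v)) * ((n - 1ℚ) * m)
          + (n + 1ℚ) * (v * v) * ((n + 1ℚ) * (v * v)) * (n * (n * m)))
        ≡ (a - v * m) + (b - v * m) + (c - v * m) + (v * v) * (n - ι 3) * m
          + (1ℚ - v * n) * (m * (ι 3 * v - (1ℚ + v * n) + (n + 1ℚ) * (n + 1ℚ) * (v * v) * (1ℚ + v * n)))
      gen = solve-∀ ℚ-ring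
      eq : (ι n + 1ℚ) - (energy - (β₀ + β₀) * ((ι n - 1ℚ) * M) + β₀ * β₀ * (ι n * (ι n * M))) ≡
        (L₁ - ν * M) + (L₂ - ν * M) + (L₃ - ν * M) + (ν * ν) * (ι n - ι 3) * M
      eq = trans (gen (ι n) ν M L₁ L₂ L₃) (trans (cong (λ x → rest + (1ℚ - x) * junk) νn) (lem rest junk))
        where
        rest junk : ℚ
        rest = (L₁ - ν * M) + (L₂ - ν * M) + (L₃ - ν * M) + (ν * ν) * (ι n - ι 3) * M
        junk = M * (ι 3 * ν - (1ℚ + ν * ι n) + (ι n + 1ℚ) * (ι n + 1ℚ) * (ν * ν) * (1ℚ + ν * ι n))
        lem : ∀ a b → a + (1ℚ - 1ℚ) * b ≡ a
        lem = solve-∀ ℚ-ring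

    -- In the quadratic inequality, c = r bounds the discrepancy from below and c = - r from above.
    jacobi-bound : ∀ r → 0ℚ < r → ι n + 1ℚ ≤ r * r → ∀ z →
      ℚ.∣ discrepancy n K (λ i j → P (pt n i j) z) ∣ ≤ r
    jacobi-bound r 0<r q≤rr z = abs≤ (double r 0<r (- D₀) _ q≤rr (subst (0ℚ ≤_) (lem (ι n + 1ℚ) r D₀) (bound (- r))))
        (double r 0<r D₀ _ q≤rr (bound r))
      where
      D₀ = discrepancy n K (λ i j → P (p i j) z)
      bound : ∀ c → 0ℚ ≤ (ι n + 1ℚ) + (c + c) * D₀ + c * c
      bound c = ℚₚ.≤-trans (PointTest.quadratic β₀ z c)
        (ℚₚ.+-monoˡ-≤ (c * c) (ℚₚ.+-monoˡ-≤ ((c + c) * D₀) energy-bound))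
      lem : ∀ q r d → q + (- r + - r) * d + (- r) * (- r) ≡ q + (r + r) * (- d) + r * r
      lem = solve-∀ ℚ-ring
      abs≤ : - (- D₀) ≤ r → - D₀ ≤ r → ℚ.∣ D₀ ∣ ≤ r
      abs≤ p q with ℚₚ.∣p∣≡p∨∣p∣≡-p D₀
      ... | inj₁ eq = subst (_≤ r) (trans (neg-neg D₀) (sym eq)) p
        where
        neg-neg : ∀ d → - (- d) ≡ d
        neg-neg = solve-∀ ℚ-ring
      ... | inj₂ eq = subst (_≤ r) (sym eq) q

-- Expansion of the avoidance conditions into kernels.

module FourierExpansion where
  open ≡ using (sym; trans; cong; cong₂; subst₂; module ≡-Reasoning)
  open import Data.Rational using (_+_; _*_; _-_; -_; _≤_; _<_)
  open RingSolver using (solve-∀)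
  open RationalSums
  open PositiveDefiniteKernels
  open JacobiSums

  ϑ : ℕ → ℚ
  ϑ l = 1ℚ - inv l

  ϑ-nonneg : ∀ l → 1 ℕ.≤ l → 0ℚ ≤ ϑ l
  ϑ-nonneg l 1≤l = *-cancelˡ-≤ (0<ι l 1≤l) (subst₂ _≤_ (sym (ℚₚ.*-zeroʳ (ι l))) eq (0≤ι (l ℕ.∸ 1)))
    where
    open ≡-Reasoning
    lem : ∀ a v → a - v * a ≡ a * (1ℚ - v)
    lem = solve-∀ ℚ-ring
    lem′ : ∀ a → a ≡ a + 1ℚ - 1ℚ
    lem′ = solve-∀ ℚ-ring
    eq : ι (l ℕ.∸ 1) ≡ ι l * ϑ l
    eq = begin
      ι (l ℕ.∸ 1)             ≡⟨ lem′ (ι (l ℕ.∸ 1)) ⟩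
      ι (l ℕ.∸ 1) + 1ℚ - 1ℚ   ≡⟨ cong₂ _-_ (sym (ι-pred l 1≤l)) (sym (inv-*-ι l 1≤l)) ⟩
      ι l - inv l * ι l       ≡⟨ lem (ι l) (inv l) ⟩
      ι l * ϑ l               ∎

  inv-pred : ∀ l → 2 ℕ.≤ l → inv (l ℕ.∸ 1) * (ι l - 1ℚ) ≡ 1ℚ
  inv-pred l 2≤l = trans (cong (λ x → inv (l ℕ.∸ 1) * (x - 1ℚ)) (ι-pred l (ℕₚ.<⇒≤ 2≤l)))
    (trans (lem (inv (l ℕ.∸ 1)) (ι (l ℕ.∸ 1))) (inv-*-ι (l ℕ.∸ 1) (ℕₚ.∸-monoˡ-≤ 1 2≤l)))
    where
    lem : ∀ v x → v * (x + 1ℚ - 1ℚ) ≡ v * x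
    lem = solve-∀ ℚ-ring

  -- An identity modulo u (n - 1) = 1 and v n = 1, with the multiples of these relations made explicit.
  δ-as-κ : ∀ l → 2 ℕ.≤ l → ∀ a b → δ l a b ≡ inv l + ϑ l * κ l a b
  δ-as-κ l 2≤l a b = sym (trans (lem (inv l) (inv (l ℕ.∸ 1)) (ι l) (δ l a b))
    (trans (cong₂ (λ x y → δ l a b + (inv l - δ l a b) * (1ℚ - x) + (inv (l ℕ.∸ 1) * δ l a b - inv (l ℕ.∸ 1)) * (1ℚ - y)) (inv-pred l 2≤l) (inv-*-ι l (ℕₚ.<⇒≤ 2≤l)))
    (lem′ (inv l) (inv (l ℕ.∸ 1)) (δ l a b))))
    where
    lem : ∀ v u n d → v + (1ℚ - v) * (u * (n * d - 1ℚ)) ≡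
      d + (v - d) * (1ℚ - u * (n - 1ℚ)) + (u * d - u) * (1ℚ - v * n)
    lem = solve-∀ ℚ-ring
    lem′ : ∀ v u d → d + (v - d) * (1ℚ - 1ℚ) + (u * d - u) * (1ℚ - 1ℚ) ≡ d
    lem′ = solve-∀ ℚ-ring

  avoid : List (ℕ × Axis) → Point → Point → ℚ
  avoid []             x y = 1ℚ
  avoid ((l , c) ∷ fs) x y = (1ℚ - δ l (x c) (y c)) * avoid fs x y

  -- The sum of the absolute values of the coefficients when every 1 - δ is written as ϑ (1 - κ) and
  -- the product is multiplied out.
  spread-bound : List (ℕ × Axis) → ℚ
  spread-bound []             = 1ℚ
  spread-bound ((l , c) ∷ fs) = (ϑ l + ϑ l) * spread-bound fs

  module Expansion
    (n : ℕ) (3≤n : 3 ℕ.≤ n)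
    {K : ℕ → ℕ → ℚ} (K-line : LineCorrelation n K)
    (r : ℚ) (0<r : 0ℚ < r) (q≤rr : ι n + 1ℚ ≤ r * r) (z : Point)
    where

    discrepancy-cong : ∀ {f g} → (∀ i j → f i j ≡ g i j) → discrepancy n K f ≡ discrepancy n K g
    discrepancy-cong eq = cong₂ (λ x y → x - density n * y)
      (∑∑-cong n λ i j → cong (K i j *_) (eq i j)) (∑∑-cong n eq)

    discrepancy-split : ∀ t f g →
      discrepancy n K (λ i j → t * (f i j - g i j)) ≡ t * (discrepancy n K f - discrepancy n K g)
    discrepancy-split t f g = trans (cong₂ (λ x y → x - density n * y)
        (trans (∑∑-cong n λ i j → lem₁ (K i j) t (f i j) (g i j))
          (trans (∑∑-*ˡ n t (λ i j → K i j * f i j - K i j * g i j))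
            (cong (t *_) (∑∑-sub n (λ i j → K i j * f i j) (λ i j → K i j * g i j)))))
        (trans (∑∑-*ˡ n t (λ i j → f i j - g i j)) (cong (t *_) (∑∑-sub n f g))))
      (lem₂ t (density n) (∑∑ n (λ i j → K i j * f i j)) (∑∑ n (λ i j → K i j * g i j)) (∑∑ n f) (∑∑ n g))
      where
      lem₁ : ∀ k t f g → k * (t * (f - g)) ≡ t * (k * f - k * g)
      lem₁ = solve-∀ ℚ-ring
      lem₂ : ∀ t b x y u v → t * (x - y) - b * (t * (u - v)) ≡ t * ((x - b * u) - (y - b * v))
      lem₂ = solve-∀ ℚ-ring

    -- One factor at a time is split by 1 - δ = ϑ (1 - κ), and the new `κ` joins `gs`. All factors
    -- refer to the same point `z`, so what remains at the end is one row of a translation kernel,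
    -- whatever moduli and axes occur in it.
    expansion-bound : ∀ {fs gs} → All (λ f → GoodModulus n (proj₁ f)) fs → All (λ f → GoodModulus n (proj₁ f)) gs →
      ℚ.∣ discrepancy n K (λ i j → avoid fs (pt n i j) z * kernel gs (pt n i j) z) ∣ ≤ spread-bound fs * r
    expansion-bound {[]} {gs} [] goods = subst₂ _≤_
      (cong ℚ.∣_∣ (discrepancy-cong λ i j → sym (ℚₚ.*-identityˡ (kernel gs (pt n i j) z))))
      (sym (ℚₚ.*-identityˡ r))
      (JacobiBound.jacobi-bound n 3≤n K-line (kernel-translation n goods) r 0<r q≤rr z)
    expansion-bound {(l , c) ∷ fs} {gs} ((2≤l , l∣n) ∷ goodf) goods = begin
      ℚ.∣ discrepancy n K (λ i j → avoid ((l , c) ∷ fs) (pt n i j) z * kernel gs (pt n i j) z) ∣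
        ≡⟨ cong ℚ.∣_∣ (trans (discrepancy-cong term) (discrepancy-split (ϑ l) f g)) ⟩
      ℚ.∣ ϑ l * (Df - Dg) ∣
        ≡⟨ ℚₚ.∣p*q∣≡∣p∣*∣q∣ (ϑ l) (Df - Dg) ⟩
      ℚ.∣ ϑ l ∣ * ℚ.∣ Df - Dg ∣
        ≡⟨ cong (_* ℚ.∣ Df - Dg ∣) (ℚₚ.0≤p⇒∣p∣≡p 0≤ϑ) ⟩
      ϑ l * ℚ.∣ Df - Dg ∣
        ≤⟨ *-monoˡ-≤ 0≤ϑ (ℚₚ.≤-trans (ℚₚ.∣p-q∣≤∣p∣+∣q∣ Df Dg) (ℚₚ.+-mono-≤
             (expansion-bound {fs} {gs} goodf goods) (expansion-bound {fs} {(l , c) ∷ gs} goodf ((2≤l , l∣n) ∷ goods)))) ⟩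
      ϑ l * (spread-bound fs * r + spread-bound fs * r)
        ≡⟨ lem (ϑ l) (spread-bound fs) r ⟩
      (ϑ l + ϑ l) * spread-bound fs * r ∎
      where
      open ℚₚ.≤-Reasoning
      f g : ℕ → ℕ → ℚ
      f i j = avoid fs (pt n i j) z * kernel gs (pt n i j) z
      g i j = avoid fs (pt n i j) z * kernel ((l , c) ∷ gs) (pt n i j) z
      Df Dg : ℚ
      Df = discrepancy n K f
      Dg = discrepancy n K g
      0≤ϑ : 0ℚ ≤ ϑ l
      0≤ϑ = ϑ-nonneg l (ℕₚ.<⇒≤ 2≤l)
      lem : ∀ t b r → t * (b * r + b * r) ≡ (t + t) * b * r
      lem = solve-∀ ℚ-ring
      expand : ∀ v k a b → (1ℚ - (v + (1ℚ - v) * k)) * a * b ≡ (1ℚ - v) * (a * b - a * (k * b))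
      expand = solve-∀ ℚ-ring
      term : ∀ i j → avoid ((l , c) ∷ fs) (pt n i j) z * kernel gs (pt n i j) z ≡ ϑ l * (f i j - g i j)
      term i j = trans (cong (λ d → (1ℚ - d) * avoid fs (pt n i j) z * kernel gs (pt n i j) z)
          (δ-as-κ l 2≤l (pt n i j c) (z c)))
        (expand (inv l) (κ l (pt n i j c) (z c)) (avoid fs (pt n i j) z) (kernel gs (pt n i j) z))

-- Averages over residues and independence modulo distinct primes.

module ResidueAverages where
  open ≡ using (refl; sym; trans; cong; cong₂; subst; module ≡-Reasoning)
  open import Data.Rational using (_+_; _*_; _-_; -_; _≤_; _<_)
  open RingSolver using (solve-∀)
  open RationalSums
  open PositiveDefiniteKernels
  open JacobiSums
  open FourierExpansion

  Respects : ℕ → (ℕ → ℚ) → Set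
  Respects l h = ∀ {a b} → Cong l a b → h a ≡ h b

  Respects₂ : ℕ → (ℕ → ℕ → ℚ) → Set
  Respects₂ l h = ∀ {a b a′ b′} → Cong l a a′ → Cong l b b′ → h a b ≡ h a′ b′

  -- Translating the summation variable by t c, for t < l, moves h through all residues mod l and fixes f.
  average : ∀ N l c → 0 ℕ.< l → l ℕ∣.∣ N → Cong l c 1 → (h f : ℕ → ℚ) → Respects l h →
    (∀ m → f (m ℕ.+ N) ≡ f m) → (∀ m → f (m ℕ.+ c) ≡ f m) →
    ι l * ∑ N (λ m → h m * f m) ≡ ∑ l h * ∑ N f
  average N l c 0<l l∣N c≡1 h f h-resp f-per f-inv = begin
    ι l * ∑ N (λ m → h m * f m)
      ≡⟨ sym (∑-const l (∑ N (λ m → h m * f m))) ⟩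
    ∑ l (λ _ → ∑ N (λ m → h m * f m))
      ≡⟨ ∑-cong l moved ⟩
    ∑ l (λ t → ∑ N (λ m → h (t ℕ.+ m) * f m))
      ≡⟨ ∑-swap l N (λ t m → h (t ℕ.+ m) * f m) ⟩
    ∑ N (λ m → ∑ l (λ t → h (t ℕ.+ m) * f m))
      ≡⟨ (∑-cong N λ m → trans (∑-*ʳ l (f m) (λ t → h (t ℕ.+ m)))
           (cong (_* f m) (∑-shift l h (λ i → h-resp (Cong-+∣ i ℕ∣.∣-refl)) m))) ⟩
    ∑ N (λ m → ∑ l h * f m)
      ≡⟨ ∑-*ˡ N (∑ l h) f ⟩
    ∑ l h * ∑ N f ∎
    where
    open ≡-Reasoning
    f-inv* : ∀ t m → f (m ℕ.+ t ℕ.* c) ≡ f m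
    f-inv* zero    m = cong f (ℕₚ.+-identityʳ m)
    f-inv* (suc t) m = trans (cong f (lem m c (t ℕ.* c))) (trans (f-inv (m ℕ.+ t ℕ.* c)) (f-inv* t m))
      where
      lem : ∀ m c d → m ℕ.+ (c ℕ.+ d) ≡ m ℕ.+ d ℕ.+ c
      lem = solve-∀-ℕ
    per : ∀ m → h (m ℕ.+ N) * f (m ℕ.+ N) ≡ h m * f m
    per m = cong₂ _*_ (h-resp (Cong-+∣ m l∣N)) (f-per m)
    tc≡t : ∀ t → Cong l (t ℕ.* c) t
    tc≡t t = subst (Cong l (t ℕ.* c)) (ℕₚ.*-identityʳ t) (Cong-* t c≡1)
    moved : ∀ t → ∑ N (λ m → h m * f m) ≡ ∑ N (λ m → h (t ℕ.+ m) * f m)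
    moved t = trans (sym (∑-shift N (λ m → h m * f m) per (t ℕ.* c)))
      (∑-cong N λ m → cong₂ _*_ (h-resp (Cong-trans (Cong-+ˡ m (tc≡t t)) (Cong-reflexive (ℕₚ.+-comm m t)))) (f-inv* t m))

  average₂ : ∀ N l c → 0 ℕ.< l → l ℕ∣.∣ N → Cong l c 1 → (h f : ℕ → ℕ → ℚ) → Respects₂ l h →
    Periodic N f → Periodic c f →
    ι l * (ι l * ∑∑ N (λ i j → h i j * f i j)) ≡ ∑∑ l h * ∑∑ N f
  average₂ N l c 0<l l∣N c≡1 h f h-resp (per₁ , per₂) (inv₁ , inv₂) = begin
    ι l * (ι l * ∑∑ N (λ i j → h i j * f i j))
      ≡⟨ cong (ι l *_) (sym (∑-*ˡ N (ι l) (λ i → ∑ N (λ j → h i j * f i j)))) ⟩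
    ι l * ∑ N (λ i → ι l * ∑ N (λ j → h i j * f i j))
      ≡⟨ cong (ι l *_) (∑-cong N λ i → average N l c 0<l l∣N c≡1 (h i) (f i)
           (h-resp (Cong-refl i)) (per₂ i) (inv₂ i)) ⟩
    ι l * ∑ N (λ i → ∑ l (h i) * ∑ N (f i))
      ≡⟨ average N l c 0<l l∣N c≡1 (λ i → ∑ l (h i)) (λ i → ∑ N (f i))
           (λ p → ∑-cong l λ j → h-resp p (Cong-refl j))
           (λ i → ∑-cong N λ j → per₁ i j) (λ i → ∑-cong N λ j → inv₁ i j) ⟩
    ∑∑ l h * ∑∑ N f ∎
    where open ≡-Reasoning

  prime⇒2≤ : ∀ {l} → Prime l → 2 ℕ.≤ l
  prime⇒2≤ {l} pr = ℕ.nonTrivial⇒n>1 l {{prime⇒nonTrivial pr}}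

  -- Adding `c` moves the residue mod `l` by one and fixes the residues modulo all primes of `L`;
  -- this single number does the work of the Chinese remainder isomorphism.
  crt-unit : ∀ {l L} → Prime l → All Prime L → l ∉ L → ∃ λ c → Cong l c 1 × (∀ {l′} → l′ ∈ L → l′ ℕ∣.∣ c)
  crt-unit {l} {L} pr prs l∉L with Coprimality.coprime-Bézout coprime
    where
    coprime : Coprimality.Coprime l (product L)
    coprime (d∣l , d∣P) with prime⇒irreducible pr d∣l
    ... | inj₁ d≡1  = d≡1
    ... | inj₂ refl = ⊥-elim (l∉L (factorisationHasAllPrimeFactors pr d∣P prs))
  ... | Bézout.-+ x y eq = y ℕ.* product L
      , subst (λ m → Cong l m 1) eq (Cong-+∣ 1 (ℕ∣.n∣m*n x))
      , (λ l′∈L → ℕ∣.∣n⇒∣m*n y (∈⇒∣product l′∈L))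
  -- In this orientation y · product L is -1 mod `l`, and the factor l - 1 restores the sign.
  ... | Bézout.+- x y eq = (l ℕ.∸ 1) ℕ.* (y ℕ.* product L)
      , Cong-cancelʳ (y ℕ.* product L) (Cong-trans (∣⇒Cong0 (subst (l ℕ∣.∣_) (lem l (ℕₚ.<⇒≤ (prime⇒2≤ pr)) (y ℕ.* product L)) (ℕ∣.m∣m*n (y ℕ.* product L))))
          (Cong-sym (∣⇒Cong0 (subst (l ℕ∣.∣_) (sym eq) (ℕ∣.n∣m*n x)))))
      , (λ l′∈L → ℕ∣.∣n⇒∣m*n (l ℕ.∸ 1) (ℕ∣.∣n⇒∣m*n y (∈⇒∣product l′∈L)))
    where
    lem : ∀ l → 1 ℕ.≤ l → ∀ P → l ℕ.* P ≡ (l ℕ.∸ 1) ℕ.* P ℕ.+ P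
    lem (suc l) _ P = ℕₚ.+-comm P (l ℕ.* P)

  prodL : List ℕ → (ℕ → ℚ) → ℚ
  prodL L g = List.foldr (λ l acc → g l * acc) 1ℚ L

  prodL-cong : ∀ L {f g : ℕ → ℚ} → (∀ {l} → l ∈ L → f l ≡ g l) → prodL L f ≡ prodL L g
  prodL-cong []      eq = refl
  prodL-cong (l ∷ L) eq = cong₂ _*_ (eq (here refl)) (prodL-cong L λ l∈L → eq (there l∈L))

  ∉-head : ∀ {l : ℕ} {L} → Unique (l ∷ L) → l ∉ L
  ∉-head (l≢ ∷ _) l∈L = All.lookup l≢ l∈L refl

  -- Residues modulo distinct primes are independent: `average₂` peels off one prime, the remaining
  -- product being invariant under the shift from `crt-unit`. Here `E l` is the mean of `H l` over
  -- (ℤ/l)².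
  ∑∑-prodL : ∀ N L → All Prime L → Unique L → (∀ {l} → l ∈ L → l ℕ∣.∣ N) →
    (H : ℕ → ℕ → ℕ → ℚ) (E : ℕ → ℚ) → (∀ l → Respects₂ l (H l)) →
    (∀ {l} → l ∈ L → ∑∑ l (H l) ≡ ι l * (ι l * E l)) →
    ∑∑ N (λ i j → prodL L (λ l → H l i j)) ≡ ι N * (ι N * prodL L E)
  ∑∑-prodL N []      _          _ _    H E _    _  = ∑∑-const N 1ℚ
  ∑∑-prodL N (l ∷ L) (pr ∷ prs) uniq@(_ ∷ uniq′) L∣N H E resp eq with crt-unit pr prs (∉-head uniq)
  ... | c , c≡1 , L∣c = ≤-cancel (≤-cancel (begin
    ι l * (ι l * ∑∑ N (λ i j → H l i j * f i j))
      ≡⟨ average₂ N l c 0<l (L∣N (here refl)) c≡1 (H l) f (resp l) (invariant N λ m → L∣N (there m)) (invariant c L∣c) ⟩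
    ∑∑ l (H l) * ∑∑ N f
      ≡⟨ cong₂ _*_ (eq (here refl)) (∑∑-prodL N L prs uniq′ (λ m → L∣N (there m)) H E resp (λ m → eq (there m))) ⟩
    ι l * (ι l * E l) * (ι N * (ι N * prodL L E))
      ≡⟨ lem (ι l) (E l) (ι N) (prodL L E) ⟩
    ι l * (ι l * (ι N * (ι N * (E l * prodL L E)))) ∎))
    where
    open ≡-Reasoning
    0<l : 0 ℕ.< l
    0<l = ℕₚ.<⇒≤ (prime⇒2≤ pr)
    f : ℕ → ℕ → ℚ
    f i j = prodL L (λ l → H l i j)
    invariant : ∀ c → (∀ {l′} → l′ ∈ L → l′ ℕ∣.∣ c) → Periodic c f
    invariant c L∣c = (λ i j → prodL-cong L λ {l} m → resp l (Cong-+∣ i (L∣c m)) (Cong-refl j))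
                    , (λ i j → prodL-cong L λ {l} m → resp l (Cong-refl i) (Cong-+∣ j (L∣c m)))
    ≤-cancel : ∀ {x y} → ι l * x ≡ ι l * y → x ≡ y
    ≤-cancel p = ℚₚ.≤-antisym (*-cancelˡ-≤ (0<ι l 0<l) (ℚₚ.≤-reflexive p))
      (*-cancelˡ-≤ (0<ι l 0<l) (ℚₚ.≤-reflexive (sym p)))
    lem : ∀ l e n p → l * (l * e) * (n * (n * p)) ≡ l * (l * (n * (n * (e * p))))
    lem = solve-∀ ℚ-ring

  ∑-δ-shift : ∀ l → 0 ℕ.< l → ∀ c a → ∑ l (λ r → δ l (r ℕ.+ c) a) ≡ 1ℚ
  ∑-δ-shift l 0<l c a = trans (∑-shift l (λ r → δ l r a) (λ i → δ-cong l (Cong-+∣ i ℕ∣.∣-refl) (Cong-refl a)) c)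
    (∑-δ l 0<l a)

  avoid₃ : ℕ → Point → Point → ℚ
  avoid₃ l x y = (1ℚ - δ l (x fst) (y fst)) * ((1ℚ - δ l (x snd) (y snd)) * (1ℚ - δ l (x quo) (y quo)))

  triples : List ℕ → List (ℕ × Axis)
  triples []      = []
  triples (l ∷ L) = (l , fst) ∷ (l , snd) ∷ (l , quo) ∷ triples L

  avoid-triples : ∀ L x y → avoid (triples L) x y ≡ prodL L (λ l → avoid₃ l x y)
  avoid-triples []      x y = refl
  avoid-triples (l ∷ L) x y = trans
    (cong (λ w → (1ℚ - δ l (x fst) (y fst)) * ((1ℚ - δ l (x snd) (y snd)) * ((1ℚ - δ l (x quo) (y quo)) * w))) (avoid-triples L x y))
    (lem (1ℚ - δ l (x fst) (y fst)) (1ℚ - δ l (x snd) (y snd)) (1ℚ - δ l (x quo) (y quo)) (prodL L (λ l → avoid₃ l x y)))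
    where
    lem : ∀ a b c d → a * (b * (c * d)) ≡ (a * (b * c)) * d
    lem = solve-∀ ℚ-ring

  avoid₃-respects : ∀ n z l → Respects₂ l (λ i j → avoid₃ l (pt n i j) z)
  avoid₃-respects n z l {i} {j} {i′} {j′} p q = cong₂ _*_ (lem fst) (cong₂ _*_ (lem snd) (lem quo))
    where
    lem : ∀ c → 1ℚ - δ l (pt n i j c) (z c) ≡ 1ℚ - δ l (pt n i′ j′ c) (z c)
    lem c = cong (λ d → 1ℚ - d) (δ-cong l (pt-cong n p q c) (Cong-refl (z c)))

  -- n - 1 acts as -1 on logarithms, which keeps every exponent a natural number.
  Cong-neg : ∀ {l n} → 0 ℕ.< n → l ℕ∣.∣ n → ∀ a → Cong l ((n ℕ.∸ 1) ℕ.* a ℕ.+ a) 0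
  Cong-neg {l} {suc n} _ l∣n a = ∣⇒Cong0 (subst (l ℕ∣.∣_) (ℕₚ.+-comm a (n ℕ.* a)) (ℕ∣.∣m⇒∣m*n a l∣n))

  -- Three lines of (ℤ/l)², pairwise not parallel and without a common point.
  ∑∑-avoid₃ : ∀ n l → 0 ℕ.< n → 0 ℕ.< l → l ℕ∣.∣ n → ∀ z → ¬ Cong l (z snd ℕ.+ (n ℕ.∸ 1) ℕ.* z fst) (z quo) →
    ∑∑ l (λ i j → avoid₃ l (pt n i j) z) ≡ ι l * ι l - ι 3 * ι l + ι 3
  ∑∑-avoid₃ n l 0<n 0<l l∣n z noncollinear = begin
    ∑ l (λ i → ∑ l (λ j → (1ℚ - A i) * ((1ℚ - B j) * (1ℚ - C i j))))
      ≡⟨ ∑-cong l row ⟩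
    ∑ l (λ i → (ι l - ι 2) + G i - (ι l - ι 2) * A i)
      ≡⟨ trans (∑-sub l (λ i → (ι l - ι 2) + G i) (λ i → (ι l - ι 2) * A i))
           (cong₂ _-_ (trans (∑-+ l (λ _ → ι l - ι 2) G) (cong₂ _+_ (∑-const l (ι l - ι 2)) ∑G))
             (trans (∑-*ˡ l (ι l - ι 2) A) (cong ((ι l - ι 2) *_) (∑-δ l 0<l (z fst))))) ⟩
    ι l * (ι l - ι 2) + 1ℚ - (ι l - ι 2) * 1ℚ
      ≡⟨ lem (ι l) ⟩
    ι l * ι l - ι 3 * ι l + ι 3 ∎
    where
    open ≡-Reasoning
    m = n ℕ.∸ 1
    A B : ℕ → ℚ
    A i = δ l i (z fst)
    B j = δ l j (z snd)
    C : ℕ → ℕ → ℚ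
    C i j = δ l (j ℕ.+ m ℕ.* i) (z quo)
    G : ℕ → ℚ
    G i = ∑ l (λ j → B j * C i j)
    lem : ∀ l → l * (l - ι 2) + 1ℚ - (l - ι 2) * 1ℚ ≡ l * l - ι 3 * l + ι 3
    lem = solve-∀ ℚ-ring
    triple : ∀ i j → A i * (B j * C i j) ≡ 0ℚ
    triple i j with cong? l i (z fst) | cong? l j (z snd) | cong? l (j ℕ.+ m ℕ.* i) (z quo)
    ... | no _  | b     | c     = ℚₚ.*-zeroˡ (𝟙 b * 𝟙 c)
    ... | yes _ | no _  | c     = cong (1ℚ *_) (ℚₚ.*-zeroˡ (𝟙 c))
    ... | yes _ | yes _ | no _  = refl
    ... | yes p | yes q | yes s = ⊥-elim (noncollinear (Cong-trans (Cong-sym (Cong-+ q (Cong-* m p))) s))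
    AG : ∀ i → A i * G i ≡ 0ℚ
    AG i = trans (sym (∑-*ˡ l (A i) (λ j → B j * C i j))) (trans (∑-cong l (triple i)) (∑-zero l))
    ∑C : ∀ i → ∑ l (C i) ≡ 1ℚ
    ∑C i = ∑-δ-shift l 0<l (m ℕ.* i) (z quo)
    -- The third line solved for `i` instead of `j`, so that it can also be summed over `i`.
    C-flip : ∀ i j → C i j ≡ δ l (i ℕ.+ z quo) j
    C-flip i j = 𝟙-cong (cong? l (j ℕ.+ m ℕ.* i) (z quo)) (cong? l (i ℕ.+ z quo) j)
      (λ p → Cong-trans (Cong-reflexive (ℕₚ.+-comm i (z quo))) (Cong-trans (Cong-sym (Cong-+ʳ i p)) cancel))
      (λ p → Cong-cancelʳ i (Cong-trans cancel (Cong-trans (Cong-sym p) (Cong-reflexive (ℕₚ.+-comm i (z quo))))))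
      where
      cancel : Cong l (j ℕ.+ m ℕ.* i ℕ.+ i) j
      cancel = Cong-trans (Cong-reflexive (ℕₚ.+-assoc j (m ℕ.* i) i))
        (subst (Cong l (j ℕ.+ (m ℕ.* i ℕ.+ i))) (ℕₚ.+-identityʳ j) (Cong-+ˡ j (Cong-neg 0<n l∣n i)))
    ∑G : ∑ l G ≡ 1ℚ
    ∑G = begin
      ∑ l (λ i → ∑ l (λ j → B j * C i j))
        ≡⟨ ∑-swap l l (λ i j → B j * C i j) ⟩
      ∑ l (λ j → ∑ l (λ i → B j * C i j))
        ≡⟨ (∑-cong l λ j → trans (∑-*ˡ l (B j) (λ i → C i j)) (trans (cong (B j *_)
             (trans (∑-cong l λ i → C-flip i j) (∑-δ-shift l 0<l (z quo) j))) (ℚₚ.*-identityʳ (B j)))) ⟩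
      ∑ l B
        ≡⟨ ∑-δ l 0<l (z snd) ⟩
      1ℚ ∎
    row : ∀ i → ∑ l (λ j → (1ℚ - A i) * ((1ℚ - B j) * (1ℚ - C i j))) ≡ (ι l - ι 2) + G i - (ι l - ι 2) * A i
    row i = begin
      ∑ l (λ j → (1ℚ - A i) * ((1ℚ - B j) * (1ℚ - C i j)))
        ≡⟨ ∑-*ˡ l (1ℚ - A i) (λ j → (1ℚ - B j) * (1ℚ - C i j)) ⟩
      (1ℚ - A i) * ∑ l (λ j → (1ℚ - B j) * (1ℚ - C i j))
        ≡⟨ cong ((1ℚ - A i) *_) (trans (∑-cong l λ j → expand (B j) (C i j))
             (trans (∑-+ l (λ j → 1ℚ - B j - C i j) (λ j → B j * C i j)) (cong (_+ G i)
               (trans (∑-sub l (λ j → 1ℚ - B j) (C i)) (cong₂ _-_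
                 (trans (∑-sub l (λ _ → 1ℚ) B) (cong₂ _-_ (∑-const l 1ℚ) (∑-δ l 0<l (z snd)))) (∑C i)))))) ⟩
      (1ℚ - A i) * (ι l * 1ℚ - 1ℚ - 1ℚ + G i)
        ≡⟨ lem₁ (A i) (ι l) (G i) ⟩
      (ι l - ι 2) + G i - (ι l - ι 2) * A i - A i * G i
        ≡⟨ cong (λ x → (ι l - ι 2) + G i - (ι l - ι 2) * A i - x) (AG i) ⟩
      (ι l - ι 2) + G i - (ι l - ι 2) * A i - 0ℚ
        ≡⟨ ℚₚ.+-identityʳ _ ⟩
      (ι l - ι 2) + G i - (ι l - ι 2) * A i ∎
      where
      expand : ∀ b c → (1ℚ - b) * (1ℚ - c) ≡ 1ℚ - b - c + b * c
      expand = solve-∀ ℚ-ring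
      lem₁ : ∀ a l g → (1ℚ - a) * (l * 1ℚ - 1ℚ - 1ℚ + g) ≡ (l - ι 2) + g - (l - ι 2) * a - a * g
      lem₁ = solve-∀ ℚ-ring

  -- The share (l² - 3 l + 3) / l² of (ℤ/l)² that misses three lines in general position.
  generic-density : ℕ → ℚ
  generic-density l = 1ℚ - ι 3 * inv l + ι 3 * (inv l * inv l)

  module Averages
    (n : ℕ) (0<n : 0 ℕ.< n) (L : List ℕ) (primes : All Prime L) (uniq : Unique L)
    (L∣n : ∀ {l} → l ∈ L → l ℕ∣.∣ n) (z : Point)
    where

    F : ℕ → ℕ → ℚ
    F i j = avoid (triples L) (pt n i j) z

    F-prod : ∀ i j → F i j ≡ prodL L (λ l → avoid₃ l (pt n i j) z)
    F-prod i j = avoid-triples L (pt n i j) z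

    F-invariant : ∀ c → (∀ {l} → l ∈ L → l ℕ∣.∣ c) → Periodic c F
    F-invariant c L∣c =
        (λ i j → eq (Cong-+∣ i) (λ _ → Cong-refl j))
      , (λ i j → eq (λ _ → Cong-refl i) (Cong-+∣ j))
      where
      eq : ∀ {i i′ j j′} → (∀ {l} → l ℕ∣.∣ c → Cong l i i′) → (∀ {l} → l ℕ∣.∣ c → Cong l j j′) → F i j ≡ F i′ j′
      eq {i} {i′} {j} {j′} p q = trans (F-prod i j) (trans
        (prodL-cong L λ {l} m → avoid₃-respects n z l (p (L∣c m)) (q (L∣c m))) (sym (F-prod i′ j′)))

    ∑∑F : (∀ {l} → l ∈ L → ¬ Cong l (z snd ℕ.+ (n ℕ.∸ 1) ℕ.* z fst) (z quo)) →
      ∑∑ n F ≡ ι n * (ι n * prodL L generic-density)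
    ∑∑F noncollinear = trans (∑∑-cong n F-prod)
      (∑∑-prodL n L primes uniq L∣n (λ l i j → avoid₃ l (pt n i j) z) generic-density (avoid₃-respects n z) local)
      where
      local : ∀ {l} → l ∈ L → ∑∑ l (λ i j → avoid₃ l (pt n i j) z) ≡ ι l * (ι l * generic-density l)
      local {l} m = trans (∑∑-avoid₃ n l 0<n 0<l (L∣n m) z (noncollinear m)) (sym (begin
        ι l * (ι l * (1ℚ - ι 3 * inv l + ι 3 * (inv l * inv l)))
          ≡⟨ lem (ι l) (inv l) ⟩
        ι l * ι l - ι 3 * ((inv l * ι l) * ι l) + ι 3 * ((inv l * ι l) * (inv l * ι l))
          ≡⟨ cong (λ x → ι l * ι l - ι 3 * (x * ι l) + ι 3 * (x * x)) (inv-*-ι l 0<l) ⟩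
        ι l * ι l - ι 3 * (1ℚ * ι l) + ι 3 * (1ℚ * 1ℚ)
          ≡⟨ lem′ (ι l) ⟩
        ι l * ι l - ι 3 * ι l + ι 3 ∎))
        where
        open ≡-Reasoning
        0<l : 0 ℕ.< l
        0<l = ℕₚ.<⇒≤ (prime⇒2≤ (All.lookup primes m))
        lem : ∀ l v → l * (l * (1ℚ - ι 3 * v + ι 3 * (v * v))) ≡ l * l - ι 3 * ((v * l) * l) + ι 3 * ((v * l) * (v * l))
        lem = solve-∀ ℚ-ring
        lem′ : ∀ l → l * l - ι 3 * (1ℚ * l) + ι 3 * (1ℚ * 1ℚ) ≡ l * l - ι 3 * l + ι 3
        lem′ = solve-∀ ℚ-ring

  ∑-κ-shift : ∀ l → 2 ℕ.≤ l → ∀ c a → ∑ l (λ r → κ l (r ℕ.+ c) a) ≡ 0ℚ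
  ∑-κ-shift l 2≤l c a = trans (∑-*ˡ l (inv (l ℕ.∸ 1)) (λ r → ι l * δ l (r ℕ.+ c) a - 1ℚ))
    (trans (cong (inv (l ℕ.∸ 1) *_) (trans (∑-sub l (λ r → ι l * δ l (r ℕ.+ c) a) (λ _ → 1ℚ))
      (cong₂ _-_ (trans (∑-*ˡ l (ι l) (λ r → δ l (r ℕ.+ c) a)) (cong (ι l *_) (∑-δ-shift l (ℕₚ.<⇒≤ 2≤l) c a))) (∑-const l 1ℚ))))
    (trans (cong (inv (l ℕ.∸ 1) *_) (ℚₚ.+-inverseʳ (ι l * 1ℚ))) (ℚₚ.*-zeroʳ (inv (l ℕ.∸ 1)))))

-- Cyclicity of the unit group of a finite field.

module CyclicUnits where
  open PositiveDefiniteKernels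
  open ResidueAverages

  isPrimeDivisor? : ∀ m l → Dec (Prime l × l ℕ∣.∣ m)
  isPrimeDivisor? m l = prime? l ×-dec (l ℕ∣.∣? m)

  ∈-primeDivisors⁻ : ∀ m {l} → l ∈ primeDivisors m → Prime l × l ℕ∣.∣ m
  ∈-primeDivisors⁻ m l∈ = proj₂ (∈-filter⁻ (isPrimeDivisor? m) {xs = List.upTo (suc m)} l∈)

  ∈-primeDivisors⁺ : ∀ m {l} → 0 ℕ.< m → Prime l → l ℕ∣.∣ m → l ∈ primeDivisors m
  ∈-primeDivisors⁺ m {l} 0<m pr l∣m = ∈-filter⁺ (isPrimeDivisor? m)
    (∈-upTo⁺ (ℕ.s≤s (ℕ∣.∣⇒≤ {{ℕ.>-nonZero 0<m}} l∣m))) (pr , l∣m)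

  primeDivisors-unique : ∀ m → Unique (primeDivisors m)
  primeDivisors-unique m = Uniqueₚ.filter⁺ (isPrimeDivisor? m) (Uniqueₚ.upTo⁺ (suc m))

  primeDivisors-prime : ∀ m → All Prime (primeDivisors m)
  primeDivisors-prime m = All.tabulate λ l∈ → proj₁ (∈-primeDivisors⁻ m l∈)

  primeFactor : ∀ e → 2 ℕ.≤ e → ∃ λ l → Prime l × l ℕ∣.∣ e
  primeFactor e 2≤e with factorise e {{ℕ.>-nonZero (ℕₚ.<⇒≤ 2≤e)}}
  ... | record { factors = []     ; isFactorisation = eq } = ⊥-elim (ℕₚ.<-irrefl (≡.sym eq) 2≤e)
  ... | record { factors = l ∷ fs ; isFactorisation = eq ; factorsPrime = pr ∷ _ } =
    l , pr , ≡.subst (l ℕ∣.∣_) (≡.sym eq) (ℕ∣.m∣m*n (product fs))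

  primePart : ∀ l → 2 ℕ.≤ l → ∀ n → 0 ℕ.< n → ∃ λ a → ∃ λ n′ → n ≡ l ℕ.^ a ℕ.* n′ × ¬ (l ℕ∣.∣ n′)
  primePart l 2≤l = <-rec _ go
    where
    go : ∀ n → (∀ {m} → m ℕ.< n → 0 ℕ.< m → ∃ λ a → ∃ λ n′ → m ≡ l ℕ.^ a ℕ.* n′ × ¬ (l ℕ∣.∣ n′)) →
      0 ℕ.< n → ∃ λ a → ∃ λ n′ → n ≡ l ℕ.^ a ℕ.* n′ × ¬ (l ℕ∣.∣ n′)
    go n rec 0<n with l ℕ∣.∣? n
    ... | no l∤n = 0 , n , ≡.sym (ℕₚ.*-identityˡ n) , l∤n
    ... | yes d@(ℕ∣.divides m n≡m*l) with rec m<n 0<m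
      where
      instance
        _ = ℕ.>-nonZero 0<n
        _ = ℕ.n>1⇒nonTrivial 2≤l
      m<n : m ℕ.< n
      m<n = ℕ∣.quotient-< d
      0<m : 0 ℕ.< m
      0<m = ℕ.>-nonZero⁻¹ m {{ℕ∣.quotient≢0 d}}
    ... | a , n′ , m≡ , l∤n′ = suc a , n′
      , ≡.trans n≡m*l (≡.trans (ℕₚ.*-comm m l) (≡.trans (≡.cong (l ℕ.*_) m≡) (≡.sym (ℕₚ.*-assoc l (l ℕ.^ a) n′))))
      , l∤n′

  prime∣^⇒∣ : ∀ {p} → Prime p → ∀ l a → p ℕ∣.∣ l ℕ.^ a → p ℕ∣.∣ l
  prime∣^⇒∣ {p} pr l zero    p∣1 = ⊥-elim (ℕₚ.<⇒≱ (prime⇒2≤ pr) (ℕ∣.∣⇒≤ p∣1))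
  prime∣^⇒∣ {p} pr l (suc a) p∣ with euclidsLemma l (l ℕ.^ a) pr p∣
  ... | inj₁ p∣l = p∣l
  ... | inj₂ p∣la = prime∣^⇒∣ pr l a p∣la

  prime∣prime⇒≡ : ∀ {p l} → Prime p → Prime l → p ℕ∣.∣ l → p ≡ l
  prime∣prime⇒≡ pp pl p∣l with prime⇒irreducible pl p∣l
  ... | inj₁ ≡.refl = ⊥-elim (ℕₚ.<-irrefl ≡.refl (prime⇒2≤ pp))
  ... | inj₂ eq = eq

  prime∤⇒coprime : ∀ {l m} → Prime l → ¬ (l ℕ∣.∣ m) → Coprimality.Coprime l m
  prime∤⇒coprime pr l∤m (d∣l , d∣m) with prime⇒irreducible pr d∣l
  ... | inj₁ d≡1    = d≡1
  ... | inj₂ ≡.refl = ⊥-elim (l∤m d∣m)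

  module Powers {c ℓ} {q} (F : FiniteField c ℓ q) where
    open FiniteField F
    open SetoidReasoning setoid
    open SemiringSolver commutativeSemiring using (solve; _:=_; _:+_; _:*_)

    NonZero : Carrier → Set ℓ
    NonZero x = ¬ (x ≈ 0#)

    _≟_ : ∀ x y → Dec (x ≈ y)
    x ≟ y with enum-sur x | enum-sur y
    ... | i , ei | j , ej with i Finₚ.≟ j
    ... | yes ≡.refl = yes (trans (sym ei) ej)
    ... | no i≢j     = no λ x≈y → i≢j (enum-inj i j (trans ei (trans x≈y (sym ej))))

    *-cancelˡ : ∀ {z x y} → NonZero z → z * x ≈ z * y → x ≈ y
    *-cancelˡ {z} {x} {y} z≉0 eq = begin
      x                ≈⟨ sym (undo x) ⟩
      z ⁻¹ * (z * x)   ≈⟨ *-congˡ eq ⟩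
      z ⁻¹ * (z * y)   ≈⟨ undo y ⟩
      y                ∎
      where
      undo : ∀ x → z ⁻¹ * (z * x) ≈ x
      undo x = begin
        z ⁻¹ * (z * x)   ≈⟨ sym (*-assoc _ _ _) ⟩
        (z ⁻¹ * z) * x   ≈⟨ *-congʳ (trans (*-comm _ _) (inverseʳ z z≉0)) ⟩
        1# * x           ≈⟨ *-identityˡ x ⟩
        x                ∎

    *-nonZero : ∀ {x y} → NonZero x → NonZero y → NonZero (x * y)
    *-nonZero x≉0 y≉0 xy≈0 = y≉0 (*-cancelˡ x≉0 (trans xy≈0 (sym (zeroʳ _))))

    ⁻¹-nonZero : ∀ {x} → NonZero x → NonZero (x ⁻¹)
    ⁻¹-nonZero {x} x≉0 eq = 1≉0 (trans (sym (inverseʳ x x≉0)) (trans (*-congˡ eq) (zeroʳ x)))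

    NonZero-resp : ∀ {x y} → x ≈ y → NonZero x → NonZero y
    NonZero-resp x≈y x≉0 y≈0 = x≉0 (trans x≈y y≈0)

    ^-nonZero : ∀ {x} → NonZero x → ∀ m → NonZero (x ^ m)
    ^-nonZero x≉0 zero    = 1≉0
    ^-nonZero x≉0 (suc m) = *-nonZero x≉0 (^-nonZero x≉0 m)

    ^-cong : ∀ {x y} → x ≈ y → ∀ m → x ^ m ≈ y ^ m
    ^-cong eq zero    = refl
    ^-cong eq (suc m) = *-cong eq (^-cong eq m)

    ^-+ : ∀ x m k → x ^ (m ℕ.+ k) ≈ x ^ m * x ^ k
    ^-+ x zero    k = sym (*-identityˡ _)
    ^-+ x (suc m) k = trans (*-congˡ (^-+ x m k)) (sym (*-assoc _ _ _))

    1^ : ∀ m → 1# ^ m ≈ 1#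
    1^ zero    = refl
    1^ (suc m) = trans (*-identityˡ _) (1^ m)

    *-^ : ∀ x y m → (x * y) ^ m ≈ x ^ m * y ^ m
    *-^ x y zero    = sym (*-identityˡ _)
    *-^ x y (suc m) = trans (*-congˡ (*-^ x y m))
      (solve 4 (λ a b c d → (a :* b) :* (c :* d) := (a :* c) :* (b :* d)) refl x y (x ^ m) (y ^ m))

    ^-* : ∀ x m k → x ^ (m ℕ.* k) ≈ (x ^ m) ^ k
    ^-* x zero    k = sym (1^ k)
    ^-* x (suc m) k = begin
      x ^ (k ℕ.+ m ℕ.* k)      ≈⟨ ^-+ x k (m ℕ.* k) ⟩
      x ^ k * x ^ (m ℕ.* k)    ≈⟨ *-congˡ (^-* x m k) ⟩
      x ^ k * (x ^ m) ^ k      ≈⟨ sym (*-^ x (x ^ m) k) ⟩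
      (x * x ^ m) ^ k          ∎

    ^-≡ : ∀ x {m k} → m ≡ k → x ^ m ≈ x ^ k
    ^-≡ x eq = reflexive (≡.cong (x ^_) eq)

    ^≈1-∣ : ∀ {x m k} → x ^ m ≈ 1# → m ℕ∣.∣ k → x ^ k ≈ 1#
    ^≈1-∣ {x} {m} eq (ℕ∣.divides t k≡) = trans (^-≡ x (≡.trans k≡ (ℕₚ.*-comm t m)))
      (trans (^-* x m t) (trans (^-cong eq t) (1^ t)))

    ^≈1-gcd : ∀ {x} a b → x ^ a ≈ 1# → x ^ b ≈ 1# → x ^ gcd a b ≈ 1#
    ^≈1-gcd {x} a b xa xb with Bézout.identity (gcd-GCD a b)
    ... | Bézout.+- s t eq = begin
      x ^ gcd a b                   ≈⟨ sym (*-identityʳ _) ⟩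
      x ^ gcd a b * 1#              ≈⟨ *-congˡ (sym (^≈1-∣ xb (ℕ∣.n∣m*n t))) ⟩
      x ^ gcd a b * x ^ (t ℕ.* b)   ≈⟨ sym (^-+ x (gcd a b) (t ℕ.* b)) ⟩
      x ^ (gcd a b ℕ.+ t ℕ.* b)     ≈⟨ ^-≡ x eq ⟩
      x ^ (s ℕ.* a)                 ≈⟨ ^≈1-∣ xa (ℕ∣.n∣m*n s) ⟩
      1#                            ∎
    ... | Bézout.-+ s t eq = begin
      x ^ gcd a b                   ≈⟨ sym (*-identityʳ _) ⟩
      x ^ gcd a b * 1#              ≈⟨ *-congˡ (sym (^≈1-∣ xa (ℕ∣.n∣m*n s))) ⟩
      x ^ gcd a b * x ^ (s ℕ.* a)   ≈⟨ sym (^-+ x (gcd a b) (s ℕ.* a)) ⟩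
      x ^ (gcd a b ℕ.+ s ℕ.* a)     ≈⟨ ^-≡ x eq ⟩
      x ^ (t ℕ.* b)                 ≈⟨ ^≈1-∣ xb (ℕ∣.n∣m*n t) ⟩
      1#                            ∎

    -- Polynomials as functions in Horner form, indexed by degree. Only evaluation matters, so no
    -- lists of coefficients are kept.
    data Monic : ℕ → (Carrier → Carrier) → Set (c ⊔ ℓ) where
      one  : ∀ {f} → (∀ x → f x ≈ 1#) → Monic 0 f
      step : ∀ {m f g} → Monic m g → ∀ c → (∀ x → f x ≈ x * g x + c) → Monic (suc m) f

    -- f x - f a = (x - a) g x, with the subtractions moved across.
    factor : ∀ {m f} → Monic (suc m) f → ∀ a → ∃ λ g → Monic m g × (∀ x → f x + a * g x ≈ f a + x * g x)
    factor {f = f} (step {g = h} (one h≈1) c f≈) a = (λ _ → 1#) , one (λ _ → refl) , λ x → begin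
      f x + a * 1#             ≈⟨ +-congʳ (trans (f≈ x) (+-congʳ (*-congˡ (h≈1 x)))) ⟩
      x * 1# + c + a * 1#      ≈⟨ solve 3 (λ x a c → x :+ c :+ a := a :+ c :+ x) refl (x * 1#) (a * 1#) c ⟩
      a * 1# + c + x * 1#      ≈⟨ +-congʳ (sym (trans (f≈ a) (+-congʳ (*-congˡ (h≈1 a))))) ⟩
      f a + x * 1#             ∎
    factor {f = f} (step {g = h} hm@(step _ _ _) c f≈) a with factor hm a
    ... | g , gm , eq = (λ x → x * g x + h a) , step gm (h a) (λ _ → refl) , λ x → begin
      f x + a * (x * g x + h a)
        ≈⟨ +-congʳ (f≈ x) ⟩
      x * h x + c + a * (x * g x + h a)
        ≈⟨ solve 6 (λ x a c hx ha gx → x :* hx :+ c :+ a :* (x :* gx :+ ha) := x :* (hx :+ a :* gx) :+ (c :+ a :* ha))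
             refl x a c (h x) (h a) (g x) ⟩
      x * (h x + a * g x) + (c + a * h a)
        ≈⟨ +-congʳ (*-congˡ (eq x)) ⟩
      x * (h a + x * g x) + (c + a * h a)
        ≈⟨ solve 5 (λ x a c ha gx → x :* (ha :+ x :* gx) :+ (c :+ a :* ha) := a :* ha :+ c :+ x :* (x :* gx :+ ha))
             refl x a c (h a) (g x) ⟩
      a * h a + c + x * (x * g x + h a)
        ≈⟨ +-congʳ (sym (f≈ a)) ⟩
      f a + x * (x * g x + h a) ∎

    -- The root a = e 0 is divided out by `factor`. At another root b the factor identity becomes a
    -- g(b) = b g(b), so b is a root of the quotient because it differs from a.
    roots≤degree : ∀ {m f k} → Monic m f → (e : Fin k → Carrier) →
      (∀ i j → e i ≈ e j → i ≡ j) → (∀ i → f (e i) ≈ 0#) → k ℕ.≤ m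
    roots≤degree {k = zero}  _         e inj root = ℕ.z≤n
    roots≤degree {k = suc k} (one f≈1) e inj root =
      ⊥-elim (1≉0 (trans (sym (f≈1 (e Fin.zero))) (root Fin.zero)))
    roots≤degree {suc m} {f} {suc k} fm@(step _ _ _) e inj root with factor fm (e Fin.zero)
    ... | g , gm , eq = ℕ.s≤s (roots≤degree gm (λ i → e (Fin.suc i))
        (λ i j p → Finₚ.suc-injective (inj (Fin.suc i) (Fin.suc j) p)) gRoot)
      where
      a = e Fin.zero
      gRoot : ∀ i → g (e (Fin.suc i)) ≈ 0#
      gRoot i with g (e (Fin.suc i)) ≟ 0#
      ... | yes p = p
      ... | no g≉0 with inj Fin.zero (Fin.suc i) (*-cancelˡ g≉0 (begin
              g b * a          ≈⟨ *-comm _ _ ⟩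
              a * g b          ≈⟨ sym (+-identityˡ _) ⟩
              0# + a * g b     ≈⟨ +-congʳ (sym (root (Fin.suc i))) ⟩
              f b + a * g b    ≈⟨ eq b ⟩
              f a + b * g b    ≈⟨ +-congʳ (root Fin.zero) ⟩
              0# + b * g b     ≈⟨ +-identityˡ _ ⟩
              b * g b          ≈⟨ *-comm _ _ ⟩
              g b * b          ∎))
        where b = e (Fin.suc i)
      ... | ()

    monic-^ : ∀ m → Monic m (_^ m)
    monic-^ zero    = one λ _ → refl
    monic-^ (suc m) = step (monic-^ m) 0# λ x → sym (+-identityʳ _)

    unityRoots≤ : ∀ m k → 0 ℕ.< m → (e : Fin k → Carrier) → (∀ i j → e i ≈ e j → i ≡ j) →
      (∀ i → e i ^ m ≈ 1#) → k ℕ.≤ m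
    unityRoots≤ (suc m) k _ e inj root = roots≤degree (step (monic-^ m) (- 1#) λ _ → refl) e inj
      λ i → trans (+-congʳ (root i)) (-‿inverseʳ 1#)

  record PrimitiveRoot {c ℓ q} (F : FiniteField c ℓ q) (n : ℕ) : Set (c ⊔ ℓ) where
    open FiniteField F
    field
      g         : Carrier
      g≉0       : ¬ (g ≈ 0#)
      ^-period  : ∀ {i j} → Cong n i j → g ^ i ≈ g ^ j
      ^-inj     : ∀ {i j} → g ^ i ≈ g ^ j → Cong n i j
      log       : ∀ x → ¬ (x ≈ 0#) → ∃ λ i → i ℕ.< n × x ≈ g ^ i

  module Cyclic {c ℓ} {n} (F : FiniteField c ℓ (suc n)) (0<n : 0 ℕ.< n) where
    open FiniteField F
    open Powers F
    open SetoidReasoning setoid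
    module Π = CommutativeMonoidSum *-commutativeMonoid
    open SemiringSolver commutativeSemiring using (solve; _:=_; _:*_)

    i₀ : Fin (suc n)
    i₀ = proj₁ (enum-sur 0#)

    unit : Fin n → Carrier
    unit i = enum (punchIn i₀ i)

    unit-nonZero : ∀ i → NonZero (unit i)
    unit-nonZero i eq = Finₚ.punchInᵢ≢i i₀ i (enum-inj _ _ (trans eq (sym (proj₂ (enum-sur 0#)))))

    unit-inj : ∀ i j → unit i ≈ unit j → i ≡ j
    unit-inj i j eq = Finₚ.punchIn-injective i₀ i j (enum-inj _ _ eq)

    unit-sur : ∀ x → NonZero x → ∃ λ i → unit i ≈ x
    unit-sur x x≉0 with enum-sur x
    ... | j , ej = punchOut i₀≢j , trans (reflexive (≡.cong enum (Finₚ.punchIn-punchOut i₀≢j))) ej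
      where
      i₀≢j : i₀ ≢ j
      i₀≢j ≡.refl = x≉0 (trans (sym ej) (proj₂ (enum-sur 0#)))

    Π-nonZero : ∀ {m} (e : Fin m → Carrier) → (∀ i → NonZero (e i)) → NonZero (Π.sum e)
    Π-nonZero {zero}  e e≉0 = 1≉0
    Π-nonZero {suc m} e e≉0 = *-nonZero (e≉0 Fin.zero) (Π-nonZero (λ i → e (Fin.suc i)) (λ i → e≉0 (Fin.suc i)))

    Π-scale : ∀ {m} x (e : Fin m → Carrier) → Π.sum (λ i → x * e i) ≈ x ^ m * Π.sum e
    Π-scale {zero}  x e = sym (*-identityˡ _)
    Π-scale {suc m} x e = trans (*-congˡ (Π-scale x (λ i → e (Fin.suc i))))
      (solve 4 (λ a b c d → (a :* b) :* (c :* d) := (a :* c) :* (b :* d)) refl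
        x (e Fin.zero) (x ^ m) (Π.sum (λ i → e (Fin.suc i))))

    -- Multiplication by `x` permutes the units, so the product of all units equals x^n times itself
    -- and can be cancelled.
    lagrange : ∀ x → NonZero x → x ^ n ≈ 1#
    lagrange x x≉0 = *-cancelˡ (Π-nonZero unit unit-nonZero) (begin
      Π.sum unit * x ^ n                        ≈⟨ *-comm _ _ ⟩
      x ^ n * Π.sum unit                        ≈⟨ sym (Π-scale x unit) ⟩
      Π.sum (λ i → x * unit i)                  ≈⟨ Π.sum-cong-≋ (λ i → sym (times-unit x x≉0 i)) ⟩
      Π.sum (λ i → unit (times x x≉0 i))        ≈⟨ sym (Π.sum-permute unit π) ⟩
      Π.sum unit                                ≈⟨ sym (*-identityʳ _) ⟩
      Π.sum unit * 1#                           ∎)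
      where
      times : ∀ x → NonZero x → Fin n → Fin n
      times x x≉0 i = proj₁ (unit-sur (x * unit i) (*-nonZero x≉0 (unit-nonZero i)))
      times-unit : ∀ x x≉0 i → unit (times x x≉0 i) ≈ x * unit i
      times-unit x x≉0 i = proj₂ (unit-sur (x * unit i) (*-nonZero x≉0 (unit-nonZero i)))
      undo : ∀ {x y} x≉0 y≉0 → x * y ≈ 1# → ∀ i → times x x≉0 (times y y≉0 i) ≡ i
      undo {x} {y} x≉0 y≉0 xy≈1 i = unit-inj _ _ (begin
        unit (times x x≉0 (times y y≉0 i))   ≈⟨ times-unit x x≉0 _ ⟩
        x * unit (times y y≉0 i)             ≈⟨ *-congˡ (times-unit y y≉0 i) ⟩
        x * (y * unit i)                     ≈⟨ sym (*-assoc _ _ _) ⟩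
        (x * y) * unit i                     ≈⟨ *-congʳ xy≈1 ⟩
        1# * unit i                          ≈⟨ *-identityˡ _ ⟩
        unit i                               ∎)
      x⁻¹≉0 = ⁻¹-nonZero x≉0
      π = permutation (times x x≉0) (times (x ⁻¹) x⁻¹≉0)
        (undo x≉0 x⁻¹≉0 (inverseʳ x x≉0)) (undo x⁻¹≉0 x≉0 (trans (*-comm _ _) (inverseʳ x x≉0)))

    -- Otherwise all `n` units would be roots of X^d - 1, too many for the degree d < n.
    notUnityRoot : ∀ d → 0 ℕ.< d → d ℕ.< n → ∃ λ x → NonZero x × ¬ (x ^ d ≈ 1#)
    notUnityRoot d 0<d d<n with Finₚ.any? (λ i → ¬? ((unit i ^ d) ≟ 1#))
    ... | yes (i , p) = unit i , unit-nonZero i , p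
    ... | no none = ⊥-elim (ℕₚ.<⇒≱ d<n (unityRoots≤ d n 0<d unit unit-inj
      λ i → decidable-stable ((unit i ^ d) ≟ 1#) λ p → none (i , p)))

    -- Some x has x^(n/l) ≠ 1; take y = x^n′, where n′ is the part of `n` prime to `l`. A prime l′ ≠
    -- l dividing n divides n′, so n divides n′ (n/l′) and y^(n/l′) = 1. If y^(n/l) were 1, the
    -- order of x^(n/l) would divide both `l` and n′, hence be 1.
    sylow : ∀ {l} → Prime l → l ℕ∣.∣ n → ∃ λ y → NonZero y ×
      (∀ d → n ≡ l ℕ.* d → ¬ (y ^ d ≈ 1#)) ×
      (∀ {l′} → Prime l′ → l′ ≢ l → ∀ d → n ≡ l′ ℕ.* d → y ^ d ≈ 1#)
    sylow {l} pr l∣n@(ℕ∣.divides d₀ n≡d₀*l) with primePart l (prime⇒2≤ pr) n 0<n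
    ... | a , n′ , n≡ , l∤n′ with notUnityRoot d₀
        (ℕ.>-nonZero⁻¹ d₀ {{ℕ∣.quotient≢0 l∣n {{ℕ.>-nonZero 0<n}}}})
        (ℕ∣.quotient-< l∣n {{prime⇒nonTrivial pr}} {{ℕ.>-nonZero 0<n}})
    ... | x , x≉0 , xd≉1 = x ^ n′ , ^-nonZero x≉0 n′ , nontrivial , trivial
      where
      instance _ = prime⇒nonZero pr
      nontrivial : ∀ d → n ≡ l ℕ.* d → ¬ ((x ^ n′) ^ d ≈ 1#)
      nontrivial d n≡l*d eq = xd≉1 (begin
        x ^ d₀                    ≈⟨ ^-≡ x (≡.sym d≡d₀) ⟩
        x ^ d                     ≈⟨ sym (*-identityʳ _) ⟩
        (x ^ d) ^ 1               ≈⟨ ^-≡ (x ^ d) (≡.sym (Coprimality.coprime⇒gcd≡1 (prime∤⇒coprime pr l∤n′))) ⟩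
        (x ^ d) ^ gcd l n′        ≈⟨ ^≈1-gcd l n′ wl wn′ ⟩
        1#                        ∎)
        where
        d≡d₀ : d ≡ d₀
        d≡d₀ = ℕₚ.*-cancelˡ-≡ d d₀ l (≡.trans (≡.sym n≡l*d) (≡.trans n≡d₀*l (ℕₚ.*-comm d₀ l)))
        wl : (x ^ d) ^ l ≈ 1#
        wl = trans (sym (^-* x d l)) (trans (^-≡ x (≡.trans (ℕₚ.*-comm d l) (≡.sym n≡l*d))) (lagrange x x≉0))
        wn′ : (x ^ d) ^ n′ ≈ 1#
        wn′ = trans (sym (^-* x d n′)) (trans (^-≡ x (ℕₚ.*-comm d n′)) (trans (^-* x n′ d) eq))
      trivial : ∀ {l′} → Prime l′ → l′ ≢ l → ∀ d → n ≡ l′ ℕ.* d → (x ^ n′) ^ d ≈ 1#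
      trivial {l′} pr′ l′≢l d n≡l′*d with euclidsLemma (l ℕ.^ a) n′ pr′ (≡.subst (l′ ℕ∣.∣_) (≡.trans (≡.sym n≡l′*d) n≡) (ℕ∣.m∣m*n d))
      ... | inj₁ l′∣la = ⊥-elim (l′≢l (prime∣prime⇒≡ pr′ pr (prime∣^⇒∣ pr′ l a l′∣la)))
      ... | inj₂ (ℕ∣.divides n″ n′≡) = trans (sym (^-* x n′ d)) (^≈1-∣ (lagrange x x≉0) (ℕ∣.divides n″
              (≡.trans (≡.cong (ℕ._* d) n′≡) (≡.trans (ℕₚ.*-assoc n″ l′ d) (≡.cong (n″ ℕ.*_) (≡.sym n≡l′*d))))))

    Separates : List ℕ → Carrier → Set ℓ
    Separates L y = NonZero y ×
      (∀ {l} → l ∈ L → ∀ d → n ≡ l ℕ.* d → ¬ (y ^ d ≈ 1#)) ×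
      (∀ {l} → Prime l → l ∉ L → ∀ d → n ≡ l ℕ.* d → y ^ d ≈ 1#)

    -- At each exponent n/l′ at most one of the two factors differs from 1, so non-triviality at one
    -- prime is never cancelled by the other factor.
    separates-* : ∀ {l L y z} → Prime l → All Prime L → l ∉ L →
      NonZero y × (∀ d → n ≡ l ℕ.* d → ¬ (y ^ d ≈ 1#)) ×
        (∀ {l′} → Prime l′ → l′ ≢ l → ∀ d → n ≡ l′ ℕ.* d → y ^ d ≈ 1#) →
      Separates L z → Separates (l ∷ L) (y * z)
    separates-* {l} {L} {y} {z} pr prs l∉L (y≉0 , y-l , y-l′) (z≉0 , z-in , z-out) =
      *-nonZero y≉0 z≉0 , inside , outside
      where
      inside : ∀ {l′} → l′ ∈ l ∷ L → ∀ d → n ≡ l′ ℕ.* d → ¬ ((y * z) ^ d ≈ 1#)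
      inside (here ≡.refl) d n≡ eq = y-l d n≡ (begin
        y ^ d            ≈⟨ sym (*-identityʳ _) ⟩
        y ^ d * 1#       ≈⟨ *-congˡ (sym (z-out pr l∉L d n≡)) ⟩
        y ^ d * z ^ d    ≈⟨ sym (*-^ y z d) ⟩
        (y * z) ^ d      ≈⟨ eq ⟩
        1#               ∎)
      inside {l′} (there m) d n≡ eq = z-in m d n≡ (begin
        z ^ d            ≈⟨ sym (*-identityˡ _) ⟩
        1# * z ^ d       ≈⟨ *-congʳ (sym (y-l′ (All.lookup prs m) (λ l′≡l → l∉L (≡.subst (_∈ L) l′≡l m)) d n≡)) ⟩
        y ^ d * z ^ d    ≈⟨ sym (*-^ y z d) ⟩
        (y * z) ^ d      ≈⟨ eq ⟩
        1#               ∎)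
      outside : ∀ {l′} → Prime l′ → l′ ∉ l ∷ L → ∀ d → n ≡ l′ ℕ.* d → (y * z) ^ d ≈ 1#
      outside pr′ l′∉ d n≡ = begin
        (y * z) ^ d      ≈⟨ *-^ y z d ⟩
        y ^ d * z ^ d    ≈⟨ *-cong (y-l′ pr′ (λ l′≡l → l′∉ (here l′≡l)) d n≡)
                               (z-out pr′ (λ m → l′∉ (there m)) d n≡) ⟩
        1# * 1#          ≈⟨ *-identityˡ _ ⟩
        1#               ∎

    separate : ∀ L → All Prime L → Unique L → (∀ {l} → l ∈ L → l ℕ∣.∣ n) → ∃ (Separates L)
    separate [] _ _ _ = 1# , 1≉0 , (λ ()) , λ _ _ d _ → 1^ d
    separate (l ∷ L) (pr ∷ prs) uniq@(_ ∷ uniq′) L∣n = proj₁ syl * proj₁ rec ,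
        separates-* pr prs (∉-head uniq) (proj₂ syl) (proj₂ rec)
      where
      syl = sylow pr (L∣n (here ≡.refl))
      rec = separate L prs uniq′ (λ m → L∣n (there m))

    module Generator (g : Carrier) (g≉0 : NonZero g)
      (g-max : ∀ {l} → Prime l → ∀ d → n ≡ l ℕ.* d → ¬ (g ^ d ≈ 1#)) where

      gn : g ^ n ≈ 1#
      gn = lagrange g g≉0
      -- From g^i = g^n = 1 follows g^gcd(i, n) = 1. A prime `l` dividing n / gcd(i, n) would then
      -- give g^(n/l) = 1 against `g-max`, so the gcd is `n`.
      order : ∀ i → g ^ i ≈ 1# → n ℕ∣.∣ i
      order i eq with gcd[m,n]∣n i n
      ... | ℕ∣.divides zero n≡ = ⊥-elim (ℕₚ.<-irrefl (≡.sym n≡) 0<n)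
      ... | ℕ∣.divides 1 n≡ = ≡.subst (ℕ∣._∣ i) (≡.sym (≡.trans n≡ (ℕₚ.*-identityˡ _))) (gcd[m,n]∣m i n)
      ... | ℕ∣.divides e@(suc (suc _)) n≡ with primeFactor e (ℕ.s≤s (ℕ.s≤s ℕ.z≤n))
      ... | l , pr , ℕ∣.divides e′ e≡ = ⊥-elim (g-max pr (e′ ℕ.* gcd i n)
          (≡.trans n≡′ (ℕₚ.*-comm _ l)) (^≈1-∣ (^≈1-gcd i n eq gn) (ℕ∣.n∣m*n e′)))
        where
        lem : ∀ a b c → (a ℕ.* b) ℕ.* c ≡ (a ℕ.* c) ℕ.* b
        lem = solve-∀-ℕ
        n≡′ : n ≡ (e′ ℕ.* gcd i n) ℕ.* l
        n≡′ = ≡.trans n≡ (≡.trans (≡.cong (ℕ._* gcd i n) e≡) (lem e′ l (gcd i n)))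
      period≤ : ∀ {i j} → i ℕ.≤ j → Cong n j i → g ^ j ≈ g ^ i
      period≤ {i} {j} i≤j p = begin
        g ^ j                    ≈⟨ ^-≡ g (≡.sym (ℕₚ.m+[n∸m]≡n i≤j)) ⟩
        g ^ (i ℕ.+ (j ℕ.∸ i))    ≈⟨ ^-+ g i (j ℕ.∸ i) ⟩
        g ^ i * g ^ (j ℕ.∸ i)    ≈⟨ *-congˡ (^≈1-∣ gn (Cong0⇒∣ (Cong-cancelˡ i
                                      (≡.subst₂ (Cong n) (≡.sym (ℕₚ.m+[n∸m]≡n i≤j)) (≡.sym (ℕₚ.+-identityʳ i)) p)))) ⟩
        g ^ i * 1#               ≈⟨ *-identityʳ _ ⟩
        g ^ i                    ∎
      period : ∀ {i j} → Cong n i j → g ^ i ≈ g ^ j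
      period {i} {j} p with ℕₚ.≤-total i j
      ... | inj₁ i≤j = sym (period≤ i≤j (Cong-sym p))
      ... | inj₂ j≤i = period≤ j≤i p
      inj≤ : ∀ {i j} → i ℕ.≤ j → g ^ i ≈ g ^ j → Cong n j i
      inj≤ {i} {j} i≤j eq = ≡.subst (λ k → Cong n k i) (ℕₚ.m+[n∸m]≡n i≤j) (Cong-+∣ i (order (j ℕ.∸ i)
        (*-cancelˡ (^-nonZero g≉0 i) (begin
          g ^ i * g ^ (j ℕ.∸ i)   ≈⟨ sym (^-+ g i (j ℕ.∸ i)) ⟩
          g ^ (i ℕ.+ (j ℕ.∸ i))   ≈⟨ ^-≡ g (ℕₚ.m+[n∸m]≡n i≤j) ⟩
          g ^ j                   ≈⟨ sym eq ⟩
          g ^ i                   ≈⟨ sym (*-identityʳ _) ⟩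
          g ^ i * 1#              ∎))))
      inj : ∀ {i j} → g ^ i ≈ g ^ j → Cong n i j
      inj {i} {j} eq with ℕₚ.≤-total i j
      ... | inj₁ i≤j = Cong-sym (inj≤ i≤j eq)
      ... | inj₂ j≤i = inj≤ j≤i (sym eq)
      -- If `x` were not among g^0, ..., g^(n-1), it would form with them a set of n + 1 roots of
      -- X^n - 1.
      log : ∀ x → ¬ (x ≈ 0#) → ∃ λ i → i ℕ.< n × x ≈ g ^ i
      log x x≉0 with Finₚ.any? (λ (i : Fin n) → x ≟ (g ^ Fin.toℕ i))
      ... | yes (i , p) = Fin.toℕ i , Finₚ.toℕ<n i , p
      ... | no none = ⊥-elim (ℕₚ.<-irrefl ≡.refl (unityRoots≤ n (suc n) 0<n e e-inj e-root))
        where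
        e : Fin (suc n) → Carrier
        e Fin.zero    = x
        e (Fin.suc i) = g ^ Fin.toℕ i
        e-inj : ∀ i j → e i ≈ e j → i ≡ j
        e-inj Fin.zero    Fin.zero    p = ≡.refl
        e-inj Fin.zero    (Fin.suc j) p = ⊥-elim (none (j , p))
        e-inj (Fin.suc i) Fin.zero    p = ⊥-elim (none (i , sym p))
        e-inj (Fin.suc i) (Fin.suc j) p =
          ≡.cong Fin.suc (Finₚ.toℕ-injective (Cong-<⇒≡ (Finₚ.toℕ<n i) (Finₚ.toℕ<n j) (inj p)))
        e-root : ∀ i → e i ^ n ≈ 1#
        e-root Fin.zero    = lagrange x x≉0
        e-root (Fin.suc i) = lagrange (g ^ Fin.toℕ i) (^-nonZero g≉0 (Fin.toℕ i))

      root : PrimitiveRoot F n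
      root = record
        { g        = g
        ; g≉0      = g≉0
        ; ^-period = period
        ; ^-inj    = inj
        ; log      = log
        }

    primitiveRoot : PrimitiveRoot F n
    primitiveRoot = Generator.root (proj₁ generator) (proj₁ (proj₂ generator))
      λ {l} pr d n≡l*d → proj₁ (proj₂ (proj₂ generator))
        (∈-primeDivisors⁺ n 0<n pr (ℕ∣.divides d (≡.trans n≡l*d (ℕₚ.*-comm l d)))) d n≡l*d
      where
      generator = separate (primeDivisors n) (primeDivisors-prime n) (primeDivisors-unique n)
        (λ m → proj₂ (∈-primeDivisors⁻ n m))

-- Zech logarithms and quotients of points on the line.

module ZechLogarithms where
  open RingSolver using (solve-∀)
  open RationalSums
  open PositiveDefiniteKernels
  open JacobiSums
  open CyclicUnits

  module Zech {c ℓ} {n} (F : FiniteField c ℓ (suc n)) (0<n : 0 ℕ.< n) (root : PrimitiveRoot F n) where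
    open FiniteField F
    open Powers F
    open PrimitiveRoot root
    open SetoidReasoning setoid
    open GroupProperties +-group using () renaming (∙-cancelˡ to +-cancelˡ; ∙-cancelʳ to +-cancelʳ)

    zech? : ∀ i j → Dec (g ^ j ≈ 1# + g ^ i)
    zech? i j = (g ^ j) ≟ (1# + g ^ i)

    K : ℕ → ℕ → ℚ
    K i j = 𝟙 (zech? i j)

    add-n : ∀ i → g ^ (i ℕ.+ n) ≈ g ^ i
    add-n i = ^-period (Cong-+∣ i ℕ∣.∣-refl)

    K-periodic : Periodic n K
    K-periodic =
        (λ i j → 𝟙-cong (zech? (i ℕ.+ n) j) (zech? i j)
          (λ p → trans p (+-congˡ (add-n i))) (λ p → trans p (+-congˡ (sym (add-n i)))))
      , (λ i j → 𝟙-cong (zech? i (j ℕ.+ n)) (zech? i j)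
          (λ p → trans (sym (add-n j)) p) (λ p → trans (add-n j) p))

    ∑-hit : ∀ x → ∑ n (λ i → 𝟙 ((g ^ i) ≟ x)) ≡ 1ℚ ℚ.- 𝟙 (x ≟ 0#)
    ∑-hit x with x ≟ 0#
    ... | yes x≈0 = ≡.trans (∑-cong n λ i → 𝟙-no ((g ^ i) ≟ x) λ p → ^-nonZero g≉0 i (trans p x≈0)) (∑-zero n)
    ... | no x≉0 with log x x≉0
    ... | a , a<n , x≈ga = ≡.trans (∑-cong n λ i → 𝟙-cong ((g ^ i) ≟ x) (cong? n i a)
            (λ p → ^-inj (trans p x≈ga)) (λ p → trans (^-period p) (sym x≈ga))) (∑-δ n 0<n a)

    -- Every unit x has exactly one logarithm of 1 + x below `n`, except x = -1.
    ∑∑K : ∑∑ n K ≡ ι n ℚ.- 1ℚ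
    ∑∑K = ≡.trans (∑-cong n λ i → ≡.trans (∑-hit (1# + g ^ i)) (≡.cong (λ x → 1ℚ ℚ.- x)
            (𝟙-cong ((1# + g ^ i) ≟ 0#) ((g ^ i) ≟ (- 1#)) (to i) (from i))))
        (≡.trans (∑-sub n (λ _ → 1ℚ) (λ i → 𝟙 ((g ^ i) ≟ (- 1#))))
        (≡.cong₂ ℚ._-_ (≡.trans (∑-const n 1ℚ) (ℚₚ.*-identityʳ (ι n)))
        (≡.trans (∑-hit (- 1#)) (≡.cong (λ x → 1ℚ ℚ.- x) (𝟙-no ((- 1#) ≟ 0#) -1≉0)))))
      where
      to : ∀ i → 1# + g ^ i ≈ 0# → g ^ i ≈ - 1#
      to i p = +-cancelˡ 1# (g ^ i) (- 1#) (trans p (sym (-‿inverseʳ 1#)))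
      from : ∀ i → g ^ i ≈ - 1# → 1# + g ^ i ≈ 0#
      from i p = trans (+-congˡ p) (-‿inverseʳ 1#)
      -1≉0 : ¬ (- 1# ≈ 0#)
      -1≉0 p = 1≉0 (trans (sym (+-identityʳ 1#)) (trans (+-congˡ (sym p)) (-‿inverseʳ 1#)))

    -- A pair of points with quotient (σ, η) is a `y` with η (1 + y) = 1 + σ y, that is (σ - η) y =
    -- η - 1. There is one solution because σ ≠ η; it is a unit because η ≠ 1, and 1 + y is a unit
    -- because σ ≠ 1.
    module Generic {s t} (s≢0 : ¬ Cong n s 0) (t≢0 : ¬ Cong n t 0) (t≢s : ¬ Cong n t s) where
      σ η w y₀ : Carrier
      σ = g ^ s
      η = g ^ t
      w = σ + - η
      y₀ = (η + - 1#) * w ⁻¹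

      σ≈η+w : σ ≈ η + w
      σ≈η+w = begin
        σ                ≈⟨ sym (+-identityʳ σ) ⟩
        σ + 0#           ≈⟨ +-congˡ (sym (-‿inverseˡ η)) ⟩
        σ + (- η + η)    ≈⟨ sym (+-assoc _ _ _) ⟩
        w + η            ≈⟨ +-comm _ _ ⟩
        η + w            ∎

      w≉0 : NonZero w
      w≉0 p = t≢s (^-inj (sym (trans σ≈η+w (trans (+-congˡ p) (+-identityʳ η)))))

      1+wy₀≈η : 1# + w * y₀ ≈ η
      1+wy₀≈η = begin
        1# + w * ((η + - 1#) * w ⁻¹)   ≈⟨ +-congˡ (trans (*-comm _ _) (*-assoc _ _ _)) ⟩
        1# + (η + - 1#) * (w ⁻¹ * w)   ≈⟨ +-congˡ (trans (*-congˡ (trans (*-comm _ _) (inverseʳ w w≉0))) (*-identityʳ _)) ⟩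
        1# + (η + - 1#)                ≈⟨ +-comm _ _ ⟩
        η + - 1# + 1#                  ≈⟨ +-assoc _ _ _ ⟩
        η + (- 1# + 1#)                ≈⟨ +-congˡ (-‿inverseˡ 1#) ⟩
        η + 0#                         ≈⟨ +-identityʳ η ⟩
        η                              ∎

      σ-split : ∀ y → 1# + σ * y ≈ (1# + w * y) + η * y
      σ-split y = begin
        1# + σ * y               ≈⟨ +-congˡ (trans (*-congʳ (trans σ≈η+w (+-comm _ _))) (distribʳ y w η)) ⟩
        1# + (w * y + η * y)     ≈⟨ sym (+-assoc _ _ _) ⟩
        (1# + w * y) + η * y     ∎

      η-distrib : ∀ y → η * (1# + y) ≈ η + η * y
      η-distrib y = trans (distribˡ η 1# y) (+-congʳ (*-identityʳ η))

      solution : η * (1# + y₀) ≈ 1# + σ * y₀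
      solution = trans (η-distrib y₀) (trans (+-congʳ (sym 1+wy₀≈η)) (sym (σ-split y₀)))

      unique : ∀ {y} → η * (1# + y) ≈ 1# + σ * y → y ≈ y₀
      unique {y} p = *-cancelˡ w≉0 (+-cancelˡ 1# (w * y) (w * y₀) (begin
        1# + w * y    ≈⟨ +-cancelʳ (η * y) (1# + w * y) η (trans (sym (σ-split y)) (trans (sym p) (η-distrib y))) ⟩
        η             ≈⟨ sym 1+wy₀≈η ⟩
        1# + w * y₀   ∎))

      y₀≉0 : NonZero y₀
      y₀≉0 p = t≢0 (^-inj (begin
        η              ≈⟨ sym 1+wy₀≈η ⟩
        1# + w * y₀    ≈⟨ +-congˡ (trans (*-congˡ p) (zeroʳ w)) ⟩
        1# + 0#        ≈⟨ +-identityʳ 1# ⟩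
        1#             ∎))

      1+y₀≉0 : NonZero (1# + y₀)
      1+y₀≉0 p = s≢0 (^-inj (+-cancelʳ (σ * y₀) σ 1# (begin
        σ + σ * y₀        ≈⟨ +-congʳ (sym (*-identityʳ σ)) ⟩
        σ * 1# + σ * y₀   ≈⟨ sym (distribˡ σ 1# y₀) ⟩
        σ * (1# + y₀)     ≈⟨ trans (*-congˡ p) (zeroʳ σ) ⟩
        0#                ≈⟨ sym (trans (*-congˡ p) (zeroʳ η)) ⟩
        η * (1# + y₀)     ≈⟨ solution ⟩
        1# + σ * y₀       ∎)))

      correlation : ∑∑ n (λ i j → K i j ℚ.* K (i ℕ.+ s) (j ℕ.+ t)) ≡ 1ℚ
      correlation with log y₀ y₀≉0 | log (1# + y₀) 1+y₀≉0
      ... | a , a<n , y₀≈ | b , b<n , Y₀≈ = ≡.trans (∑∑-cong n term)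
        (≡.trans (∑-cong n λ i → ≡.trans (∑-*ˡ n (δ n i a) (λ j → δ n j b))
          (≡.trans (≡.cong (δ n i a ℚ.*_) (∑-δ n 0<n b)) (ℚₚ.*-identityʳ (δ n i a)))) (∑-δ n 0<n a))
        where
        shifted : ∀ i s → g ^ (i ℕ.+ s) ≈ g ^ s * g ^ i
        shifted i s = trans (^-+ g i s) (*-comm _ _)
        term : ∀ i j → K i j ℚ.* K (i ℕ.+ s) (j ℕ.+ t) ≡ δ n i a ℚ.* δ n j b
        term i j = ≡.trans (𝟙-× (zech? i j) (zech? (i ℕ.+ s) (j ℕ.+ t)))
          (≡.trans (𝟙-cong (zech? i j ×-dec zech? (i ℕ.+ s) (j ℕ.+ t)) (cong? n i a ×-dec cong? n j b) to from)
            (≡.sym (𝟙-× (cong? n i a) (cong? n j b))))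
          where
          to : g ^ j ≈ 1# + g ^ i × g ^ (j ℕ.+ t) ≈ 1# + g ^ (i ℕ.+ s) → Cong n i a × Cong n j b
          to (k , k′) = ^-inj (trans gi≈y₀ y₀≈) , ^-inj (trans k (trans (+-congˡ gi≈y₀) Y₀≈))
            where
            gi≈y₀ : g ^ i ≈ y₀
            gi≈y₀ = unique (begin
              η * (1# + g ^ i)       ≈⟨ *-congˡ (sym k) ⟩
              η * g ^ j              ≈⟨ sym (shifted j t) ⟩
              g ^ (j ℕ.+ t)          ≈⟨ k′ ⟩
              1# + g ^ (i ℕ.+ s)     ≈⟨ +-congˡ (shifted i s) ⟩
              1# + σ * g ^ i         ∎)
          from : Cong n i a × Cong n j b → g ^ j ≈ 1# + g ^ i × g ^ (j ℕ.+ t) ≈ 1# + g ^ (i ℕ.+ s)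
          from (p , q) = k , (begin
              g ^ (j ℕ.+ t)          ≈⟨ shifted j t ⟩
              η * g ^ j              ≈⟨ *-congˡ gj≈Y₀ ⟩
              η * (1# + y₀)          ≈⟨ solution ⟩
              1# + σ * y₀            ≈⟨ +-congˡ (*-congˡ (sym gi≈y₀)) ⟩
              1# + σ * g ^ i         ≈⟨ +-congˡ (sym (shifted i s)) ⟩
              1# + g ^ (i ℕ.+ s)     ∎)
            where
            gi≈y₀ : g ^ i ≈ y₀
            gi≈y₀ = trans (^-period p) (sym y₀≈)
            gj≈Y₀ : g ^ j ≈ 1# + y₀
            gj≈Y₀ = trans (^-period q) (sym Y₀≈)
            k : g ^ j ≈ 1# + g ^ i
            k = trans gj≈Y₀ (+-congˡ (sym gi≈y₀))

    zero-correlation : ∀ {s t} → (∀ i j → g ^ j ≈ 1# + g ^ i → g ^ (j ℕ.+ t) ≈ 1# + g ^ (i ℕ.+ s) → ⊥) →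
      ∑∑ n (λ i j → K i j ℚ.* K (i ℕ.+ s) (j ℕ.+ t)) ≡ 0ℚ
    zero-correlation {s} {t} disjoint = ≡.trans (∑∑-cong n λ i j → ≡.trans (𝟙-× (zech? i j) (zech? (i ℕ.+ s) (j ℕ.+ t)))
        (𝟙-no (zech? i j ×-dec zech? (i ℕ.+ s) (j ℕ.+ t)) λ (k , k′) → disjoint i j k k′))
      (≡.trans (∑-cong n λ _ → ∑-zero n) (∑-zero n))

    -- Of the coincidences σ = 1, η = 1, σ = η for σ = g^s, η = g^t, any two imply the third. With
    -- none of them, one pair of points has quotient (σ, η); with exactly one, the linear equation
    -- has no admissible solution; with all three, the two points coincide and the n - 1 points of
    -- the line are counted. The right-hand side interpolates 1, 0 and n - 1.
    K-correlation : ∀ s t → ∑∑ n (λ i j → K i j ℚ.* K (i ℕ.+ s) (j ℕ.+ t)) ≡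
      (ι n ℚ.+ 1ℚ) ℚ.* (δ n s 0 ℚ.* δ n t 0) ℚ.+ 1ℚ ℚ.- δ n t s ℚ.- δ n s 0 ℚ.- δ n t 0
    K-correlation s t with cong? n s 0 | cong? n t 0 | cong? n t s
    ... | yes p | yes q | no ¬r = ⊥-elim (¬r (Cong-trans q (Cong-sym p)))
    ... | yes p | no ¬q | yes r = ⊥-elim (¬q (Cong-trans r p))
    ... | no ¬p | yes q | yes r = ⊥-elim (¬p (Cong-trans (Cong-sym r) q))
    ... | yes p | yes q | yes r = ≡.trans (∑∑-cong n term) (≡.trans ∑∑K (lem (ι n)))
      where
      idem : ∀ {a} {A : Set a} (d : Dec A) → 𝟙 d ℚ.* 𝟙 d ≡ 𝟙 d
      idem (yes _) = ≡.refl
      idem (no _)  = ≡.refl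
      term : ∀ i j → K i j ℚ.* K (i ℕ.+ s) (j ℕ.+ t) ≡ K i j
      term i j = ≡.trans (≡.cong (K i j ℚ.*_) (𝟙-cong (zech? (i ℕ.+ s) (j ℕ.+ t)) (zech? i j)
          (λ k → trans (sym (same j q)) (trans k (+-congˡ (same i p))))
          (λ k → trans (same j q) (trans k (+-congˡ (sym (same i p)))))))
        (idem (zech? i j))
        where
        same : ∀ i {s} → Cong n s 0 → g ^ (i ℕ.+ s) ≈ g ^ i
        same i p = ^-period (≡.subst (Cong n _) (ℕₚ.+-identityʳ i) (Cong-+ˡ i p))
      lem : ∀ n → n ℚ.- 1ℚ ≡ (n ℚ.+ 1ℚ) ℚ.* (1ℚ ℚ.* 1ℚ) ℚ.+ 1ℚ ℚ.- 1ℚ ℚ.- 1ℚ ℚ.- 1ℚ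
      lem = solve-∀ ℚ-ring
    ... | yes p | no ¬q | no _  = ≡.trans (zero-correlation λ i j k k′ → ¬q
            (Cong-cancelˡ j (^-inj (begin
              g ^ (j ℕ.+ t)          ≈⟨ k′ ⟩
              1# + g ^ (i ℕ.+ s)     ≈⟨ +-congˡ (^-period (Cong-+ˡ i p)) ⟩
              1# + g ^ (i ℕ.+ 0)     ≈⟨ +-congˡ (^-≡ g (ℕₚ.+-identityʳ i)) ⟩
              1# + g ^ i             ≈⟨ sym k ⟩
              g ^ j                  ≈⟨ ^-≡ g (≡.sym (ℕₚ.+-identityʳ j)) ⟩
              g ^ (j ℕ.+ 0)          ∎)))) (lem (ι n))
      where
      lem : ∀ n → 0ℚ ≡ (n ℚ.+ 1ℚ) ℚ.* (1ℚ ℚ.* 0ℚ) ℚ.+ 1ℚ ℚ.- 0ℚ ℚ.- 1ℚ ℚ.- 0ℚ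
      lem = solve-∀ ℚ-ring
    ... | no ¬p | yes q | no _  = ≡.trans (zero-correlation λ i j k k′ → ¬p (Cong-cancelˡ i (^-inj
            (+-cancelˡ 1# (g ^ (i ℕ.+ s)) (g ^ (i ℕ.+ 0)) (begin
              1# + g ^ (i ℕ.+ s)     ≈⟨ sym k′ ⟩
              g ^ (j ℕ.+ t)          ≈⟨ ^-period (Cong-+ˡ j q) ⟩
              g ^ (j ℕ.+ 0)          ≈⟨ ^-≡ g (ℕₚ.+-identityʳ j) ⟩
              g ^ j                  ≈⟨ k ⟩
              1# + g ^ i             ≈⟨ +-congˡ (^-≡ g (≡.sym (ℕₚ.+-identityʳ i))) ⟩
              1# + g ^ (i ℕ.+ 0)     ∎))))) (lem (ι n))
      where
      lem : ∀ n → 0ℚ ≡ (n ℚ.+ 1ℚ) ℚ.* (0ℚ ℚ.* 1ℚ) ℚ.+ 1ℚ ℚ.- 0ℚ ℚ.- 0ℚ ℚ.- 1ℚ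
      lem = solve-∀ ℚ-ring
    ... | no ¬p | no ¬q | yes r = ≡.trans (zero-correlation λ i j k k′ → ¬q (^-inj
            (+-cancelʳ (g ^ t * g ^ i) (g ^ t) 1# (begin
              g ^ t + g ^ t * g ^ i         ≈⟨ +-congʳ (sym (*-identityʳ _)) ⟩
              g ^ t * 1# + g ^ t * g ^ i    ≈⟨ sym (distribˡ _ _ _) ⟩
              g ^ t * (1# + g ^ i)          ≈⟨ *-congˡ (sym k) ⟩
              g ^ t * g ^ j                 ≈⟨ trans (*-comm _ _) (sym (^-+ g j t)) ⟩
              g ^ (j ℕ.+ t)                 ≈⟨ k′ ⟩
              1# + g ^ (i ℕ.+ s)            ≈⟨ +-congˡ (trans (^-period (Cong-+ˡ i (Cong-sym r))) (trans (^-+ g i t) (*-comm _ _))) ⟩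
              1# + g ^ t * g ^ i            ∎)))) (lem (ι n))
      where
      lem : ∀ n → 0ℚ ≡ (n ℚ.+ 1ℚ) ℚ.* (0ℚ ℚ.* 0ℚ) ℚ.+ 1ℚ ℚ.- 1ℚ ℚ.- 0ℚ ℚ.- 0ℚ
      lem = solve-∀ ℚ-ring
    ... | no ¬p | no ¬q | no ¬r = ≡.trans (Generic.correlation ¬p ¬q ¬r) (lem (ι n))
      where
      lem : ∀ n → 1ℚ ≡ (n ℚ.+ 1ℚ) ℚ.* (0ℚ ℚ.* 0ℚ) ℚ.+ 1ℚ ℚ.- 0ℚ ℚ.- 0ℚ ℚ.- 0ℚ
      lem = solve-∀ ℚ-ring

    K-line : LineCorrelation n K
    K-line = record { K-periodic = K-periodic ; ∑∑K = ∑∑K ; K-correlation = K-correlation }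

-- Radicals, totients, and the local factors of `θ` and `τ`.

module Multiplicativity where
  open ≡ using (refl; sym; trans; cong; cong₂; subst; module ≡-Reasoning)
  open import Data.Rational using (_+_; _*_; _-_; -_; _≤_; _<_)
  open RingSolver using (solve-∀)
  open Coprimality using (Coprime; coprime?)
  open RationalSums
  open PositiveDefiniteKernels
  open JacobiSums
  open FourierExpansion
  open ResidueAverages
  open CyclicUnits hiding (module Powers; module Cyclic)

  square∤product : ∀ {p L} → Prime p → All Prime L → Unique L → ¬ (p ℕ.* p ℕ∣.∣ product L)
  square∤product {p} pr [] _ p²∣1 = ℕₚ.<⇒≱ (prime⇒2≤ pr) (ℕ∣.∣⇒≤ (ℕ∣.∣-trans (ℕ∣.m∣m*n p) p²∣1))
  square∤product {p} {l ∷ L} pr (prl ∷ prs) uniq@(_ ∷ uniq′) p²∣ with p ℕ.≟ l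
  ... | yes refl = ∉-head uniq (factorisationHasAllPrimeFactors pr (ℕ∣.*-cancelˡ-∣ p {{prime⇒nonZero pr}} p²∣) prs)
  ... | no p≢l = square∤product pr prs uniq′ (Coprimality.coprime-divisor (λ (d∣ , d∣l) → coprime-square d∣ d∣l) p²∣)
    where
    p∤l : ¬ (p ℕ∣.∣ l)
    p∤l p∣l = p≢l (prime∣prime⇒≡ pr prl p∣l)
    coprime-square : ∀ {d} → d ℕ∣.∣ p ℕ.* p → d ℕ∣.∣ l → d ≡ 1
    coprime-square d∣p² d∣l = prime∤⇒coprime pr p∤l (d∣p , d∣l)
      where
      d∣p = Coprimality.coprime-divisor (λ (e∣d , e∣p) → prime∤⇒coprime pr p∤l (e∣p , ℕ∣.∣-trans e∣d d∣l)) d∣p²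

  module Radical {n k ps} (0<n : 0 ℕ.< n) (ps-prime : All Prime ps) (ps-unique : Unique ps)
    (k*ps≡Rad : k ℕ.* product ps ≡ Rad n) where

    ps∣n : ∀ {p} → p ∈ ps → p ℕ∣.∣ n
    ps∣n p∈ps = proj₂ (∈-primeDivisors⁻ n (factorisationHasAllPrimeFactors (All.lookup ps-prime p∈ps)
      (subst (_ ℕ∣.∣_) k*ps≡Rad (ℕ∣.∣n⇒∣m*n k (∈⇒∣product p∈ps))) (primeDivisors-prime n)))

    k∣n : ∀ {l} → l ∈ primeDivisors k → l ℕ∣.∣ n
    k∣n l∈k = proj₂ (∈-primeDivisors⁻ n (factorisationHasAllPrimeFactors (proj₁ (∈-primeDivisors⁻ k l∈k))
      (subst (_ ℕ∣.∣_) k*ps≡Rad (ℕ∣.∣m⇒∣m*n (product ps) (proj₂ (∈-primeDivisors⁻ k l∈k)))) (primeDivisors-prime n)))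

    0<k : 0 ℕ.< k
    0<k = ℕₚ.n≢0⇒n>0 λ { refl → ℕ.≢-nonZero⁻¹ (Rad n) {{productOfPrimes≢0 (primeDivisors-prime n)}} (sym k*ps≡Rad) }

    -- A common prime would have its square dividing `Rad n`, but a product of distinct primes is
    -- squarefree.
    ps∉k : ∀ {p} → p ∈ ps → p ∉ primeDivisors k
    ps∉k {p} p∈ps p∈k = square∤product (All.lookup ps-prime p∈ps) (primeDivisors-prime n) (primeDivisors-unique n)
      (subst (p ℕ.* p ℕ∣.∣_) k*ps≡Rad (ℕ∣.*-pres-∣ (proj₂ (∈-primeDivisors⁻ k p∈k)) (∈⇒∣product p∈ps)))

    split : ∀ {l} → Prime l → l ℕ∣.∣ n → l ∈ primeDivisors k ⊎ l ∈ ps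
    split {l} pr l∣n with euclidsLemma k (product ps) pr (subst (l ℕ∣.∣_) (sym k*ps≡Rad) (∈⇒∣product (∈-primeDivisors⁺ n 0<n pr l∣n)))
    ... | inj₁ l∣k = inj₁ (∈-primeDivisors⁺ k 0<k pr l∣k)
    ... | inj₂ l∣ps = inj₂ (factorisationHasAllPrimeFactors pr l∣ps ps-prime)

  sumL : ∀ {a} {A : Set a} → List A → (A → ℚ) → ℚ
  sumL xs f = List.foldr (λ x acc → f x + acc) 0ℚ xs

  length-filter : ∀ {a p} {A : Set a} {P : Pred A p} (P? : Decidable P) xs →
    ι (length (filter P? xs)) ≡ sumL xs (λ x → 𝟙 (P? x))
  length-filter P? []       = refl
  length-filter P? (x ∷ xs) with P? x
  ... | yes _ = trans (ℚₚ.+-comm (ι (length (filter P? xs))) 1ℚ) (cong (1ℚ +_) (length-filter P? xs))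
  ... | no _  = trans (length-filter P? xs) (sym (ℚₚ.+-identityˡ (sumL xs (λ x → 𝟙 (P? x)))))

  sumL-applyUpTo : ∀ {a} {A : Set a} (h : ℕ → A) n (f : A → ℚ) → sumL (applyUpTo h n) f ≡ ∑ n (λ i → f (h i))
  sumL-applyUpTo h zero    f = refl
  sumL-applyUpTo h (suc n) f = trans (cong (λ z → f (h 0) + z) (sumL-applyUpTo (λ i → h (suc i)) n f))
    (∑-suc n (λ i → f (h i)))

  allAvoid? : ∀ L m → Dec (All (λ l → ¬ Cong l m 0) L)
  allAvoid? L m = All.all? (λ l → ¬? (cong? l m 0)) L

  𝟙-¬ : ∀ {a} {A : Set a} (d : Dec A) → 1ℚ - 𝟙 d ≡ 𝟙 (¬? d)
  𝟙-¬ (yes _) = refl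
  𝟙-¬ (no _)  = refl

  prodL-𝟙 : ∀ {p} {P : Pred ℕ p} (P? : Decidable P) L → prodL L (λ l → 𝟙 (P? l)) ≡ 𝟙 (All.all? P? L)
  prodL-𝟙 P? []      = refl
  prodL-𝟙 P? (l ∷ L) = trans (cong (𝟙 (P? l) *_) (prodL-𝟙 P? L)) (trans (𝟙-× (P? l) (All.all? P? L))
    (𝟙-cong (P? l ×-dec All.all? P? L) (All.all? P? (l ∷ L)) (λ (p , ps) → p ∷ ps) (λ { (p ∷ ps) → p , ps })))

  avoid⇒coprime : ∀ {n m} → 0 ℕ.< n → (∀ {l} → Prime l → l ℕ∣.∣ n → ¬ (l ℕ∣.∣ m)) → Coprime m n
  avoid⇒coprime {n} {m} 0<n avoids {zero} (_ , 0∣n) = ⊥-elim (ℕₚ.<-irrefl (sym (ℕ∣.0∣⇒≡0 0∣n)) 0<n)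
  avoid⇒coprime {n} {m} 0<n avoids {1} _ = refl
  avoid⇒coprime {n} {m} 0<n avoids {suc (suc d)} (d∣m , d∣n) with primeFactor (suc (suc d)) (ℕ.s≤s (ℕ.s≤s ℕ.z≤n))
  ... | l , pr , l∣d = ⊥-elim (avoids pr (ℕ∣.∣-trans l∣d d∣n) (ℕ∣.∣-trans l∣d d∣m))

  coprime⇒avoid : ∀ {n m l} → Coprime m n → Prime l → l ℕ∣.∣ n → ¬ (l ℕ∣.∣ m)
  coprime⇒avoid cop pr l∣n l∣m with cop (l∣m , l∣n)
  ... | refl = ℕₚ.<-irrefl refl (prime⇒2≤ pr)

  𝟙-coprime : ∀ n → 0 ℕ.< n → ∀ m → 𝟙 (coprime? m n) ≡ prodL (primeDivisors n) (λ l → 1ℚ - δ l m 0)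
  𝟙-coprime n 0<n m = sym (trans (prodL-cong (primeDivisors n) λ {l} _ → 𝟙-¬ (cong? l m 0))
    (trans (prodL-𝟙 (λ l → ¬? (cong? l m 0)) (primeDivisors n))
    (𝟙-cong (allAvoid? (primeDivisors n) m) (coprime? m n)
      (λ avoids → avoid⇒coprime 0<n λ pr l∣n l∣m → All.lookup avoids (∈-primeDivisors⁺ n 0<n pr l∣n) (∣⇒Cong0 l∣m))
      (λ cop → All.tabulate λ l∈ l≡0 →
        coprime⇒avoid cop (proj₁ (∈-primeDivisors⁻ n l∈)) (proj₂ (∈-primeDivisors⁻ n l∈)) (Cong0⇒∣ l≡0)))))

  -- `φ` counts in 1, ..., n, while the sums run over 0, ..., n - 1; coprimality to `n` has period
  -- `n`, so the window may be shifted by one.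
  φ-sum : ∀ n → 0 ℕ.< n → ι (φ n) ≡ ∑ n (λ m → 𝟙 (coprime? m n))
  φ-sum n 0<n = begin
    ι (φ n)
      ≡⟨ length-filter (λ i → coprime? i n) (applyUpTo suc n) ⟩
    sumL (applyUpTo suc n) (λ i → 𝟙 (coprime? i n))
      ≡⟨ sumL-applyUpTo suc n (λ i → 𝟙 (coprime? i n)) ⟩
    ∑ n (λ i → 𝟙 (coprime? (suc i) n))
      ≡⟨ ∑-cong n (λ i → cong (λ m → 𝟙 (coprime? m n)) (ℕₚ.+-comm 1 i)) ⟩
    ∑ n (λ i → 𝟙 (coprime? (i ℕ.+ 1) n))
      ≡⟨ ∑-shift n (λ i → 𝟙 (coprime? i n)) periodic 1 ⟩
    ∑ n (λ i → 𝟙 (coprime? i n)) ∎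
    where
    open ≡-Reasoning
    periodic : ∀ i → 𝟙 (coprime? (i ℕ.+ n) n) ≡ 𝟙 (coprime? i n)
    periodic i = trans (𝟙-coprime n 0<n (i ℕ.+ n)) (trans (prodL-cong (primeDivisors n) λ {l} l∈ →
      cong (λ d → 1ℚ - d) (δ-cong l (Cong-+∣ i (proj₂ (∈-primeDivisors⁻ n l∈))) (Cong-refl 0))) (sym (𝟙-coprime n 0<n i)))

  *-cancelˡ-≡ : ∀ {z x y} → 0ℚ < z → z * x ≡ z * y → x ≡ y
  *-cancelˡ-≡ 0<z p = ℚₚ.≤-antisym (*-cancelˡ-≤ 0<z (ℚₚ.≤-reflexive p)) (*-cancelˡ-≤ 0<z (ℚₚ.≤-reflexive (sym p)))

  -- The two-dimensional product formula with an idle first coordinate, whose factor `n` cancels.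
  φ-product : ∀ n → 0 ℕ.< n → ι (φ n) ≡ ι n * prodL (primeDivisors n) ϑ
  φ-product n 0<n = *-cancelˡ-≡ (0<ι n 0<n) (begin
    ι n * ι (φ n)
      ≡⟨ cong (ι n *_) (trans (φ-sum n 0<n) (∑-cong n (𝟙-coprime n 0<n))) ⟩
    ι n * ∑ n (λ m → prodL L (λ l → 1ℚ - δ l m 0))
      ≡⟨ sym (∑-const n (∑ n (λ m → prodL L (λ l → 1ℚ - δ l m 0)))) ⟩
    ∑∑ n (λ _ m → prodL L (λ l → 1ℚ - δ l m 0))
      ≡⟨ ∑∑-prodL n L (primeDivisors-prime n) (primeDivisors-unique n) (λ l∈ → proj₂ (∈-primeDivisors⁻ n l∈))
           (λ l _ m → 1ℚ - δ l m 0) ϑ (λ l _ q → cong (λ d → 1ℚ - d) (δ-cong l q (Cong-refl 0))) local ⟩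
    ι n * (ι n * prodL L ϑ) ∎)
    where
    open ≡-Reasoning
    L = primeDivisors n
    local : ∀ {l} → l ∈ L → ∑∑ l (λ _ m → 1ℚ - δ l m 0) ≡ ι l * (ι l * ϑ l)
    local {l} l∈ = trans (∑-const l (∑ l (λ m → 1ℚ - δ l m 0))) (cong (ι l *_) (begin
      ∑ l (λ m → 1ℚ - δ l m 0)    ≡⟨ trans (∑-sub l (λ _ → 1ℚ) (λ m → δ l m 0)) (cong₂ _-_ (∑-const l 1ℚ) (∑-δ l 0<l 0)) ⟩
      ι l * 1ℚ - 1ℚ               ≡⟨ cong (λ x → ι l * 1ℚ - x) (sym (inv-*-ι l 0<l)) ⟩
      ι l * 1ℚ - inv l * ι l      ≡⟨ lem (ι l) (inv l) ⟩
      ι l * (1ℚ - inv l)          ∎))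
      where
      0<l : 0 ℕ.< l
      0<l = ℕₚ.<⇒≤ (prime⇒2≤ (proj₁ (∈-primeDivisors⁻ n l∈)))
      lem : ∀ l v → l * 1ℚ - v * l ≡ l * (1ℚ - v)
      lem = solve-∀ ℚ-ring

  θ-φ : ∀ n → 0 ℕ.< n → θ n * ι n ≡ ι (φ n)
  θ-φ (suc n) 0<n = trans (cong (_* ι (suc n)) (/-as-* (φ (suc n)) n))
    (trans (ℚₚ.*-assoc (ι (φ (suc n))) (inv (suc n)) (ι (suc n)))
    (trans (cong (ι (φ (suc n)) *_) (inv-*-ι (suc n) 0<n)) (ℚₚ.*-identityʳ (ι (φ (suc n))))))

  θ-product : ∀ n → 0 ℕ.< n → θ n ≡ prodL (primeDivisors n) ϑ
  θ-product n 0<n = *-cancelˡ-≡ (0<ι n 0<n) (trans (ℚₚ.*-comm (ι n) (θ n)) (trans (θ-φ n 0<n) (φ-product n 0<n)))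

  -- Each of the three axes contributes a factor 2 ϑ(l) at every prime; this is the origin of θ³ W³
  -- in the error term.
  spread-bound-triples : ∀ L → spread-bound (triples L) ≡
    (prodL L ϑ * prodL L ϑ * prodL L ϑ) * (ι (2 ℕ.^ length L) * ι (2 ℕ.^ length L) * ι (2 ℕ.^ length L))
  spread-bound-triples []      = refl
  spread-bound-triples (l ∷ L) = trans
    (cong (λ x → (ϑ l + ϑ l) * ((ϑ l + ϑ l) * ((ϑ l + ϑ l) * x))) (spread-bound-triples L))
    (trans (lem (ϑ l) (prodL L ϑ) (ι (2 ℕ.^ length L)))
      (cong (λ x → (t * t * t) * (x * x * x)) (sym (ι-* 2 (2 ℕ.^ length L)))))
    where
    t = ϑ l * prodL L ϑ
    lem : ∀ t p w → (t + t) * ((t + t) * ((t + t) * ((p * p * p) * (w * w * w)))) ≡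
      ((t * p) * (t * p) * (t * p)) * ((ι 2 * w) * (ι 2 * w) * (ι 2 * w))
    lem = solve-∀ ℚ-ring

  inv-* : ∀ a b → 0 ℕ.< a → 0 ℕ.< b → inv (a ℕ.* b) ≡ inv a * inv b
  inv-* a b 0<a 0<b = *-cancelˡ-≡ (0<ι (a ℕ.* b) 0<ab) (begin
    ι (a ℕ.* b) * inv (a ℕ.* b)         ≡⟨ ℚₚ.*-comm (ι (a ℕ.* b)) (inv (a ℕ.* b)) ⟩
    inv (a ℕ.* b) * ι (a ℕ.* b)         ≡⟨ inv-*-ι (a ℕ.* b) 0<ab ⟩
    1ℚ * 1ℚ                             ≡⟨ sym (cong₂ _*_ (inv-*-ι a 0<a) (inv-*-ι b 0<b)) ⟩
    (inv a * ι a) * (inv b * ι b)       ≡⟨ lem (inv a) (ι a) (inv b) (ι b) ⟩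
    (ι a * ι b) * (inv a * inv b)       ≡⟨ cong (_* (inv a * inv b)) (sym (ι-* a b)) ⟩
    ι (a ℕ.* b) * (inv a * inv b)       ∎)
    where
    open ≡-Reasoning
    0<ab : 0 ℕ.< a ℕ.* b
    0<ab = ℕₚ.*-mono-≤ 0<a 0<b
    lem : ∀ u a v b → (u * a) * (v * b) ≡ (a * b) * (u * v)
    lem = solve-∀ ℚ-ring

  ϑ-inv-pred : ∀ l → 2 ℕ.≤ l → ϑ l * inv (l ℕ.∸ 1) ≡ inv l
  ϑ-inv-pred l 2≤l = begin
    (1ℚ - v) * u                                    ≡⟨ lem (ι l) v u ⟩
    v * (u * (ι l - 1ℚ)) + u * (1ℚ - v * ι l)       ≡⟨ cong₂ (λ x y → v * x + u * (1ℚ - y)) (inv-pred l 2≤l) (inv-*-ι l (ℕₚ.<⇒≤ 2≤l)) ⟩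
    v * 1ℚ + u * (1ℚ - 1ℚ)                          ≡⟨ lem′ v u ⟩
    v                                               ∎
    where
    open ≡-Reasoning
    v = inv l
    u = inv (l ℕ.∸ 1)
    lem : ∀ n v u → (1ℚ - v) * u ≡ v * (u * (n - 1ℚ)) + u * (1ℚ - v * n)
    lem = solve-∀ ℚ-ring
    lem′ : ∀ v u → v * 1ℚ + u * (1ℚ - 1ℚ) ≡ v
    lem′ = solve-∀ ℚ-ring

  -- ϑ(l) / (l - 1) = 1 / l, so the right side is ϑ² - ϑ / l + 1 / l². As ϑ² is the density of the
  -- first two conditions, `τ-factor l` is the conditional density of the third.
  generic-density-factor : ∀ l → 2 ℕ.≤ l → generic-density l ≡ ϑ l * ϑ l * τ-factor l
  generic-density-factor l 2≤l = sym (begin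
    ϑ l * ϑ l * ((1ℚ - u) + inv ((l ℕ.∸ 1) ℕ.* (l ℕ.∸ 1)))
      ≡⟨ cong (λ x → ϑ l * ϑ l * ((1ℚ - u) + x)) (inv-* (l ℕ.∸ 1) (l ℕ.∸ 1) 0<l-1 0<l-1) ⟩
    ϑ l * ϑ l * ((1ℚ - u) + u * u)
      ≡⟨ lem (ϑ l) u ⟩
    ϑ l * ϑ l - ϑ l * (ϑ l * u) + (ϑ l * u) * (ϑ l * u)
      ≡⟨ cong (λ x → ϑ l * ϑ l - ϑ l * x + x * x) (ϑ-inv-pred l 2≤l) ⟩
    (1ℚ - inv l) * (1ℚ - inv l) - (1ℚ - inv l) * inv l + inv l * inv l
      ≡⟨ lem′ (inv l) ⟩
    generic-density l ∎)
    where
    open ≡-Reasoning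
    u = inv (l ℕ.∸ 1)
    0<l-1 : 0 ℕ.< l ℕ.∸ 1
    0<l-1 = ℕₚ.∸-monoˡ-≤ 1 2≤l
    lem : ∀ t u → t * t * ((1ℚ - u) + u * u) ≡ t * t - t * (t * u) + (t * u) * (t * u)
    lem = solve-∀ ℚ-ring
    lem′ : ∀ v → (1ℚ - v) * (1ℚ - v) - (1ℚ - v) * v + v * v ≡ 1ℚ - ι 3 * v + ι 3 * (v * v)
    lem′ = solve-∀ ℚ-ring

  prodL-* : ∀ L f g → prodL L (λ l → f l * g l) ≡ prodL L f * prodL L g
  prodL-* []      f g = refl
  prodL-* (l ∷ L) f g = trans (cong ((f l * g l) *_) (prodL-* L f g)) (lem (f l) (g l) (prodL L f) (prodL L g))
    where
    lem : ∀ a b c d → (a * b) * (c * d) ≡ (a * c) * (b * d)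
    lem = solve-∀ ℚ-ring

  generic-density-product : ∀ k → 0 ℕ.< k →
    prodL (primeDivisors k) generic-density ≡ θ k * θ k * τ k
  generic-density-product k 0<k = begin
    prodL L generic-density
      ≡⟨ prodL-cong L (λ {l} l∈ → generic-density-factor l (prime⇒2≤ (proj₁ (∈-primeDivisors⁻ k l∈)))) ⟩
    prodL L (λ l → ϑ l * ϑ l * τ-factor l)
      ≡⟨ trans (prodL-* L (λ l → ϑ l * ϑ l) τ-factor) (cong (_* τ k) (prodL-* L ϑ ϑ)) ⟩
    prodL L ϑ * prodL L ϑ * τ k
      ≡⟨ cong (λ x → x * x * τ k) (sym (θ-product k 0<k)) ⟩
    θ k * θ k * τ k ∎
    where
    open ≡-Reasoning
    L = primeDivisors k

-- The sieve over the primes in `ps`, averaged over primitive b.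

module Sieving where
  open ≡ using (refl; sym; trans; cong; cong₂; subst; subst₂; module ≡-Reasoning)
  open import Data.Rational using (_+_; _*_; _-_; -_; _≤_; _<_)
  open RingSolver using (solve-∀)
  open Coprimality using (Coprime; coprime?)
  open RationalSums
  open PositiveDefiniteKernels
  open JacobiSums
  open FourierExpansion
  open ResidueAverages
  open CyclicUnits hiding (module Powers; module Cyclic)
  open Multiplicativity

  sumL-cong : ∀ {A : Set} xs {f g : A → ℚ} → (∀ {x} → x ∈ xs → f x ≡ g x) → sumL xs f ≡ sumL xs g
  sumL-cong []       eq = refl
  sumL-cong (x ∷ xs) eq = cong₂ _+_ (eq (here refl)) (sumL-cong xs λ m → eq (there m))

  sumL-*ˡ : ∀ {A : Set} xs c (f : A → ℚ) → sumL xs (λ x → c * f x) ≡ c * sumL xs f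
  sumL-*ˡ []       c f = sym (ℚₚ.*-zeroʳ c)
  sumL-*ˡ (x ∷ xs) c f = trans (cong (λ z → c * f x + z) (sumL-*ˡ xs c f)) (sym (ℚₚ.*-distribˡ-+ c (f x) (sumL xs f)))

  sumL-+ : ∀ {A : Set} xs (f g : A → ℚ) → sumL xs (λ x → f x + g x) ≡ sumL xs f + sumL xs g
  sumL-+ []       f g = refl
  sumL-+ (x ∷ xs) f g = trans (cong (λ z → f x + g x + z) (sumL-+ xs f g)) (lem (f x) (g x) (sumL xs f) (sumL xs g))
    where
    lem : ∀ a b c d → (a + b) + (c + d) ≡ (a + c) + (b + d)
    lem = solve-∀ ℚ-ring

  sumL-mono : ∀ {A : Set} xs {f g : A → ℚ} → (∀ {x} → x ∈ xs → f x ≤ g x) → sumL xs f ≤ sumL xs g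
  sumL-mono []       p = ℚₚ.≤-refl
  sumL-mono (x ∷ xs) p = ℚₚ.+-mono-≤ (p (here refl)) (sumL-mono xs λ m → p (there m))

  sumL-nonneg : ∀ {A : Set} xs {f : A → ℚ} → (∀ x → 0ℚ ≤ f x) → 0ℚ ≤ sumL xs f
  sumL-nonneg []       p = ℚₚ.≤-refl
  sumL-nonneg (x ∷ xs) p = +-nonneg (p x) (sumL-nonneg xs p)

  sumL-≥ : ∀ {A : Set} xs {f : A → ℚ} → (∀ x → 0ℚ ≤ f x) → ∀ {x} → x ∈ xs → f x ≤ sumL xs f
  sumL-≥ (x ∷ xs) {f} p (here refl) = subst (_≤ f x + sumL xs f) (ℚₚ.+-identityʳ (f x)) (ℚₚ.+-monoʳ-≤ (f x) (sumL-nonneg xs p))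
  sumL-≥ (y ∷ xs) {f} p {x} (there m) = subst (_≤ f y + sumL xs f) (ℚₚ.+-identityˡ (f x)) (ℚₚ.+-mono-≤ (p y) (sumL-≥ xs p m))

  ∑-sumL : ∀ {A : Set} n (xs : List A) (f : ℕ → A → ℚ) → ∑ n (λ i → sumL xs (f i)) ≡ sumL xs (λ x → ∑ n (λ i → f i x))
  ∑-sumL n []       f = ∑-zero n
  ∑-sumL n (x ∷ xs) f = trans (∑-+ n (λ i → f i x) (λ i → sumL xs (f i))) (cong (λ z → ∑ n (λ i → f i x) + z) (∑-sumL n xs f))

  ∑∑-sumL : ∀ {A : Set} n (xs : List A) (f : ℕ → ℕ → A → ℚ) →
    ∑∑ n (λ i j → sumL xs (f i j)) ≡ sumL xs (λ x → ∑∑ n (λ i j → f i j x))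
  ∑∑-sumL n xs f = trans (∑-cong n λ i → ∑-sumL n xs (f i)) (∑-sumL n xs (λ i x → ∑ n (λ j → f i j x)))

  ∑ₐ : (Axis → ℚ) → ℚ
  ∑ₐ f = f fst + f snd + f quo

  ∑ₐ-cong : ∀ {f g} → (∀ c → f c ≡ g c) → ∑ₐ f ≡ ∑ₐ g
  ∑ₐ-cong eq = cong₂ _+_ (cong₂ _+_ (eq fst) (eq snd)) (eq quo)

  ∑ₐ-*ˡ : ∀ k f → ∑ₐ (λ c → k * f c) ≡ k * ∑ₐ f
  ∑ₐ-*ˡ k f = lem k (f fst) (f snd) (f quo)
    where
    lem : ∀ k a b c → k * a + k * b + k * c ≡ k * (a + b + c)
    lem = solve-∀ ℚ-ring

  ∑-∑ₐ : ∀ n (f : ℕ → Axis → ℚ) → ∑ n (λ i → ∑ₐ (f i)) ≡ ∑ₐ (λ c → ∑ n (λ i → f i c))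
  ∑-∑ₐ n f = trans (∑-+ n (λ i → f i fst + f i snd) (λ i → f i quo))
    (cong (λ z → z + ∑ n (λ i → f i quo)) (∑-+ n (λ i → f i fst) (λ i → f i snd)))

  ∑∑-∑ₐ : ∀ n (f : ℕ → ℕ → Axis → ℚ) → ∑∑ n (λ i j → ∑ₐ (f i j)) ≡ ∑ₐ (λ c → ∑∑ n (λ i j → f i j c))
  ∑∑-∑ₐ n f = trans (∑-cong n λ i → ∑-∑ₐ n (f i)) (∑-∑ₐ n (λ i c → ∑ n (λ j → f i j c)))

  p≤∣p∣ : ∀ p → p ≤ ℚ.∣ p ∣
  p≤∣p∣ p with ℚₚ.∣p∣≡p∨∣p∣≡-p p
  ... | inj₁ eq = ℚₚ.≤-reflexive (sym eq)
  ... | inj₂ eq = ≤-from-diff (subst (λ x → 0ℚ ≤ ℚ.∣ p ∣ + x) eq (+-nonneg (ℚₚ.0≤∣p∣ p) (ℚₚ.0≤∣p∣ p)))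

  lower-bound : ∀ {a b c} → ℚ.∣ a - b ∣ ≤ c → b - c ≤ a
  lower-bound {a} {b} {c} p = ≤-from-diff (subst (0ℚ ≤_) (lem a b c) (diff-from-≤ (ℚₚ.≤-trans
      (ℚₚ.≤-trans (p≤∣p∣ (- (a - b))) (ℚₚ.≤-reflexive (ℚₚ.∣-p∣≡∣p∣ (a - b)))) p)))
    where
    lem : ∀ a b c → c - (- (a - b)) ≡ a - (b - c)
    lem = solve-∀ ℚ-ring

  module Target (n : ℕ) (0<n : 0 ℕ.< n) (U V : ℕ) where

    m : ℕ
    m = n ℕ.∸ 1

    offset : ℕ → Axis → ℕ
    offset B fst = V ℕ.+ B ℕ.+ m ℕ.* U
    offset B snd = V ℕ.+ B
    offset B quo = U ℕ.+ m ℕ.* B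

    -- The logarithms of a, u a + v b and (u a + v b) / (a b) for b = g^B, u = g^U, v = g^V
    -- and u a = v b g^i, u a + v b = v b g^j.
    exponent : ℕ → ℕ → ℕ → Axis → ℕ
    exponent B i j c = pt n i j c ℕ.+ offset B c

    Primitive : ℕ → ℕ → ℕ → Set
    Primitive B i j = Coprime (exponent B i j fst) n × Coprime (exponent B i j snd) n × Coprime (exponent B i j quo) n

    primitive? : ∀ B i j → Dec (Primitive B i j)
    primitive? B i j = coprime? (exponent B i j fst) n ×-dec coprime? (exponent B i j snd) n ×-dec coprime? (exponent B i j quo) n

    χ : ℕ → ℕ → ℕ → ℕ → Axis → ℚ
    χ p B i j c = κ p (exponent B i j c) 0

    -- Minus the offset, so that an exponent vanishes mod `l` exactly where `pt n i j` agrees with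
    -- this point. All conditions then refer to one reference point, as the kernels require.
    target : ℕ → Point
    target B c = m ℕ.* offset B c

    offset-cong : ∀ {l B B′} → Cong l B B′ → ∀ c → Cong l (offset B c) (offset B′ c)
    offset-cong p fst = Cong-+ʳ (m ℕ.* U) (Cong-+ˡ V p)
    offset-cong p snd = Cong-+ˡ V p
    offset-cong p quo = Cong-+ˡ U (Cong-* m p)

    exponent-cong : ∀ {l B B′} → Cong l B B′ → ∀ i j c → Cong l (exponent B i j c) (exponent B′ i j c)
    exponent-cong p i j c = Cong-+ˡ (pt n i j c) (offset-cong p c)

    δ-target : ∀ {l} → l ℕ∣.∣ n → ∀ B i j c → δ l (pt n i j c) (target B c) ≡ δ l (exponent B i j c) 0
    δ-target {l} l∣n B i j c = trans (sym (δ-shift l (pt n i j c) (target B c) (offset B c)))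
      (δ-cong l (Cong-refl (exponent B i j c)) (Cong-neg 0<n l∣n (offset B c)))

    κ-target : ∀ {l} → l ℕ∣.∣ n → ∀ B i j c → κ l (pt n i j c) (target B c) ≡ κ l (exponent B i j c) 0
    κ-target {l} l∣n B i j c = cong (λ d → inv (l ℕ.∸ 1) * (ι l * d - 1ℚ)) (δ-target l∣n B i j c)

    -- Modulo `l` the offsets on `fst` and `quo` add up to V, while the one on `snd` is V + B. The
    -- three lines are concurrent only if `l` divides `B`, that is, if b is an l-th power.
    noncollinear : ∀ {l} → l ℕ∣.∣ n → ∀ B → ¬ (l ℕ∣.∣ B) →
      ¬ Cong l (target B snd ℕ.+ m ℕ.* target B fst) (target B quo)
    noncollinear {l} l∣n B l∤B p = l∤B (Cong0⇒∣ (Cong-cancelˡ V (Cong-trans offsets-equal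
        (Cong-trans (Cong-reflexive (lem U V B (m ℕ.* U) (m ℕ.* B)))
          (Cong-+ˡ V (Cong-+ (Cong-neg 0<n l∣n U) (Cong-neg 0<n l∣n B)))))))
      where
      lem : ∀ U V B mU mB → (U ℕ.+ mB) ℕ.+ (V ℕ.+ B ℕ.+ mU) ≡ V ℕ.+ ((mU ℕ.+ U) ℕ.+ (mB ℕ.+ B))
      lem = solve-∀-ℕ
      neg-cancel : ∀ {X Y} → Cong l (m ℕ.* X) (m ℕ.* Y) → Cong l X Y
      neg-cancel {X} {Y} q = Cong-cancelˡ (m ℕ.* X) (Cong-trans (Cong-neg 0<n l∣n X)
        (Cong-sym (Cong-trans (Cong-+ʳ Y q) (Cong-neg 0<n l∣n Y))))
      f = offset B fst
      s = offset B snd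
      h = offset B quo
      offsets-equal : Cong l s (h ℕ.+ f)
      offsets-equal = neg-cancel (Cong-trans (Cong-sym step₁) (Cong-trans (Cong-+ʳ (m ℕ.* f) p)
          (Cong-reflexive (sym (ℕₚ.*-distribˡ-+ m h f)))))
        where
        step₁ : Cong l (m ℕ.* s ℕ.+ m ℕ.* (m ℕ.* f) ℕ.+ m ℕ.* f) (m ℕ.* s)
        step₁ = subst₂ (Cong l) (sym (ℕₚ.+-assoc (m ℕ.* s) (m ℕ.* (m ℕ.* f)) (m ℕ.* f))) (ℕₚ.+-identityʳ (m ℕ.* s))
          (Cong-+ˡ (m ℕ.* s) (Cong-neg 0<n l∣n (m ℕ.* f)))

    -- Each exponent is linear in `B` with coefficient 1, 1 or -1 mod `p`, so it runs once through
    -- all residues, over which `κ` sums to zero.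
    ∑-κ-exponent : ∀ {p} → 2 ℕ.≤ p → p ℕ∣.∣ n → ∀ i j c → ∑ p (λ B → χ p B i j c) ≡ 0ℚ
    ∑-κ-exponent {p} 2≤p p∣n i j fst = trans (∑-cong p λ B → cong (λ e → κ p e 0) (lem i V B (m ℕ.* U)))
        (∑-κ-shift p 2≤p (i ℕ.+ V ℕ.+ m ℕ.* U) 0)
      where
      lem : ∀ i V B mU → i ℕ.+ (V ℕ.+ B ℕ.+ mU) ≡ B ℕ.+ (i ℕ.+ V ℕ.+ mU)
      lem = solve-∀-ℕ
    ∑-κ-exponent {p} 2≤p p∣n i j snd = trans (∑-cong p λ B → cong (λ e → κ p e 0) (lem j V B))
        (∑-κ-shift p 2≤p (j ℕ.+ V) 0)
      where
      lem : ∀ j V B → j ℕ.+ (V ℕ.+ B) ≡ B ℕ.+ (j ℕ.+ V)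
      lem = solve-∀-ℕ
    ∑-κ-exponent {p} 2≤p p∣n i j quo = trans (∑-cong p flip) (∑-κ-shift p 2≤p 0 (e ℕ.+ U))
      where
      e = j ℕ.+ m ℕ.* i
      flip : ∀ B → κ p (e ℕ.+ (U ℕ.+ m ℕ.* B)) 0 ≡ κ p (B ℕ.+ 0) (e ℕ.+ U)
      flip B = trans (sym (κ-shift p (e ℕ.+ (U ℕ.+ m ℕ.* B)) 0 B)) (trans (κ-sym p (e ℕ.+ (U ℕ.+ m ℕ.* B) ℕ.+ B) B)
        (κ-cong p (Cong-reflexive (sym (ℕₚ.+-identityʳ B)))
          (subst₂ (Cong p) (lem e U (m ℕ.* B) B) (ℕₚ.+-identityʳ (e ℕ.+ U)) (Cong-+ˡ (e ℕ.+ U) (Cong-neg 0<n p∣n B)))))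
        where
        lem : ∀ e U mB B → (e ℕ.+ U) ℕ.+ (mB ℕ.+ B) ≡ e ℕ.+ (U ℕ.+ mB) ℕ.+ B
        lem = solve-∀-ℕ

  module Sieve
    (n : ℕ) (3≤n : 3 ℕ.≤ n)
    {K : ℕ → ℕ → ℚ} (K-line : LineCorrelation n K) (K-nonneg : ∀ i j → 0ℚ ≤ K i j)
    (r : ℚ) (0<r : 0ℚ < r) (q≤rr : ι n + 1ℚ ≤ r * r)
    (U V : ℕ)
    (L : List ℕ) (L-prime : All Prime L) (L-unique : Unique L) (L∣n : ∀ {l} → l ∈ L → l ℕ∣.∣ n)
    (ps : List ℕ) (ps-prime : All Prime ps) (ps∣n : ∀ {p} → p ∈ ps → p ℕ∣.∣ n) (ps∉L : ∀ {p} → p ∈ ps → p ∉ L)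
    (split : ∀ {l} → Prime l → l ℕ∣.∣ n → l ∈ L ⊎ l ∈ ps)
    where

    0<n : 0 ℕ.< n
    0<n = ℕₚ.≤-trans (ℕ.s≤s ℕ.z≤n) 3≤n

    open Target n 0<n U V

    2≤prime : ∀ {p} → p ∈ ps → 2 ℕ.≤ p
    2≤prime p∈ps = prime⇒2≤ (All.lookup ps-prime p∈ps)

    prim : ℕ → ℚ
    prim B = 𝟙 (coprime? B n)

    A : ℕ → ℕ → ℕ → ℚ
    A B i j = avoid (triples L) (pt n i j) (target B)

    A-prod : ∀ B i j → A B i j ≡ prodL L (λ l → avoid₃ l (pt n i j) (target B))
    A-prod B i j = avoid-triples L (pt n i j) (target B)

    A-cong : ∀ {B B′} i j → (∀ {l} → l ∈ L → Cong l B B′) → A B i j ≡ A B′ i j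
    A-cong {B} {B′} i j eq = trans (A-prod B i j) (trans (prodL-cong L λ {l} l∈ →
        cong₂ _*_ (one l fst (eq l∈)) (cong₂ _*_ (one l snd (eq l∈)) (one l quo (eq l∈)))) (sym (A-prod B′ i j)))
      where
      one : ∀ l c → Cong l B B′ → 1ℚ - δ l (pt n i j c) (target B c) ≡ 1ℚ - δ l (pt n i j c) (target B′ c)
      one l c p = cong (λ d → 1ℚ - d) (δ-cong l (Cong-refl (pt n i j c)) (Cong-* m (offset-cong p c)))

    Avoids : ℕ → ℕ → ℕ → ℕ → Set
    Avoids B i j l = ¬ Cong l (exponent B i j fst) 0 × ¬ Cong l (exponent B i j snd) 0 × ¬ Cong l (exponent B i j quo) 0

    avoids? : ∀ B i j l → Dec (Avoids B i j l)
    avoids? B i j l = ¬? (cong? l (exponent B i j fst) 0) ×-dec ¬? (cong? l (exponent B i j snd) 0) ×-dec ¬? (cong? l (exponent B i j quo) 0)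

    A-𝟙 : ∀ B i j → A B i j ≡ 𝟙 (All.all? (avoids? B i j) L)
    A-𝟙 B i j = trans (A-prod B i j) (trans (prodL-cong L local) (prodL-𝟙 (avoids? B i j) L))
      where
      local : ∀ {l} → l ∈ L → avoid₃ l (pt n i j) (target B) ≡ 𝟙 (avoids? B i j l)
      local {l} l∈ = trans (cong₂ _*_ (one fst) (trans (cong₂ _*_ (one snd) (one quo)) (𝟙-× (not snd) (not quo))))
          (𝟙-× (not fst) (not snd ×-dec not quo))
        where
        not : ∀ c → Dec (¬ Cong l (exponent B i j c) 0)
        not c = ¬? (cong? l (exponent B i j c) 0)
        one : ∀ c → 1ℚ - δ l (pt n i j c) (target B c) ≡ 𝟙 (not c)
        one c = trans (cong (λ d → 1ℚ - d) (δ-target (L∣n l∈) B i j c)) (𝟙-¬ (cong? l (exponent B i j c) 0))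

    E : ℕ → ℕ → ℕ → ℕ → ℚ
    E B i j p = ∑ₐ (λ c → δ p (exponent B i j c) 0)

    E-nonneg : ∀ B i j p → 0ℚ ≤ E B i j p
    E-nonneg B i j p = +-nonneg (+-nonneg (nn fst) (nn snd)) (nn quo)
      where
      nn : ∀ c → 0ℚ ≤ δ p (exponent B i j c) 0
      nn c = 𝟙-nonneg (cong? p (exponent B i j c) 0)

    1≤E : ∀ B i j p → ¬ Avoids B i j p →
      1ℚ ≤ E B i j p
    1≤E B i j p hit with cong? p (exponent B i j fst) 0 | cong? p (exponent B i j snd) 0 | cong? p (exponent B i j quo) 0
    ... | yes _ | s     | h     = ℚₚ.+-mono-≤ (ℚₚ.+-mono-≤ (ℚₚ.≤-refl {1ℚ}) (𝟙-nonneg s)) (𝟙-nonneg h)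
    ... | no _  | yes _ | h     = ℚₚ.+-mono-≤ (ℚₚ.≤-refl {1ℚ}) (𝟙-nonneg h)
    ... | no _  | no _  | yes _ = ℚₚ.≤-refl
    ... | no a  | no b  | no c  = ⊥-elim (hit (a , b , c))

    -- A union bound. Where `A` is 1, either some prime of `ps` is hit, so that the sum is at least
    -- 1 and the left side is not positive, or none is, and then `split` shows that no prime divisor
    -- of `n` is hit.
    sieve-pointwise : ∀ B i j → A B i j * (1ℚ - sumL ps (E B i j)) ≤ 𝟙 (primitive? B i j)
    sieve-pointwise B i j = subst (λ a → a * (1ℚ - S) ≤ 𝟙 (primitive? B i j)) (sym (A-𝟙 B i j))
        (cases (All.all? (avoids? B i j) L) (All.all? (avoids? B i j) ps) (primitive? B i j))
      where
      S = sumL ps (E B i j)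
      0≤S : 0ℚ ≤ S
      0≤S = sumL-nonneg ps (E-nonneg B i j)
      cases : (a : Dec (All (Avoids B i j) L)) (b : Dec (All (Avoids B i j) ps)) (d : Dec (Primitive B i j)) → 𝟙 a * (1ℚ - S) ≤ 𝟙 d
      cases (no _)   _        d       = subst (_≤ 𝟙 d) (sym (ℚₚ.*-zeroˡ (1ℚ - S))) (𝟙-nonneg d)
      cases (yes _)  (no hit) d       = ℚₚ.≤-trans (≤-from-diff (subst (0ℚ ≤_) (lem S) (diff-from-≤ 1≤S))) (𝟙-nonneg d)
        where
        lem : ∀ s → s - 1ℚ ≡ 0ℚ - 1ℚ * (1ℚ - s)
        lem = solve-∀ ℚ-ring
        1≤S : 1ℚ ≤ S
        1≤S with find (Allₚ.¬All⇒Any¬ (avoids? B i j) ps hit)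
        ... | p , p∈ps , hit-p = ℚₚ.≤-trans (1≤E B i j p hit-p) (sumL-≥ ps (E-nonneg B i j) p∈ps)
      cases (yes _)  (yes _)  (yes _) = ≤-from-diff (subst (0ℚ ≤_) (lem S) 0≤S)
        where
        lem : ∀ s → s ≡ 1ℚ - 1ℚ * (1ℚ - s)
        lem = solve-∀ ℚ-ring
      cases (yes aL) (yes aps) (no bad) = ⊥-elim (bad
          ( avoid⇒coprime 0<n (λ pr l∣n l∣e → proj₁ (avoided pr l∣n) (∣⇒Cong0 l∣e))
          , avoid⇒coprime 0<n (λ pr l∣n l∣e → proj₁ (proj₂ (avoided pr l∣n)) (∣⇒Cong0 l∣e))
          , avoid⇒coprime 0<n (λ pr l∣n l∣e → proj₂ (proj₂ (avoided pr l∣n)) (∣⇒Cong0 l∣e))))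
        where
        avoided : ∀ {l} → Prime l → l ℕ∣.∣ n →
          Avoids B i j l
        avoided pr l∣n with split pr l∣n
        ... | inj₁ l∈L  = All.lookup aL l∈L
        ... | inj₂ l∈ps = All.lookup aps l∈ps

    triples-good : All (λ f → GoodModulus n (proj₁ f)) (triples L)
    triples-good = go L L-prime L∣n
      where
      go : ∀ L → All Prime L → (∀ {l} → l ∈ L → l ℕ∣.∣ n) → All (λ f → GoodModulus n (proj₁ f)) (triples L)
      go []      _          _   = []
      go (l ∷ L) (pr ∷ prs) L∣n = good ∷ good ∷ good ∷ go L prs (λ l∈ → L∣n (there l∈))
        where
        good : GoodModulus n l
        good = prime⇒2≤ pr , L∣n (here refl)

    error : ℚ
    error = spread-bound (triples L) * r

    -- The density q / n² times the n² pairs of units leaves the factor q. Primitivity of b enters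
    -- through `noncollinear`, which puts the three forbidden lines in general position for every
    -- prime of `L`.
    main-bound : ∀ B → Coprime B n →
      (ι n + 1ℚ) * prodL L generic-density - error ≤ ∑∑ n (λ i j → K i j * A B i j)
    main-bound B cop = lower-bound (subst₂ (λ x y → ℚ.∣ x - y ∣ ≤ error) eq₁ eq₂
        (Expansion.expansion-bound n 3≤n K-line r 0<r q≤rr (target B)
          {triples L} {[]} triples-good []))
      where
      eq₁ : ∑∑ n (λ i j → K i j * (A B i j * 1ℚ)) ≡ ∑∑ n (λ i j → K i j * A B i j)
      eq₁ = ∑∑-cong n λ i j → cong (K i j *_) (ℚₚ.*-identityʳ (A B i j))
      P : ℚ
      P = prodL L generic-density
      ∑∑A : ∑∑ n (A B) ≡ ι n * (ι n * P)
      ∑∑A = Averages.∑∑F n 0<n L L-prime L-unique L∣n (target B)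
        λ l∈ → noncollinear (L∣n l∈) B (coprime⇒avoid cop (All.lookup L-prime l∈) (L∣n l∈))
      eq₂ : density n * ∑∑ n (λ i j → A B i j * 1ℚ) ≡ (ι n + 1ℚ) * P
      eq₂ = trans (cong (density n *_) (trans (∑∑-cong n λ i j → ℚₚ.*-identityʳ (A B i j)) ∑∑A))
        (trans (lem (ι n) (inv n) P) (trans (cong (λ x → (ι n + 1ℚ) * ((x * x) * P)) (inv-*-ι n 0<n)) (lem′ (ι n + 1ℚ) P)))
        where
        lem : ∀ n v p → ((n + 1ℚ) * (v * v)) * (n * (n * p)) ≡ (n + 1ℚ) * (((v * n) * (v * n)) * p)
        lem = solve-∀ ℚ-ring
        lem′ : ∀ q p → q * ((1ℚ * 1ℚ) * p) ≡ q * p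
        lem′ = solve-∀ ℚ-ring

    module _ {p} (p∈ps : p ∈ ps) where
      p-prime : Prime p
      p-prime = All.lookup ps-prime p∈ps

      2≤p : 2 ℕ.≤ p
      2≤p = prime⇒2≤ p-prime

      0<p : 0 ℕ.< p
      0<p = ℕₚ.<⇒≤ 2≤p

      ≢p? : ∀ l → Dec (l ≢ p)
      ≢p? l = ¬? (l ℕ.≟ p)

      others : List ℕ
      others = filter ≢p? (primeDivisors n)

      ∈-others⁻ : ∀ {l} → l ∈ others → Prime l × l ℕ∣.∣ n × l ≢ p
      ∈-others⁻ {l} l∈ with ∈-filter⁻ ≢p? {xs = primeDivisors n} l∈
      ... | l∈n , l≢p = proj₁ (∈-primeDivisors⁻ n l∈n) , proj₂ (∈-primeDivisors⁻ n l∈n) , l≢p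

      ∈-others⁺ : ∀ {l} → Prime l → l ℕ∣.∣ n → l ≢ p → l ∈ others
      ∈-others⁺ pr l∣n l≢p = ∈-filter⁺ ≢p? (∈-primeDivisors⁺ n 0<n pr l∣n) l≢p

      L⊆others : ∀ {l} → l ∈ L → l ∈ others
      L⊆others l∈ = ∈-others⁺ (All.lookup L-prime l∈) (L∣n l∈) λ l≡p → ps∉L p∈ps (subst (_∈ L) l≡p l∈)

      unit : ∃ λ e → Cong p e 1 × (∀ {l} → l ∈ others → l ℕ∣.∣ e)
      unit = crt-unit p-prime (All.tabulate λ l∈ → proj₁ (∈-others⁻ l∈)) (λ p∈ → proj₂ (proj₂ (∈-others⁻ p∈)) refl)

      e : ℕ
      e = proj₁ unit

      e≡1 : Cong p e 1
      e≡1 = proj₁ (proj₂ unit)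

      others∣e : ∀ {l} → l ∈ others → l ℕ∣.∣ e
      others∣e = proj₂ (proj₂ unit)

      prim-split : ∀ B → prim B ≡ (1ℚ - δ p B 0) * 𝟙 (allAvoid? others B)
      prim-split B = sym (trans (cong (_* 𝟙 (allAvoid? others B)) (𝟙-¬ (cong? p B 0)))
        (trans (𝟙-× (¬? (cong? p B 0)) (allAvoid? others B))
        (𝟙-cong (¬? (cong? p B 0) ×-dec allAvoid? others B) (coprime? B n) to from)))
        where
        to : ¬ Cong p B 0 × All (λ l → ¬ Cong l B 0) others → Coprime B n
        to (p∤B , avoids) = avoid⇒coprime 0<n avoided
          where
          avoided : ∀ {l} → Prime l → l ℕ∣.∣ n → ¬ (l ℕ∣.∣ B)
          avoided {l} pr l∣n l∣B with l ℕ.≟ p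
          ... | yes refl = p∤B (∣⇒Cong0 l∣B)
          ... | no l≢p   = All.lookup avoids (∈-others⁺ pr l∣n l≢p) (∣⇒Cong0 l∣B)
        from : Coprime B n → ¬ Cong p B 0 × All (λ l → ¬ Cong l B 0) others
        from cop = (λ p∣B → coprime⇒avoid cop p-prime (ps∣n p∈ps) (Cong0⇒∣ p∣B))
          , All.tabulate λ l∈ l∣B → coprime⇒avoid cop (proj₁ (∈-others⁻ l∈)) (proj₁ (proj₂ (∈-others⁻ l∈))) (Cong0⇒∣ l∣B)

      -- b is not a p-th power, so its logarithm is uniform over the non-zero residues mod p;
      -- there κ averages to -1/(p-1) times its value at residue 0, as its sum over all residues is 0.
      average-over-b : ∀ i j c →
        ∑ n (λ B → prim B * (A B i j * χ p B i j c)) ≡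
        - inv (p ℕ.∸ 1) * ∑ n (λ B → prim B * (A B i j * χ p 0 i j c))
      average-over-b i j c = *-cancelˡ-≡ (0<ι p 0<p) (begin
        ι p * ∑ n (λ B → prim B * (A B i j * χ p B i j c))
          ≡⟨ cong (ι p *_) (∑-cong n λ B → regroup B (χ p B i j c)) ⟩
        ι p * ∑ n (λ B → h B * f B)
          ≡⟨ average n p e 0<p (ps∣n p∈ps) e≡1 h f h-respects (f-invariant n (λ l∈ → proj₁ (proj₂ (∈-others⁻ l∈)))) (f-invariant e others∣e) ⟩
        ∑ p h * ∑ n f
          ≡⟨ cong (_* ∑ n f) ∑h ⟩
        (- inv (p ℕ.∸ 1) * ∑ p h₀) * ∑ n f
          ≡⟨ ℚₚ.*-assoc (- inv (p ℕ.∸ 1)) (∑ p h₀) (∑ n f) ⟩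
        - inv (p ℕ.∸ 1) * (∑ p h₀ * ∑ n f)
          ≡⟨ cong (- inv (p ℕ.∸ 1) *_) (sym (average n p e 0<p (ps∣n p∈ps) e≡1 h₀ f h₀-respects
               (f-invariant n (λ l∈ → proj₁ (proj₂ (∈-others⁻ l∈)))) (f-invariant e others∣e))) ⟩
        - inv (p ℕ.∸ 1) * (ι p * ∑ n (λ B → h₀ B * f B))
          ≡⟨ *-left-comm (- inv (p ℕ.∸ 1)) (ι p) (∑ n (λ B → h₀ B * f B)) ⟩
        ι p * (- inv (p ℕ.∸ 1) * ∑ n (λ B → h₀ B * f B))
          ≡⟨ cong (λ x → ι p * (- inv (p ℕ.∸ 1) * x)) (∑-cong n λ B → sym (regroup B κ₀)) ⟩
        ι p * (- inv (p ℕ.∸ 1) * ∑ n (λ B → prim B * (A B i j * κ₀))) ∎)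
        where
        open ≡-Reasoning
        κ₀ : ℚ
        κ₀ = χ p 0 i j c
        -- `f` sees `B` only modulo the primes in `others`, and `h`, `h₀` only modulo `p`, so
        -- `average` applies with the shift `e`.
        h h₀ f : ℕ → ℚ
        h B = (1ℚ - δ p B 0) * χ p B i j c
        h₀ B = (1ℚ - δ p B 0) * κ₀
        f B = 𝟙 (allAvoid? others B) * A B i j
        regroup : ∀ B k → prim B * (A B i j * k) ≡ ((1ℚ - δ p B 0) * k) * f B
        regroup B k = trans (cong (_* (A B i j * k)) (prim-split B))
            (lem′ (1ℚ - δ p B 0) (𝟙 (allAvoid? others B)) (A B i j) k)
          where
          lem′ : ∀ a b c d → (a * b) * (c * d) ≡ (a * d) * (b * c)
          lem′ = solve-∀ ℚ-ring
        h-respects : Respects p h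
        h-respects q = cong₂ _*_ (cong (λ d → 1ℚ - d) (δ-cong p q (Cong-refl 0))) (κ-cong p (exponent-cong q i j c) (Cong-refl 0))
        h₀-respects : Respects p h₀
        h₀-respects q = cong (λ d → (1ℚ - d) * κ₀) (δ-cong p q (Cong-refl 0))
        f-invariant : ∀ d → (∀ {l} → l ∈ others → l ℕ∣.∣ d) → ∀ B → f (B ℕ.+ d) ≡ f B
        f-invariant d others∣d B = cong₂ _*_
          (𝟙-cong (allAvoid? others (B ℕ.+ d)) (allAvoid? others B)
            (λ av → All.tabulate λ l∈ l∣B → All.lookup av l∈ (Cong-trans (Cong-+∣ B (others∣d l∈)) l∣B))
            (λ av → All.tabulate λ l∈ l∣B → All.lookup av l∈ (Cong-trans (Cong-sym (Cong-+∣ B (others∣d l∈))) l∣B)))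
          (A-cong i j λ l∈ → Cong-+∣ B (others∣d (L⊆others l∈)))
        ∑h : ∑ p h ≡ - inv (p ℕ.∸ 1) * ∑ p h₀
        ∑h = begin
          ∑ p (λ B → (1ℚ - δ p B 0) * χ p B i j c)
            ≡⟨ trans (∑-cong p λ B → lem₁ (δ p B 0) (χ p B i j c))
                 (∑-sub p (λ B → χ p B i j c) (λ B → χ p B i j c * δ p B 0)) ⟩
          ∑ p (λ B → χ p B i j c) - ∑ p (λ B → χ p B i j c * δ p B 0)
            ≡⟨ cong₂ _-_ (∑-κ-exponent 2≤p (ps∣n p∈ps) i j c) (∑-pick p (λ B → χ p B i j c) 0 0<p) ⟩
          0ℚ - κ₀
            ≡⟨ cong (λ x → 0ℚ - x) (trans (sym (ℚₚ.*-identityˡ κ₀)) (cong (_* κ₀) (sym (inv-pred p 2≤p)))) ⟩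
          0ℚ - (inv (p ℕ.∸ 1) * (ι p - 1ℚ)) * κ₀
            ≡⟨ lem₂ (inv (p ℕ.∸ 1)) (ι p) κ₀ ⟩
          - inv (p ℕ.∸ 1) * ((ι p * 1ℚ - 1ℚ) * κ₀)
            ≡⟨ cong (- inv (p ℕ.∸ 1) *_) (sym ∑h₀) ⟩
          - inv (p ℕ.∸ 1) * ∑ p h₀ ∎
          where
          lem₁ : ∀ d k → (1ℚ - d) * k ≡ k - k * d
          lem₁ = solve-∀ ℚ-ring
          lem₂ : ∀ u n k → 0ℚ - (u * (n - 1ℚ)) * k ≡ - u * ((n * 1ℚ - 1ℚ) * k)
          lem₂ = solve-∀ ℚ-ring
          ∑h₀ : ∑ p h₀ ≡ (ι p * 1ℚ - 1ℚ) * κ₀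
          ∑h₀ = trans (∑-*ʳ p κ₀ (λ B → 1ℚ - δ p B 0)) (cong (_* κ₀)
            (trans (∑-sub p (λ _ → 1ℚ) (λ B → δ p B 0)) (cong₂ _-_ (∑-const p 1ℚ) (∑-δ p 0<p 0))))

      -- `χ p 0` belongs to `target 0` while `A B` belongs to `target B`. Replacing `B` by a B₀ that
      -- is 0 mod `p` and unchanged modulo `L` gives both factors one reference point, so that
      -- `expansion-bound` applies. The main term vanishes: `κ` has mean zero over the plane mod `p`
      -- and is independent of the conditions modulo `L`.
      residual-bound : ∀ B c → - error ≤ ∑∑ n (λ i j → K i j * (A B i j * χ p 0 i j c))
      residual-bound B c = subst₂ _≤_ (ℚₚ.+-identityˡ (- error)) (sym eq)
          (lower-bound {b = 0ℚ} (subst (λ x → ℚ.∣ ∑∑ n (λ i j → K i j * Φ i j) - x ∣ ≤ error) density-zero bound))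
        where
        -- This is B - e B, where `e` is 1 mod `p` and 0 modulo the primes of `L`.
        B₀ = B ℕ.+ m ℕ.* (e ℕ.* B)
        z = target B₀
        Φ : ℕ → ℕ → ℚ
        Φ i j = avoid (triples L) (pt n i j) z * kernel ((p , c) ∷ []) (pt n i j) z
        B₀≡B : ∀ {l} → l ∈ L → Cong l B₀ B
        B₀≡B l∈ = Cong-+∣ B (ℕ∣.∣n⇒∣m*n m (ℕ∣.∣m⇒∣m*n B (others∣e (L⊆others l∈))))
        B₀≡0 : Cong p B₀ 0
        B₀≡0 = Cong-trans (Cong-+ˡ B (Cong-* m eB≡B)) (Cong-trans (Cong-reflexive (ℕₚ.+-comm B (m ℕ.* B))) (Cong-neg 0<n (ps∣n p∈ps) B))
          where
          eB≡B : Cong p (e ℕ.* B) B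
          eB≡B = subst₂ (Cong p) (ℕₚ.*-comm B e) (ℕₚ.*-identityʳ B) (Cong-* B e≡1)
        eq : ∑∑ n (λ i j → K i j * (A B i j * χ p 0 i j c)) ≡ ∑∑ n (λ i j → K i j * Φ i j)
        eq = ∑∑-cong n λ i j → cong (K i j *_) (cong₂ _*_ (A-cong i j λ l∈ → Cong-sym (B₀≡B l∈))
          (trans (κ-cong p (exponent-cong (Cong-sym B₀≡0) i j c) (Cong-refl 0))
            (trans (sym (κ-target (ps∣n p∈ps) B₀ i j c)) (sym (ℚₚ.*-identityʳ (κ p (pt n i j c) (z c)))))))
        bound : ℚ.∣ discrepancy n K Φ ∣ ≤ error
        bound = Expansion.expansion-bound n 3≤n K-line r 0<r q≤rr z
          {triples L} {(p , c) ∷ []} triples-good ((2≤p , ps∣n p∈ps) ∷ [])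
        open Averages n 0<n L L-prime L-unique L∣n z using (F; F-invariant)
        ∑∑κ : ∀ c → ∑∑ p (λ i j → κ p (pt n i j c) (z c)) ≡ 0ℚ
        ∑∑κ fst = trans (∑-swap p p (λ i _ → κ p i (z fst))) (trans (∑-cong p λ _ →
          trans (∑-cong p λ i → cong (λ x → κ p x (z fst)) (sym (ℕₚ.+-identityʳ i))) (∑-κ-shift p 2≤p 0 (z fst))) (∑-zero p))
        ∑∑κ snd = trans (∑-cong p λ _ →
          trans (∑-cong p λ i → cong (λ x → κ p x (z snd)) (sym (ℕₚ.+-identityʳ i))) (∑-κ-shift p 2≤p 0 (z snd))) (∑-zero p)
        ∑∑κ quo = trans (∑-cong p λ i → ∑-κ-shift p 2≤p (m ℕ.* i) (z quo)) (∑-zero p)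
        ∑∑κF : ∑∑ n (λ i j → κ p (pt n i j c) (z c) * F i j) ≡ 0ℚ
        ∑∑κF = *-cancelˡ-≡ (0<ι p 0<p) (*-cancelˡ-≡ (0<ι p 0<p) (trans
          (average₂ n p e 0<p (ps∣n p∈ps) e≡1 (λ i j → κ p (pt n i j c) (z c)) F
            (λ a b → κ-cong p (pt-cong n a b c) (Cong-refl (z c)))
            (F-invariant n L∣n) (F-invariant e (λ l∈ → others∣e (L⊆others l∈))))
          (trans (cong (_* ∑∑ n F) (∑∑κ c)) (lem (∑∑ n F) (ι p)))))
          where
          lem : ∀ a b → 0ℚ * a ≡ b * (b * 0ℚ)
          lem = solve-∀ ℚ-ring
        density-zero : density n * ∑∑ n Φ ≡ 0ℚ
        density-zero = trans (cong (density n *_) (trans (∑∑-cong n λ i j →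
          lem (F i j) (κ p (pt n i j c) (z c))) ∑∑κF)) (ℚₚ.*-zeroʳ (density n))
          where
          lem : ∀ a b → a * (b * 1ℚ) ≡ b * a
          lem = solve-∀ ℚ-ring

    primitives : ℚ
    primitives = ∑ n prim

    prim-weighted : ∀ {a} (f : ℕ → ℚ) → (∀ B → Coprime B n → a ≤ f B) → primitives * a ≤ ∑ n (λ B → prim B * f B)
    prim-weighted {a} f bound = subst (_≤ ∑ n (λ B → prim B * f B)) (∑-*ʳ n a prim) (∑-mono< n λ B _ → pointwise B)
      where
      pointwise : ∀ B → prim B * a ≤ prim B * f B
      pointwise B with coprime? B n
      ... | yes cop = *-monoˡ-≤ 0≤1 (bound B cop)
      ... | no _    = ℚₚ.≤-reflexive (trans (ℚₚ.*-zeroˡ a) (sym (ℚₚ.*-zeroˡ (f B))))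

    -- Equal to `δ₃ ps` by computation, written with `ι` and `sumL`.
    δ₀ : ℚ
    δ₀ = 1ℚ - ι 3 * sumL ps inv

    N₀ : ℕ → ℚ
    N₀ B = ∑∑ n (λ i j → K i j * A B i j)

    twisted residual : ℕ → Axis → ℕ → ℚ
    twisted p c B  = ∑∑ n (λ i j → K i j * (A B i j * χ p B i j c))
    residual p c B = ∑∑ n (λ i j → K i j * (A B i j * χ p 0 i j c))

    -- The average over `B` has to be taken for fixed (i, j). This is possible because `K` does not
    -- involve b, which is what the substitution u a = v b x achieves.
    ∑-through-∑∑ : ∀ (w : ℕ → ℚ) (f : ℕ → ℕ → ℕ → ℚ) →
      ∑ n (λ B → w B * ∑∑ n (λ i j → K i j * f B i j)) ≡ ∑∑ n (λ i j → K i j * ∑ n (λ B → w B * f B i j))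
    ∑-through-∑∑ w f = begin
      ∑ n (λ B → w B * ∑∑ n (λ i j → K i j * f B i j))
        ≡⟨ (∑-cong n λ B → trans (sym (∑∑-*ˡ n (w B) (λ i j → K i j * f B i j)))
             (∑∑-cong n λ i j → *-left-comm (w B) (K i j) (f B i j))) ⟩
      ∑ n (λ B → ∑∑ n (λ i j → K i j * (w B * f B i j)))
        ≡⟨ sym (∑∑-∑-swap n n (λ i j B → K i j * (w B * f B i j))) ⟩
      ∑∑ n (λ i j → ∑ n (λ B → K i j * (w B * f B i j)))
        ≡⟨ (∑∑-cong n λ i j → ∑-*ˡ n (K i j) (λ B → w B * f B i j)) ⟩
      ∑∑ n (λ i j → K i j * ∑ n (λ B → w B * f B i j)) ∎
      where
      open ≡-Reasoning

    ∑-twisted : ∀ {p} → p ∈ ps → ∀ c →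
      ∑ n (λ B → prim B * twisted p c B) ≡ - inv (p ℕ.∸ 1) * ∑ n (λ B → prim B * residual p c B)
    ∑-twisted {p} p∈ps c = begin
      ∑ n (λ B → prim B * twisted p c B)
        ≡⟨ ∑-through-∑∑ prim (λ B i j → A B i j * χ p B i j c) ⟩
      ∑∑ n (λ i j → K i j * ∑ n (λ B → prim B * (A B i j * χ p B i j c)))
        ≡⟨ (∑∑-cong n λ i j → trans (cong (K i j *_) (average-over-b p∈ps i j c))
             (*-left-comm (K i j) (- inv (p ℕ.∸ 1)) (∑ n (λ B → prim B * (A B i j * χ p 0 i j c))))) ⟩
      ∑∑ n (λ i j → - inv (p ℕ.∸ 1) * (K i j * ∑ n (λ B → prim B * (A B i j * χ p 0 i j c))))
        ≡⟨ ∑∑-*ˡ n (- inv (p ℕ.∸ 1)) (λ i j → K i j * ∑ n (λ B → prim B * (A B i j * χ p 0 i j c))) ⟩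
      - inv (p ℕ.∸ 1) * ∑∑ n (λ i j → K i j * ∑ n (λ B → prim B * (A B i j * χ p 0 i j c)))
        ≡⟨ cong (- inv (p ℕ.∸ 1) *_) (sym (∑-through-∑∑ prim (λ B i j → A B i j * χ p 0 i j c))) ⟩
      - inv (p ℕ.∸ 1) * ∑ n (λ B → prim B * residual p c B) ∎
      where
      open ≡-Reasoning

    -- The means 1/p of the three indicators at each prime are collected in `δ₀`, and only their
    -- mean-zero parts remain.
    sieve-weight : ∀ B i j → 1ℚ - sumL ps (E B i j) ≡
      δ₀ - sumL ps (λ p → ϑ p * ∑ₐ (λ c → χ p B i j c))
    sieve-weight B i j = trans (cong (λ x → 1ℚ - x) (trans (sumL-cong ps local)
        (trans (sumL-+ ps (λ p → ι 3 * inv p) (λ p → ϑ p * ∑ₐ (λ c → χ p B i j c)))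
          (cong (_+ R) (sumL-*ˡ ps (ι 3) inv))))) (lem (ι 3 * sumL ps inv) R)
      where
      R : ℚ
      R = sumL ps (λ p → ϑ p * ∑ₐ (λ c → χ p B i j c))
      lem : ∀ a b → 1ℚ - (a + b) ≡ (1ℚ - a) - b
      lem = solve-∀ ℚ-ring
      local : ∀ {p} → p ∈ ps → E B i j p ≡ ι 3 * inv p + ϑ p * ∑ₐ (λ c → χ p B i j c)
      local {p} p∈ps = trans (∑ₐ-cong λ c → δ-as-κ p (2≤prime p∈ps) (exponent B i j c) 0)
        (lem′ (inv p) (ϑ p) (χ p B i j fst) (χ p B i j snd) (χ p B i j quo))
        where
        lem′ : ∀ v t a b c → (v + t * a) + (v + t * b) + (v + t * c) ≡ ι 3 * v + t * (a + b + c)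
        lem′ = solve-∀ ℚ-ring

    sieve-sum : ∀ B → ∑∑ n (λ i j → K i j * (A B i j * (1ℚ - sumL ps (E B i j)))) ≡
      δ₀ * N₀ B - sumL ps (λ p → ϑ p * ∑ₐ (λ c → twisted p c B))
    sieve-sum B = begin
      ∑∑ n (λ i j → K i j * (A B i j * (1ℚ - sumL ps (E B i j))))
        ≡⟨ ∑∑-cong n local ⟩
      ∑∑ n (λ i j → δ₀ * (K i j * A B i j) - sumL ps (λ p → ϑ p * ∑ₐ (λ c → T i j p c)))
        ≡⟨ ∑∑-sub n (λ i j → δ₀ * (K i j * A B i j)) (λ i j → sumL ps (λ p → ϑ p * ∑ₐ (T i j p))) ⟩
      ∑∑ n (λ i j → δ₀ * (K i j * A B i j)) - ∑∑ n (λ i j → sumL ps (λ p → ϑ p * ∑ₐ (T i j p)))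
        ≡⟨ cong₂ _-_ (∑∑-*ˡ n δ₀ (λ i j → K i j * A B i j)) (trans (∑∑-sumL n ps (λ i j p → ϑ p * ∑ₐ (T i j p)))
             (sumL-cong ps λ {p} _ → trans (∑∑-*ˡ n (ϑ p) (λ i j → ∑ₐ (T i j p))) (cong (ϑ p *_) (∑∑-∑ₐ n (λ i j → T i j p))))) ⟩
      δ₀ * N₀ B - sumL ps (λ p → ϑ p * ∑ₐ (λ c → twisted p c B)) ∎
      where
      open ≡-Reasoning
      T : ℕ → ℕ → ℕ → Axis → ℚ
      T i j p c = K i j * (A B i j * χ p B i j c)
      lem : ∀ k a d s → k * (a * (d - s)) ≡ d * (k * a) - (k * a) * s
      lem = solve-∀ ℚ-ring
      lem′ : ∀ k a t x y z → (k * a) * (t * (x + y + z)) ≡ t * (k * (a * x) + k * (a * y) + k * (a * z))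
      lem′ = solve-∀ ℚ-ring
      local : ∀ i j → K i j * (A B i j * (1ℚ - sumL ps (E B i j))) ≡
        δ₀ * (K i j * A B i j) - sumL ps (λ p → ϑ p * ∑ₐ (λ c → T i j p c))
      local i j = trans (cong (λ x → K i j * (A B i j * x)) (sieve-weight B i j))
        (trans (lem (K i j) (A B i j) δ₀ (sumL ps (λ p → ϑ p * ∑ₐ (λ c → χ p B i j c))))
          (cong (λ x → δ₀ * (K i j * A B i j) - x)
            (trans (sym (sumL-*ˡ ps (K i j * A B i j) (λ p → ϑ p * ∑ₐ (λ c → χ p B i j c))))
              (sumL-cong ps λ {p} _ → lem′ (K i j) (A B i j) (ϑ p)
                (χ p B i j fst) (χ p B i j snd) (χ p B i j quo)))))

    -- The expansion of the sieve weight brings the factor - ϑ(p), the average over b the factor -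
    -- 1/(p - 1), and ϑ(p) / (p - 1) = 1/p. Residuals therefore enter with weight 1/p, where the
    -- twisted sums had weight ϑ(p).
    total-sum : ∑ n (λ B → prim B * ∑∑ n (λ i j → K i j * (A B i j * (1ℚ - sumL ps (E B i j))))) ≡
      δ₀ * ∑ n (λ B → prim B * N₀ B) + sumL ps (λ p → inv p * ∑ₐ (λ c → ∑ n (λ B → prim B * residual p c B)))
    total-sum = begin
      ∑ n (λ B → prim B * ∑∑ n (λ i j → K i j * (A B i j * (1ℚ - sumL ps (E B i j)))))
        ≡⟨ (∑-cong n λ B → trans (cong (prim B *_) (sieve-sum B)) (trans (lem (prim B) δ₀ (N₀ B) (sumL ps (λ p → ϑ p * ∑ₐ (λ c → twisted p c B))))
             (cong (λ x → δ₀ * (prim B * N₀ B) - x) (trans (sym (sumL-*ˡ ps (prim B) (λ p → ϑ p * ∑ₐ (λ c → twisted p c B))))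
               (sumL-cong ps λ {p} _ → lem′ (prim B) (ϑ p) (twisted p fst B) (twisted p snd B) (twisted p quo B)))))) ⟩
      ∑ n (λ B → δ₀ * (prim B * N₀ B) - sumL ps (λ p → ϑ p * ∑ₐ (λ c → prim B * twisted p c B)))
        ≡⟨ trans (∑-sub n (λ B → δ₀ * (prim B * N₀ B)) (λ B → sumL ps (λ p → ϑ p * ∑ₐ (λ c → prim B * twisted p c B))))
             (cong₂ _-_ (∑-*ˡ n δ₀ (λ B → prim B * N₀ B))
               (trans (∑-sumL n ps (λ B p → ϑ p * ∑ₐ (λ c → prim B * twisted p c B))) (sumL-cong ps λ {p} p∈ps →
                 trans (∑-*ˡ n (ϑ p) (λ B → ∑ₐ (λ c → prim B * twisted p c B)))
                   (cong (ϑ p *_) (trans (∑-∑ₐ n (λ B c → prim B * twisted p c B)) (∑ₐ-cong (∑-twisted p∈ps))))))) ⟩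
      δ₀ * ∑ n (λ B → prim B * N₀ B) - sumL ps (λ p → ϑ p * ∑ₐ (λ c → - inv (p ℕ.∸ 1) * X p c))
        ≡⟨ cong (λ x → δ₀ * ∑ n (λ B → prim B * N₀ B) - x) (trans (sumL-cong ps λ {p} p∈ps → local p (2≤prime p∈ps))
             (sumL-*ˡ ps (- 1ℚ) (λ p → inv p * ∑ₐ (X p)))) ⟩
      δ₀ * ∑ n (λ B → prim B * N₀ B) - (- 1ℚ) * sumL ps (λ p → inv p * ∑ₐ (X p))
        ≡⟨ lem″ (δ₀ * ∑ n (λ B → prim B * N₀ B)) (sumL ps (λ p → inv p * ∑ₐ (X p))) ⟩
      δ₀ * ∑ n (λ B → prim B * N₀ B) + sumL ps (λ p → inv p * ∑ₐ (X p)) ∎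
      where
      open ≡-Reasoning
      X : ℕ → Axis → ℚ
      X p c = ∑ n (λ B → prim B * residual p c B)
      lem : ∀ w d n s → w * (d * n - s) ≡ d * (w * n) - w * s
      lem = solve-∀ ℚ-ring
      lem′ : ∀ w t x y z → w * (t * (x + y + z)) ≡ t * (w * x + w * y + w * z)
      lem′ = solve-∀ ℚ-ring
      lem″ : ∀ a b → a - (- 1ℚ) * b ≡ a + b
      lem″ = solve-∀ ℚ-ring
      local : ∀ p → 2 ℕ.≤ p → ϑ p * ∑ₐ (λ c → - inv (p ℕ.∸ 1) * X p c) ≡ (- 1ℚ) * (inv p * ∑ₐ (X p))
      local p 2≤p = trans (cong (ϑ p *_) (∑ₐ-*ˡ (- inv (p ℕ.∸ 1)) (X p)))
        (trans (lem‴ (ϑ p) (inv (p ℕ.∸ 1)) (∑ₐ (X p))) (cong (λ x → (- 1ℚ) * (x * ∑ₐ (X p))) (ϑ-inv-pred p 2≤p)))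
        where
        lem‴ : ∀ t u x → t * (- u * x) ≡ (- 1ℚ) * ((t * u) * x)
        lem‴ = solve-∀ ℚ-ring

    sieve-bound : 0ℚ ≤ δ₀ →
      primitives * (δ₀ * ((ι n + 1ℚ) * prodL L generic-density) - error) ≤
      ∑ n (λ B → prim B * ∑∑ n (λ i j → K i j * 𝟙 (primitive? B i j)))
    sieve-bound 0≤δ₀ = begin
      primitives * (δ₀ * Q - error)
        ≡⟨ lem primitives Q error (sumL ps inv) ⟩
      δ₀ * (primitives * (Q - error)) + (ι 3 * (primitives * (- error))) * sumL ps inv
        ≤⟨ ℚₚ.+-mono-≤ (*-monoˡ-≤ 0≤δ₀ (prim-weighted N₀ main-bound)) residuals ⟩
      δ₀ * ∑ n (λ B → prim B * N₀ B) + sumL ps (λ p → inv p * ∑ₐ (X p))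
        ≡⟨ sym total-sum ⟩
      ∑ n (λ B → prim B * ∑∑ n (λ i j → K i j * (A B i j * (1ℚ - sumL ps (E B i j)))))
        ≤⟨ (∑-mono< n λ B _ → *-monoˡ-≤ (𝟙-nonneg (coprime? B n)) (∑-mono< n λ i _ → ∑-mono< n λ j _ →
             *-monoˡ-≤ (K-nonneg i j) (sieve-pointwise B i j))) ⟩
      ∑ n (λ B → prim B * ∑∑ n (λ i j → K i j * 𝟙 (primitive? B i j))) ∎
      where
      open ℚₚ.≤-Reasoning
      Q : ℚ
      Q = (ι n + 1ℚ) * prodL L generic-density
      X : ℕ → Axis → ℚ
      X p c = ∑ n (λ B → prim B * residual p c B)
      lem : ∀ φ q e s → φ * ((1ℚ - ι 3 * s) * q - e) ≡ (1ℚ - ι 3 * s) * (φ * (q - e)) + (ι 3 * (φ * (- e))) * s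
      lem = solve-∀ ℚ-ring
      residuals : (ι 3 * (primitives * (- error))) * sumL ps inv ≤ sumL ps (λ p → inv p * ∑ₐ (X p))
      residuals = subst (_≤ sumL ps (λ p → inv p * ∑ₐ (X p))) (sumL-*ˡ ps (ι 3 * (primitives * (- error))) inv)
          (sumL-mono ps λ {p} p∈ps → subst (_≤ inv p * ∑ₐ (X p)) (lem′ (inv p) (primitives * (- error)))
            (*-monoˡ-≤ (0≤inv p) (ℚₚ.+-mono-≤ (ℚₚ.+-mono-≤ (each p∈ps fst) (each p∈ps snd)) (each p∈ps quo))))
        where
        each : ∀ {p} → p ∈ ps → ∀ c → primitives * (- error) ≤ X p c
        each {p} p∈ps c = prim-weighted (residual p c) λ B _ → residual-bound p∈ps B c
        lem′ : ∀ v x → v * (x + x + x) ≡ (ι 3 * x) * v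
        lem′ = solve-∀ ℚ-ring

-- From the weighted sum to a list of distinct pairs.

module Counting where
  open RingSolver using (solve-∀)
  open Coprimality using (Coprime; coprime?)
  open RationalSums
  open PositiveDefiniteKernels
  open JacobiSums
  open ResidueAverages
  open CyclicUnits
  open ZechLogarithms
  open Multiplicativity
  open Sieving

  sumL-++ : ∀ {A : Set} (xs ys : List A) f → sumL (xs ++ ys) f ≡ sumL xs f ℚ.+ sumL ys f
  sumL-++ []       ys f = ≡.sym (ℚₚ.+-identityˡ (sumL ys f))
  sumL-++ (x ∷ xs) ys f = ≡.trans (≡.cong (λ z → f x ℚ.+ z) (sumL-++ xs ys f)) (≡.sym (ℚₚ.+-assoc (f x) (sumL xs f) (sumL ys f)))

  sumL-map : ∀ {A B : Set} (h : A → B) xs f → sumL (List.map h xs) f ≡ sumL xs (λ x → f (h x))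
  sumL-map h []       f = ≡.refl
  sumL-map h (x ∷ xs) f = ≡.cong (λ z → f (h x) ℚ.+ z) (sumL-map h xs f)

  sumL-cartesianProduct : ∀ {A B : Set} (xs : List A) (ys : List B) f →
    sumL (cartesianProduct xs ys) f ≡ sumL xs (λ x → sumL ys (λ y → f (x , y)))
  sumL-cartesianProduct []       ys f = ≡.refl
  sumL-cartesianProduct (x ∷ xs) ys f = ≡.trans (sumL-++ (List.map (x ,_) ys) (cartesianProduct xs ys) f)
    (≡.cong₂ ℚ._+_ (sumL-map (x ,_) ys f) (sumL-cartesianProduct xs ys f))

  box : ℕ → List (ℕ × ℕ × ℕ)
  box n = cartesianProduct (upTo n) (cartesianProduct (upTo n) (upTo n))

  sumL-box : ∀ n f → sumL (box n) f ≡ ∑ n (λ B → ∑∑ n (λ i j → f (B , i , j)))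
  sumL-box n f = ≡.trans (sumL-cartesianProduct (upTo n) (cartesianProduct (upTo n) (upTo n)) f)
    (≡.trans (sumL-applyUpTo (λ B → B) n (λ B → sumL (cartesianProduct (upTo n) (upTo n)) (λ t → f (B , t))))
    (∑-cong n λ B → ≡.trans (sumL-cartesianProduct (upTo n) (upTo n) (λ t → f (B , t)))
    (≡.trans (sumL-applyUpTo (λ i → i) n (λ i → sumL (upTo n) (λ j → f (B , i , j))))
    (∑-cong n λ i → sumL-applyUpTo (λ j → j) n (λ j → f (B , i , j))))))

  allPairs-from-unique : ∀ {a p r} {A : Set a} {P : A → Set p} {R : A → A → Set r} →
    (∀ {x y} → P x → P y → x ≢ y → R x y) → ∀ {xs} → All P xs → Unique xs → AllPairs R xs
  allPairs-from-unique f []         []           = []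
  allPairs-from-unique f (px ∷ pxs) (x≢ ∷ uniq) =
    All.zipWith (λ (py , x≢y) → f px py x≢y) (pxs , x≢) ∷ allPairs-from-unique f pxs uniq

  coprime-inverse : ∀ {e n} → 0 ℕ.< n → Coprime e n → ∃ λ e′ → Cong n (e ℕ.* e′) 1
  coprime-inverse {e} {n} 0<n cop with Coprimality.coprime-Bézout cop
  ... | Bézout.+- x y eq = x , ≡.subst (λ t → Cong n t 1) (≡.trans eq (ℕₚ.*-comm x e)) (Cong-+∣ 1 (ℕ∣.n∣m*n y))
  -- Here x e is -1 mod `n`, hence the factor n - 1.
  ... | Bézout.-+ x y eq = (n ℕ.∸ 1) ℕ.* x , Cong-cancelʳ (x ℕ.* e) (Cong-trans
        (≡.subst (λ t → Cong n (t ℕ.+ x ℕ.* e) 0) (lem (n ℕ.∸ 1) x e) (Cong-neg 0<n ℕ∣.∣-refl (x ℕ.* e)))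
        (Cong-sym (∣⇒Cong0 (≡.subst (n ℕ∣.∣_) (≡.sym eq) (ℕ∣.n∣m*n y)))))
    where
    lem : ∀ m x e → m ℕ.* (x ℕ.* e) ≡ e ℕ.* (m ℕ.* x)
    lem = solve-∀-ℕ

  module PrimitivePairs {c ℓ n} (F : FiniteField c ℓ (suc n)) (0<n : 0 ℕ.< n) (root : PrimitiveRoot F n)
    (u v : FiniteField.Carrier F) (u≉0 : Powers.NonZero F u) (v≉0 : Powers.NonZero F v) where
    open FiniteField F
    open Powers F
    open PrimitiveRoot root
    open Zech F 0<n root
    open SetoidReasoning setoid
    open SemiringSolver commutativeSemiring using (solve; _:=_; _:+_; _:*_)

    U V : ℕ
    U = proj₁ (log u u≉0)
    V = proj₁ (log v v≉0)

    u≈ : u ≈ g ^ U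
    u≈ = proj₂ (proj₂ (log u u≉0))

    v≈ : v ≈ g ^ V
    v≈ = proj₂ (proj₂ (log v v≉0))

    open Target n 0<n U V

    isPrimitive-resp : ∀ {x y} → x ≈ y → IsPrimitive x → IsPrimitive y
    isPrimitive-resp x≈y (x≉0 , gen) = NonZero-resp x≈y x≉0 , λ w w≉0 →
      proj₁ (gen w w≉0) , trans (proj₂ (gen w w≉0)) (^-cong x≈y (proj₁ (gen w w≉0)))

    coprime⇒primitive : ∀ {e} → Coprime e n → IsPrimitive (g ^ e)
    coprime⇒primitive {e} cop = ^-nonZero g≉0 e , generates
      where
      e′ = proj₁ (coprime-inverse 0<n cop)
      generates : ∀ x → NonZero x → ∃ λ k → x ≈ (g ^ e) ^ k
      generates x x≉0 with log x x≉0
      ... | i , _ , x≈gi = e′ ℕ.* i , (begin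
        x                        ≈⟨ x≈gi ⟩
        g ^ i                    ≈⟨ ^-period (Cong-sym (≡.subst₂ (Cong n) (lem i e e′) (ℕₚ.*-identityʳ i) (Cong-* i (proj₂ (coprime-inverse 0<n cop))))) ⟩
        g ^ (e ℕ.* (e′ ℕ.* i))   ≈⟨ ^-* g e (e′ ℕ.* i) ⟩
        (g ^ e) ^ (e′ ℕ.* i)     ∎)
        where
        lem : ∀ i e e′ → i ℕ.* (e ℕ.* e′) ≡ e ℕ.* (e′ ℕ.* i)
        lem = solve-∀-ℕ

    -- `j` is determined mod `n` by `i`; it is kept as a component so that the triples are counted
    -- by a sum against `K`.
    Good : ℕ × ℕ × ℕ → Set ℓ
    Good (B , i , j) = Coprime B n × (g ^ j ≈ 1# + g ^ i) × Primitive B i j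

    good? : ∀ t → Dec (Good t)
    good? (B , i , j) = coprime? B n ×-dec (zech? i j ×-dec primitive? B i j)

    pair : ℕ × ℕ × ℕ → Carrier × Carrier
    pair (B , i , j) = g ^ exponent B i j fst , g ^ B

    good⇒primitive : ∀ B i j → Good (B , i , j) →
      IsUVPrimitive u v (g ^ exponent B i j fst) (g ^ B)
    good⇒primitive B i j (copB , zech , copA , copC , copD) =
      coprime⇒primitive copA , coprime⇒primitive copB ,
      isPrimitive-resp (sym c≈) (coprime⇒primitive copC) ,
      isPrimitive-resp (sym d≈) (coprime⇒primitive copD)
      where
      a b : Carrier
      a = g ^ exponent B i j fst
      b = g ^ B
      ua≈ : u * a ≈ g ^ (V ℕ.+ B) * g ^ i
      ua≈ = begin
        u * a                              ≈⟨ *-congʳ u≈ ⟩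
        g ^ U * a                          ≈⟨ sym (^-+ g U (exponent B i j fst)) ⟩
        g ^ (U ℕ.+ exponent B i j fst)     ≈⟨ ^-period (Cong-trans (Cong-reflexive (lem U V B i (m ℕ.* U)))
                                                (≡.subst (Cong n (V ℕ.+ B ℕ.+ i ℕ.+ (m ℕ.* U ℕ.+ U))) (ℕₚ.+-identityʳ (V ℕ.+ B ℕ.+ i))
                                                  (Cong-+ˡ (V ℕ.+ B ℕ.+ i) (Cong-neg 0<n ℕ∣.∣-refl U)))) ⟩
        g ^ (V ℕ.+ B ℕ.+ i)                ≈⟨ ^-+ g (V ℕ.+ B) i ⟩
        g ^ (V ℕ.+ B) * g ^ i              ∎
        where
        lem : ∀ U V B i mU → U ℕ.+ (i ℕ.+ (V ℕ.+ B ℕ.+ mU)) ≡ V ℕ.+ B ℕ.+ i ℕ.+ (mU ℕ.+ U)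
        lem = solve-∀-ℕ
      vb≈ : v * b ≈ g ^ (V ℕ.+ B) * 1#
      vb≈ = trans (*-congʳ v≈) (trans (sym (^-+ g V B)) (sym (*-identityʳ _)))
      c≈ : u * a + v * b ≈ g ^ exponent B i j snd
      c≈ = begin
        u * a + v * b                                  ≈⟨ +-cong ua≈ vb≈ ⟩
        g ^ (V ℕ.+ B) * g ^ i + g ^ (V ℕ.+ B) * 1#     ≈⟨ sym (distribˡ _ _ _) ⟩
        g ^ (V ℕ.+ B) * (g ^ i + 1#)                   ≈⟨ *-congˡ (trans (+-comm _ _) (sym zech)) ⟩
        g ^ (V ℕ.+ B) * g ^ j                          ≈⟨ *-comm _ _ ⟩
        g ^ j * g ^ (V ℕ.+ B)                          ≈⟨ sym (^-+ g j (V ℕ.+ B)) ⟩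
        g ^ (j ℕ.+ (V ℕ.+ B))                          ∎
      a≉0 = ^-nonZero g≉0 (exponent B i j fst)
      b≉0 = ^-nonZero g≉0 B
      -- Multiplied by a b, the left side becomes u a + v b, so it suffices that the exponents of a,
      -- of b and on `quo` add up to the one on `snd` mod `n`.
      d≈ : v * a ⁻¹ + u * b ⁻¹ ≈ g ^ exponent B i j quo
      d≈ = *-cancelˡ (*-nonZero a≉0 b≉0) (begin
        (a * b) * (v * a ⁻¹ + u * b ⁻¹)
          ≈⟨ solve 6 (λ a b v u a′ b′ → (a :* b) :* (v :* a′ :+ u :* b′) := (v :* b) :* (a :* a′) :+ (u :* a) :* (b :* b′))
               refl a b v u (a ⁻¹) (b ⁻¹) ⟩
        (v * b) * (a * a ⁻¹) + (u * a) * (b * b ⁻¹)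
          ≈⟨ +-cong (trans (*-congˡ (inverseʳ a a≉0)) (*-identityʳ _)) (trans (*-congˡ (inverseʳ b b≉0)) (*-identityʳ _)) ⟩
        v * b + u * a
          ≈⟨ +-comm _ _ ⟩
        u * a + v * b
          ≈⟨ c≈ ⟩
        g ^ exponent B i j snd
          ≈⟨ ^-period (Cong-sym (Cong-trans (Cong-reflexive (lem i V B (m ℕ.* U) j (m ℕ.* i) U (m ℕ.* B)))
               (≡.subst (Cong n (j ℕ.+ (V ℕ.+ B) ℕ.+ ((m ℕ.* i ℕ.+ i) ℕ.+ (m ℕ.* U ℕ.+ U) ℕ.+ (m ℕ.* B ℕ.+ B)))) (ℕₚ.+-identityʳ (j ℕ.+ (V ℕ.+ B)))
                 (Cong-+ˡ (j ℕ.+ (V ℕ.+ B)) (Cong-+ (Cong-+ (neg i) (neg U)) (neg B)))))) ⟩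
        g ^ (exponent B i j fst ℕ.+ B ℕ.+ exponent B i j quo)
          ≈⟨ trans (^-+ g (exponent B i j fst ℕ.+ B) (exponent B i j quo)) (*-congʳ (^-+ g (exponent B i j fst) B)) ⟩
        (a * b) * g ^ exponent B i j quo ∎)
        where
        neg : ∀ x → Cong n (m ℕ.* x ℕ.+ x) 0
        neg = Cong-neg 0<n ℕ∣.∣-refl
        lem : ∀ i V B mU j mi U mB → (i ℕ.+ (V ℕ.+ B ℕ.+ mU)) ℕ.+ B ℕ.+ (j ℕ.+ mi ℕ.+ (U ℕ.+ mB)) ≡
          j ℕ.+ (V ℕ.+ B) ℕ.+ ((mi ℕ.+ i) ℕ.+ (mU ℕ.+ U) ℕ.+ (mB ℕ.+ B))
        lem = solve-∀-ℕ

    pairs : List (Carrier × Carrier)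
    pairs = List.map pair (filter good? (box n))

    Bounded : ℕ × ℕ × ℕ → Set ℓ
    Bounded t@(B , i , j) = (B ℕ.< n × i ℕ.< n × j ℕ.< n) × Good t

    bounded : All Bounded (filter good? (box n))
    bounded = All.tabulate bound
      where
      bound : ∀ {t} → t ∈ filter good? (box n) → Bounded t
      bound {t} t∈ with ∈-filter⁻ good? {xs = box n} t∈
      ... | t∈box , good with ∈-cartesianProduct⁻ (upTo n) (cartesianProduct (upTo n) (upTo n)) t∈box
      ... | B∈ , ij∈ with ∈-cartesianProduct⁻ (upTo n) (upTo n) ij∈
      ... | i∈ , j∈ = (∈-upTo⁻ B∈ , ∈-upTo⁻ i∈ , ∈-upTo⁻ j∈) , good

    -- Logarithms below `n` are unique: b determines `B`, then a determines `i`, and the equation of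
    -- the line determines `j`.
    distinct : ∀ {t t′} → Bounded t → Bounded t′ → t ≢ t′ → DistinctPairs (pair t) (pair t′)
    distinct {B , i , j} {B′ , i′ , j′} ((B<n , i<n , j<n) , _ , zech , _) ((B′<n , i′<n , j′<n) , _ , zech′ , _) t≢t′ (a≈ , b≈)
      with Cong-<⇒≡ B<n B′<n (^-inj b≈)
    ... | ≡.refl with Cong-<⇒≡ i<n i′<n (Cong-cancelʳ (offset B fst) (^-inj a≈))
    ... | ≡.refl with Cong-<⇒≡ j<n j′<n (^-inj (trans zech (sym zech′)))
    ... | ≡.refl = t≢t′ ≡.refl

    pairs-distinct : AllPairs DistinctPairs pairs
    pairs-distinct = AllPairsₚ.map⁺ (allPairs-from-unique distinct bounded
      (Uniqueₚ.filter⁺ good? (Uniqueₚ.cartesianProduct⁺ (Uniqueₚ.upTo⁺ n) (Uniqueₚ.cartesianProduct⁺ (Uniqueₚ.upTo⁺ n) (Uniqueₚ.upTo⁺ n)))))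

    pairs-primitive : All (λ { (a , b) → IsUVPrimitive u v a b }) pairs
    pairs-primitive = Allₚ.map⁺ (All.map (λ {(B , i , j)} p → good⇒primitive B i j (proj₂ p)) bounded)

    length-pairs : ι (length pairs) ≡ ∑ n (λ B → 𝟙 (coprime? B n) ℚ.* ∑∑ n (λ i j → K i j ℚ.* 𝟙 (primitive? B i j)))
    length-pairs = ≡.trans (≡.cong ι (Listₚ.length-map pair (filter good? (box n))))
      (≡.trans (length-filter good? (box n))
      (≡.trans (sumL-box n (λ t → 𝟙 (good? t)))
      (∑-cong n λ B → ≡.trans (∑∑-cong n λ i j → ≡.sym (≡.trans
          (≡.cong (𝟙 (coprime? B n) ℚ.*_) (𝟙-× (zech? i j) (primitive? B i j)))
          (𝟙-× (coprime? B n) (zech? i j ×-dec primitive? B i j))))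
        (∑∑-*ˡ n (𝟙 (coprime? B n)) (λ i j → K i j ℚ.* 𝟙 (primitive? B i j))))))

    enough : ∀ {b} → b ℚ.≤ ι (length pairs) → N≥ u v b
    enough {b} p = pairs , pairs-distinct , pairs-primitive , ≡.subst (b ℚ.≤_) (ι≡ℕtoℚ (length pairs)) p

-- Assembly of the bound, and the field with three elements.

open RingSolver using (solve-∀)
open import Data.Integer using (+_)
open RationalSums
open ResidueAverages
open CyclicUnits
open ZechLogarithms
open Multiplicativity
open Sieving
open Counting

lowerBound : ℕ → ℕ → List ℕ → ℚ → ℚ
lowerBound q k ps r = (θ k ℚ.* θ k) ℚ.* θ (q ℕ.∸ 1) ℚ.* ℕtoℚ (q ℕ.∸ 1)
  ℚ.* ((δ₃ ps ℚ.* τ k ℚ.* ℕtoℚ q) ℚ.- (θ k ℚ.* (W k ℚ.* W k ℚ.* W k) ℚ.* r))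

root-positive : ∀ q → 0 ℕ.< q → ∀ {r} → 0ℚ ℚ.≤ r → ℕtoℚ q ℚ.≤ r ℚ.* r → 0ℚ ℚ.< r
root-positive q 0<q {r} 0≤r q≤rr = ℚₚ.≰⇒> λ r≤0 → ℚₚ.<-irrefl ≡.refl (ℚₚ.<-≤-trans (0<ι q 0<q) (ℚₚ.≤-trans (ℚₚ.≤-reflexive (ι≡ℕtoℚ q))
  (ℚₚ.≤-trans q≤rr (≡.subst (r ℚ.* r ℚ.≤_) (ℚₚ.*-zeroʳ r) (*-monoˡ-≤ 0≤r r≤0)))))

module _ {c ℓ n} (F : FiniteField c ℓ (suc n)) {u v : FiniteField.Carrier F}
  (u≉0 : Powers.NonZero F u) (v≉0 : Powers.NonZero F v)
  {k ps} (ps-prime : All Prime ps) (ps-unique : Unique ps) (k*ps≡Rad : k ℕ.* product ps ≡ Rad n)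
  (0<δ₃ : 0ℚ ℚ.< δ₃ ps) {r} (0≤r : 0ℚ ℚ.≤ r) (q≤rr : ℕtoℚ (suc n) ℚ.≤ r ℚ.* r) where

  large-field : 3 ℕ.≤ n → FiniteField.N≥ F u v (lowerBound (suc n) k ps r)
  large-field 3≤n = C.enough (≡.subst₂ ℚ._≤_ (≡.sym bound≡) (≡.sym C.length-pairs) (S.sieve-bound (ℚₚ.<⇒≤ 0<δ₃)))
    where
    0<n : 0 ℕ.< n
    0<n = ℕₚ.≤-trans (ℕ.s≤s ℕ.z≤n) 3≤n
    root : PrimitiveRoot F n
    root = Cyclic.primitiveRoot F 0<n
    module C = PrimitivePairs F 0<n root u v u≉0 v≉0
    module Z = Zech F 0<n root
    module R = Radical {n} {k} {ps} 0<n ps-prime ps-unique k*ps≡Rad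
    module S = Sieve n 3≤n Z.K-line (λ i j → 𝟙-nonneg (Z.zech? i j))
      r (root-positive (suc n) (ℕ.s≤s ℕ.z≤n) 0≤r q≤rr) (≡.subst (ℚ._≤ r ℚ.* r) (≡.sym (ι≡ℕtoℚ (suc n))) q≤rr)
      C.U C.V (primeDivisors k) (primeDivisors-prime k) (primeDivisors-unique k) R.k∣n
      ps ps-prime R.ps∣n R.ps∉k R.split
    w : ℚ
    w = ι (2 ℕ.^ ω k)
    lem : ∀ t θ n d τ q w r →
      (t ℚ.* t) ℚ.* θ ℚ.* n ℚ.* ((d ℚ.* τ ℚ.* q) ℚ.- (t ℚ.* (w ℚ.* w ℚ.* w) ℚ.* r)) ≡
      (θ ℚ.* n) ℚ.* (d ℚ.* (q ℚ.* (t ℚ.* t ℚ.* τ)) ℚ.- (t ℚ.* t ℚ.* t) ℚ.* (w ℚ.* w ℚ.* w) ℚ.* r)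
    lem = solve-∀ ℚ-ring
    bound≡ : lowerBound (suc n) k ps r ≡ S.primitives ℚ.* (S.δ₀ ℚ.* (ι (suc n) ℚ.* prodL (primeDivisors k) generic-density) ℚ.- S.error)
    bound≡ = begin
      (θ k ℚ.* θ k) ℚ.* θ n ℚ.* ℕtoℚ n ℚ.* ((δ₃ ps ℚ.* τ k ℚ.* ℕtoℚ (suc n)) ℚ.- (θ k ℚ.* (W k ℚ.* W k ℚ.* W k) ℚ.* r))
        ≡⟨ ≡.cong₂ (λ x y → (θ k ℚ.* θ k) ℚ.* θ n ℚ.* x ℚ.* y) (≡.sym (ι≡ℕtoℚ n))
             (≡.cong₂ (λ x y → (δ₃ ps ℚ.* τ k ℚ.* x) ℚ.- (θ k ℚ.* (y ℚ.* y ℚ.* y) ℚ.* r))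
               (≡.sym (ι≡ℕtoℚ (suc n))) (≡.sym (ι≡ℕtoℚ (2 ℕ.^ ω k)))) ⟩
      (θ k ℚ.* θ k) ℚ.* θ n ℚ.* ι n ℚ.* ((δ₃ ps ℚ.* τ k ℚ.* ι (suc n)) ℚ.- (θ k ℚ.* (w ℚ.* w ℚ.* w) ℚ.* r))
        ≡⟨ lem (θ k) (θ n) (ι n) (δ₃ ps) (τ k) (ι (suc n)) w r ⟩
      (θ n ℚ.* ι n) ℚ.* (δ₃ ps ℚ.* (ι (suc n) ℚ.* (θ k ℚ.* θ k ℚ.* τ k)) ℚ.- (θ k ℚ.* θ k ℚ.* θ k) ℚ.* (w ℚ.* w ℚ.* w) ℚ.* r)
        -- θ(n) n = φ(n) is the number of choices of b.
        ≡⟨ ≡.cong₂ ℚ._*_ (≡.trans (θ-φ n 0<n) (φ-sum n 0<n))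
             (≡.cong₂ (λ x y → δ₃ ps ℚ.* (ι (suc n) ℚ.* x) ℚ.- y ℚ.* r) (≡.sym (generic-density-product k R.0<k))
               (≡.trans (≡.cong (λ t → (t ℚ.* t ℚ.* t) ℚ.* (w ℚ.* w ℚ.* w)) (θ-product k R.0<k))
                 (≡.sym (spread-bound-triples (primeDivisors k))))) ⟩
      S.primitives ℚ.* (S.δ₀ ℚ.* (ι (suc n) ℚ.* prodL (primeDivisors k) generic-density) ℚ.- S.error) ∎
      where open ≡.≡-Reasoning

-- Needed at p = 2: as 1 - 3/2 is negative, a positive `δ₃` keeps 2 out of `ps`.
δ₃≤ : ∀ {p ps} → p ∈ ps → δ₃ ps ℚ.≤ 1ℚ ℚ.- ι 3 ℚ.* inv p
δ₃≤ {p} {ps} p∈ps = ℚₚ.+-monoʳ-≤ 1ℚ (ℚₚ.neg-antimono-≤ (*-monoˡ-≤ (0≤ι 3) (sumL-≥ ps 0≤inv p∈ps)))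

δ₃≤1 : ∀ ps → δ₃ ps ℚ.≤ 1ℚ
δ₃≤1 ps = ≡.subst (δ₃ ps ℚ.≤_) (ℚₚ.+-identityʳ 1ℚ)
  (ℚₚ.+-monoʳ-≤ 1ℚ (ℚₚ.neg-antimono-≤ (*-nonneg (0≤ι 3) (sumL-nonneg ps 0≤inv))))

-- For q = 3 necessarily k = 2, and the bound is negative.
small-bound : ∀ k ps → All Prime ps → Unique ps → k ℕ.* product ps ≡ Rad 2 → 0ℚ ℚ.< δ₃ ps →
  ∀ r → 0ℚ ℚ.≤ r → ℕtoℚ 3 ℚ.≤ r ℚ.* r → lowerBound 3 k ps r ℚ.≤ 0ℚ
small-bound k ps ps-prime ps-unique k*ps≡2 0<δ₃ r 0≤r 3≤rr =
  ≡.subst (λ k → lowerBound 3 k ps r ℚ.≤ 0ℚ) (≡.sym k≡2) (at-2 (δ₃ ps) (δ₃≤1 ps))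
  where
  module R = Radical {2} {k} {ps} (ℕ.s≤s ℕ.z≤n) ps-prime ps-unique k*ps≡2
  k≡2 : k ≡ 2
  k≡2 with R.split prime[2] ℕ∣.∣-refl
  ... | inj₁ 2∈k  = ℕ∣.∣-antisym (≡.subst (k ℕ∣.∣_) k*ps≡2 (ℕ∣.m∣m*n (product ps))) (proj₂ (∈-primeDivisors⁻ k 2∈k))
  ... | inj₂ 2∈ps = ⊥-elim (toWitnessFalse {a? = 0ℚ ℚₚ.<? (1ℚ ℚ.- ι 3 ℚ.* inv 2)} _ (ℚₚ.<-≤-trans 0<δ₃ (δ₃≤ 2∈ps)))
  1≤r : 1ℚ ℚ.≤ r
  1≤r with ℚₚ.≤-total 1ℚ r
  ... | inj₁ p = p
  ... | inj₂ r≤1 = ⊥-elim (toWitnessFalse {a? = ℕtoℚ 3 ℚₚ.≤? 1ℚ} _ (ℚₚ.≤-trans 3≤rr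
          (ℚₚ.≤-trans (*-monoˡ-≤ 0≤r r≤1) (ℚₚ.≤-trans (ℚₚ.≤-reflexive (ℚₚ.*-identityʳ r)) r≤1))))
  -- With θ(2) = 1/2, τ(2) = 1 and W(2) = 2 the bound becomes (3 d - 4 r) / 4, which is negative for
  -- d ≤ 1 ≤ r.
  at-2 : ∀ d → d ℚ.≤ 1ℚ → (θ 2 ℚ.* θ 2) ℚ.* θ 2 ℚ.* ℕtoℚ 2 ℚ.* ((d ℚ.* τ 2 ℚ.* ℕtoℚ 3) ℚ.- (θ 2 ℚ.* (W 2 ℚ.* W 2 ℚ.* W 2) ℚ.* r)) ℚ.≤ 0ℚ
  at-2 d d≤1 = ≤-from-diff (≡.subst (0ℚ ℚ.≤_) (lem d r)
    (*-nonneg {x = (+ 1) / 4} (toWitness {a? = 0ℚ ℚₚ.≤? ((+ 1) / 4)} _)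
      (+-nonneg (+-nonneg (*-nonneg (0≤ι 3) (diff-from-≤ d≤1)) (*-nonneg (0≤ι 4) (diff-from-≤ 1≤r))) 0≤1)))
    where
    lem : ∀ d r → ((+ 1) / 4) ℚ.* (ι 3 ℚ.* (1ℚ ℚ.- d) ℚ.+ ι 4 ℚ.* (r ℚ.- 1ℚ) ℚ.+ 1ℚ) ≡
      0ℚ ℚ.- ((+ 1) / 4) ℚ.* (d ℚ.* 1ℚ ℚ.* ι 3 ℚ.- ι 4 ℚ.* r)
    lem = solve-∀ ℚ-ring

theorem5p4 : ∀ {c ℓ : Level} (q : ℕ) (F : FiniteField c ℓ q) →
    IsPrimePower q → 2 ℕ.< q →
    (u v : FiniteField.Carrier F) →
    ¬ (FiniteField._≈_ F u (FiniteField.0# F)) →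
    ¬ (FiniteField._≈_ F v (FiniteField.0# F)) →
    (k : ℕ) (ps : List ℕ) → All Prime ps → Unique ps →
    k ℕ.* product ps ≡ Rad (q ℕ.∸ 1) →
    0ℚ ℚ.< δ₃ ps →
    (r : ℚ) → 0ℚ ℚ.≤ r → ℕtoℚ q ℚ.≤ r ℚ.* r →
    FiniteField.N≥ F u v
    ((θ k ℚ.* θ k) ℚ.* θ (q ℕ.∸ 1) ℚ.* ℕtoℚ (q ℕ.∸ 1)
    ℚ.* ((δ₃ ps ℚ.* τ k ℚ.* ℕtoℚ q) ℚ.- (θ k ℚ.* (W k ℚ.* W k ℚ.* W k) ℚ.* r)))
theorem5p4 1 F _ (ℕ.s≤s ()) u v
theorem5p4 2 F _ (ℕ.s≤s (ℕ.s≤s ())) u v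
-- Below the range 4 ≤ q of the discrepancy bound; the empty list suffices.
theorem5p4 3 F _ _ u v _ _ k ps primes uniq k*ps≡Rad 0<δ₃ r 0≤r q≤rr =
  [] , [] , [] , small-bound k ps primes uniq k*ps≡Rad 0<δ₃ r 0≤r q≤rr
theorem5p4 (suc (suc (suc (suc n)))) F _ _ u v u≉0 v≉0 k ps primes uniq k*ps≡Rad 0<δ₃ r 0≤r q≤rr =
  large-field F u≉0 v≉0 {k = k} {ps = ps} primes uniq k*ps≡Rad 0<δ₃ 0≤r q≤rr (ℕ.s≤s (ℕ.s≤s (ℕ.s≤s ℕ.z≤n)))
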